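{- The single facility upgrading maximal covering location problem, 1-Up-MCLP, can be solved in $O(n^3)$ time on path networks, where $n$ is the number of nodes. That is, there is an algorithm which, given any instance of the 1-Up-MCLP whose network is a path (with arbitrary weights, lengths, upgrading costs and upgrading bounds), computes an optimal solution $(X_1,\delta)$ in $O(n^3)$ time.
   Context: Problem $p$-Up-MCLP. An instance consists of: an undirected network $N=(V,E,\ell)$ with finite node set $V$, $|V|=n$, edge set $E$ and positive edge lengths $\ell_e$, $e\in E$; non-negative node weights $w_i$, $i\in V$; a coverage radius $R>0$; upgrading bounds $u_e\in[0,\ell_e)$, $e\in E$; upgrading costs per unit $c_e\in\mathbb{R}^+$, $e\in E$; a budget $B\in\mathbb{R}^+$; and a number $p\in\mathbb{N}$ of facilities, $p\le|V|$. For a vector of reductions $\delta=(\delta_e)_{e\in E}$ with $0\le\delta_e\le u_e$, $d(i,j,\delta)$ is the length of a shortest path between $i$ and $j$ in the network where each edge $e$ has length $\ell_e-\delta_e$. For $X\subseteq V$ let $C(X,\delta)=\{i\in V \mid \exists j\in X:\ d(i,j,\delta)\le R\}$ be the set of covered nodes. A feasible solution is a pair $(X_p,\delta)$ with $X_p\subseteq V$, $|X_p|=p$, $0\le\delta_e\le u_e$ for all $e\in E$, and $\sum_{e\in E}c_e\delta_e\le B$; the objective is to maximise $\sum_{i\in C(X_p,\delta)}w_i$. The 1-Up-MCLP is the case $p=1$. Running time counts elementary arithmetic operations and comparisons on the input numbers, each at unit cost. -}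

module Defs where

open import Algebra.Bundles using (CommutativeRing)
open import Algebra.Core using (Op₁)
import Algebra.Definitions.RawMonoid as RawMonoidDefinitions
open import Data.Bool.Base using (Bool; true; false; _∧_; if_then_else_)
import Data.Bool.Base as Bool
open import Data.Fin.Base using (Fin; toℕ; inject₁)
open import Data.Fin.Subset using (Subset; ⁅_⁆; _∈_; ∣_∣)
open import Data.List.Base using (List; []; _∷_)
open import Data.List.Relation.Unary.Unique.Propositional using (Unique)
open import Data.Nat.Base as ℕ using (ℕ; _≡ᵇ_; _≤ᵇ_)
open import Data.Product.Base using (Σ; _×_; _,_; proj₁; proj₂)
open import Data.Sum.Base using (_⊎_)
open import Data.Vec.Base using (lookup)
open import Function.Bundles using (_↔_; _⇔_; Inverse)
open import Level using (_⊔_)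
import Level
open import Relation.Binary.Core using (Rel)
open import Relation.Binary.PropositionalEquality.Core using (_≡_)
open import Relation.Binary.Structures using (IsDecTotalOrder)
import Relation.Binary.Construct.NonStrictToStrict as ToStrict
open import Relation.Nullary.Decidable.Core using (⌊_⌋)
open import Relation.Nullary.Negation.Core using (¬_)

-- The numbers.  The reals are (classically) one such field; the order is
-- decidable because comparison is an elementary operation.  The value of 0# ⁻¹
-- is unspecified.

record OrderedField c ℓ₁ ℓ₂ : Set (Level.suc (c ⊔ ℓ₁ ⊔ ℓ₂)) where
  infix 8 _⁻¹
  infix 4 _≤_
  field
    commutativeRing : CommutativeRing c ℓ₁
  open CommutativeRing commutativeRing public
  field
    _≤_             : Rel Carrier ℓ₂
    isDecTotalOrder : IsDecTotalOrder _≈_ _≤_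
    _⁻¹             : Op₁ Carrier
    0≉1             : ¬ 0# ≈ 1#
    ⁻¹-cong         : ∀ {x y} → x ≈ y → x ⁻¹ ≈ y ⁻¹
    *-inverseʳ      : ∀ x → ¬ x ≈ 0# → x * x ⁻¹ ≈ 1#
    +-monoʳ-≤       : ∀ z {x y} → x ≤ y → z + x ≤ z + y
    *-nonNegative   : ∀ {x y} → 0# ≤ x → 0# ≤ y → 0# ≤ x * y

  open IsDecTotalOrder isDecTotalOrder public using (_≤?_)
  open ToStrict _≈_ _≤_ public using (_<_)
  open RawMonoidDefinitions +-rawMonoid public using (sum)

-- Finite simple undirected graphs: an edge is stored as an ordered pair of
-- end nodes, in an orientation that carries no meaning.

record Graph : Set where
  field
    #nodes #edges : ℕ

  Node : Set
  Node = Fin #nodes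

  Edge : Set
  Edge = Fin #edges

  field
    ends : Edge → Node × Node

  Joins : Edge → Node → Node → Set
  Joins e i j = ends e ≡ (i , j) ⊎ ends e ≡ (j , i)

  field
    loopless : ∀ e i → ¬ Joins e i i
    simple   : ∀ e f i j → Joins e i j → Joins f i j → e ≡ f

module Walks (G : Graph) where
  open Graph G

  infixr 5 _∷_
  data Walk : Node → Node → Set where
    []  : ∀ {i} → Walk i i
    _∷_ : ∀ {e i j k} → Joins e i k → Walk k j → Walk i j

  nodes : ∀ {i j} → Walk i j → List Node
  nodes {i} []      = i ∷ []
  nodes {i} (_ ∷ w) = i ∷ nodes w

  Path : Node → Node → Set
  Path i j = Σ (Walk i j) λ w → Unique (nodes w)

-- The nodes can be listed as v₀, …, vₘ and the edges as e₀, …, eₘ₋₁ so that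
-- eₖ joins vₖ and vₖ₊₁.  The given numbering of nodes and edges is arbitrary.

record IsPath (G : Graph) : Set where
  open Graph G
  field
    nodeAt : Fin (ℕ.suc #edges) ↔ Node
    edgeAt : Fin #edges ↔ Edge
    joins  : ∀ k → Joins (Inverse.to edgeAt k)
                         (Inverse.to nodeAt (inject₁ k))
                         (Inverse.to nodeAt (Fin.suc k))

module UpMCLP {c ℓ₁ ℓ₂} (K : OrderedField c ℓ₁ ℓ₂) where
  open OrderedField K

  record Instance : Set (c ⊔ ℓ₁ ⊔ ℓ₂) where
    field
      graph : Graph
    open Graph graph public
    open Walks graph public
    field
      len    : Edge → Carrier
      weight : Node → Carrier
      radius : Carrier
      bound  : Edge → Carrier
      cost   : Edge → Carrier
      budget : Carrier
      p      : ℕ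
      0<len     : ∀ e → 0# < len e
      0≤weight  : ∀ i → 0# ≤ weight i
      0<radius  : 0# < radius
      0≤bound   : ∀ e → 0# ≤ bound e
      bound<len : ∀ e → bound e < len e
      0<cost    : ∀ e → 0# < cost e
      0<budget  : 0# < budget
      p≤#nodes  : p ℕ.≤ #nodes

  module _ (I : Instance) where
    open Instance I

    Reduction : Set c
    Reduction = Edge → Carrier

    walkLength : Reduction → ∀ {i j} → Walk i j → Carrier
    walkLength δ []            = 0#
    walkLength δ (_∷_ {e} _ w) = (len e - δ e) + walkLength δ w

    pathLength : Reduction → ∀ {i j} → Path i j → Carrier
    pathLength δ (w , _) = walkLength δ w

    IsShortest : Reduction → ∀ {i j} → Path i j → Set ℓ₂
    IsShortest δ {i} {j} P = ∀ (Q : Path i j) → pathLength δ P ≤ pathLength δ Q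

    -- d(i,j,δ) ≈ d.  No d qualifies when j cannot be reached from i.
    IsDistance : Node → Node → Reduction → Carrier → Set (ℓ₁ ⊔ ℓ₂)
    IsDistance i j δ d =
      Σ (Path i j) λ P → IsShortest δ P × pathLength δ P ≈ d

    Covered : Subset #nodes → Reduction → Node → Set (c ⊔ ℓ₁ ⊔ ℓ₂)
    Covered X δ i =
      Σ Node λ j → j ∈ X × (Σ Carrier λ d → IsDistance i j δ d × d ≤ radius)

    -- C = C(X,δ).  Such a C is unique, and it exists because there are finitely
    -- many paths and the order is decidable.
    IsCoverage : Subset #nodes → Reduction → Subset #nodes → Set (c ⊔ ℓ₁ ⊔ ℓ₂)
    IsCoverage X δ C = ∀ i → i ∈ C ⇔ Covered X δ i

    totalWeight : Subset #nodes → Carrier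
    totalWeight C = sum λ i → if lookup C i then weight i else 0#

    Solution : Set c
    Solution = Subset #nodes × Reduction

    record IsFeasible (s : Solution) : Set (c ⊔ ℓ₁ ⊔ ℓ₂) where
      private
        X = proj₁ s
        δ = proj₂ s
      field
        ∣X∣≡p        : ∣ X ∣ ≡ p
        0≤δ          : ∀ e → 0# ≤ δ e
        δ≤bound      : ∀ e → δ e ≤ bound e
        withinBudget : sum (λ e → cost e * δ e) ≤ budget

    HasValue : Solution → Carrier → Set (c ⊔ ℓ₁ ⊔ ℓ₂)
    HasValue (X , δ) v =
      Σ (Subset #nodes) λ C → IsCoverage X δ C × totalWeight C ≈ v

    IsOptimal : Solution → Set (c ⊔ ℓ₁ ⊔ ℓ₂)
    IsOptimal s = IsFeasible s × (Σ Carrier λ v → HasValue s v ×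
      (∀ s′ v′ → IsFeasible s′ → HasValue s′ v′ → v′ ≤ v))

-- Programs for a unit-cost random access machine.  Its memory consists of
-- arrays of indices (natural numbers) and arrays of numbers (field elements);
-- arrays are named by natural numbers, and a scalar is kept at position 0 of
-- an array.  Field elements are never converted to indices, and a program does
-- not depend on the field.

infixl 6 _⊕_ _⊖_ _+̂_ _-̂_
infixl 7 _*̂_ _/̂_
infix  4 _≤ᵢ_ _≤ₙ_
infix  3 _[_]≔ᵢ_ _[_]≔ₙ_
infixr 2 _⨾_

data IndexExp : Set where
  lit     : ℕ → IndexExp
  idx[_]_ : (array : ℕ) (position : IndexExp) → IndexExp
  _⊕_ _⊖_ : IndexExp → IndexExp → IndexExp      -- ⊖ is truncated at 0

data NumExp : Set where
  0̂ 1̂                 : NumExp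
  num[_]_             : (array : ℕ) (position : IndexExp) → NumExp
  _+̂_ _-̂_ _*̂_ _/̂_ : NumExp → NumExp → NumExp

data Test : Set where
  _≤ᵢ_ : IndexExp → IndexExp → Test
  _≤ₙ_ : NumExp → NumExp → Test
  not  : Test → Test

data Program : Set where
  skip          : Program
  _[_]≔ᵢ_       : (array : ℕ) (position value : IndexExp) → Program
  _[_]≔ₙ_       : (array : ℕ) (position : IndexExp) (value : NumExp) → Program
  _⨾_           : Program → Program → Program
  If_Then_Else_ : Test → Program → Program → Program
  While_Do_     : Test → Program → Program

-- Every operation, constant and memory access costs one unit.

indexTime : IndexExp → ℕ
indexTime (lit _)      = 1
indexTime (idx[ _ ] e) = 1 ℕ.+ indexTime e
indexTime (e ⊕ f)      = 1 ℕ.+ indexTime e ℕ.+ indexTime f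
indexTime (e ⊖ f)      = 1 ℕ.+ indexTime e ℕ.+ indexTime f

numTime : NumExp → ℕ
numTime 0̂            = 1
numTime 1̂            = 1
numTime (num[ _ ] e) = 1 ℕ.+ indexTime e
numTime (x +̂ y)      = 1 ℕ.+ numTime x ℕ.+ numTime y
numTime (x -̂ y)      = 1 ℕ.+ numTime x ℕ.+ numTime y
numTime (x *̂ y)      = 1 ℕ.+ numTime x ℕ.+ numTime y
numTime (x /̂ y)      = 1 ℕ.+ numTime x ℕ.+ numTime y

testTime : Test → ℕ
testTime (e ≤ᵢ f) = 1 ℕ.+ indexTime e ℕ.+ indexTime f
testTime (x ≤ₙ y) = 1 ℕ.+ numTime x ℕ.+ numTime y
testTime (not b)  = 1 ℕ.+ testTime b

Memory : ∀ {a} → Set a → Set a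
Memory A = (array position : ℕ) → A

write : ∀ {a} {A : Set a} → Memory A → ℕ → ℕ → A → Memory A
write M a i x b j = if (a ≡ᵇ b) ∧ (i ≡ᵇ j) then x else M b j

module Machine {c ℓ₁ ℓ₂} (K : OrderedField c ℓ₁ ℓ₂) where
  open OrderedField K

  record State : Set c where
    constructor ⟪_,_⟫
    field
      idx : Memory ℕ
      num : Memory Carrier
  open State public

  evalIndex : State → IndexExp → ℕ
  evalIndex s (lit n)      = n
  evalIndex s (idx[ a ] e) = idx s a (evalIndex s e)
  evalIndex s (e ⊕ f)      = evalIndex s e ℕ.+ evalIndex s f
  evalIndex s (e ⊖ f)      = evalIndex s e ℕ.∸ evalIndex s f

  evalNum : State → NumExp → Carrier
  evalNum s 0̂            = 0#
  evalNum s 1̂            = 1#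
  evalNum s (num[ a ] e) = num s a (evalIndex s e)
  evalNum s (x +̂ y)      = evalNum s x + evalNum s y
  evalNum s (x -̂ y)      = evalNum s x - evalNum s y
  evalNum s (x *̂ y)      = evalNum s x * evalNum s y
  evalNum s (x /̂ y)      = evalNum s x * (evalNum s y) ⁻¹

  evalTest : State → Test → Bool
  evalTest s (e ≤ᵢ f) = evalIndex s e ≤ᵇ evalIndex s f
  evalTest s (x ≤ₙ y) = ⌊ evalNum s x ≤? evalNum s y ⌋
  evalTest s (not b)  = Bool.not (evalTest s b)

  -- s ⊢ P ⇓[ t ] s′: started in s, P halts in s′ after t time units.

  infix 1 _⊢_⇓[_]_
  data _⊢_⇓[_]_ : State → Program → ℕ → State → Set c where
    skip : ∀ {s} → s ⊢ skip ⇓[ 1 ] s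
    setᵢ : ∀ {s a e f} →
           s ⊢ a [ e ]≔ᵢ f ⇓[ 1 ℕ.+ indexTime e ℕ.+ indexTime f ]
             ⟪ write (idx s) a (evalIndex s e) (evalIndex s f) , num s ⟫
    setₙ : ∀ {s a e x} →
           s ⊢ a [ e ]≔ₙ x ⇓[ 1 ℕ.+ indexTime e ℕ.+ numTime x ]
             ⟪ idx s , write (num s) a (evalIndex s e) (evalNum s x) ⟫
    seq  : ∀ {s s′ s″ P Q t t′} →
           s ⊢ P ⇓[ t ] s′ → s′ ⊢ Q ⇓[ t′ ] s″ →
           s ⊢ P ⨾ Q ⇓[ t ℕ.+ t′ ] s″
    ifᵗ  : ∀ {s s′ b P Q t} → evalTest s b ≡ true →
           s ⊢ P ⇓[ t ] s′ →
           s ⊢ If b Then P Else Q ⇓[ 1 ℕ.+ testTime b ℕ.+ t ] s′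
    ifᶠ  : ∀ {s s′ b P Q t} → evalTest s b ≡ false →
           s ⊢ Q ⇓[ t ] s′ →
           s ⊢ If b Then P Else Q ⇓[ 1 ℕ.+ testTime b ℕ.+ t ] s′
    loop : ∀ {s s′ s″ b P t t′} → evalTest s b ≡ true →
           s ⊢ P ⇓[ t ] s′ → s′ ⊢ While b Do P ⇓[ t′ ] s″ →
           s ⊢ While b Do P ⇓[ 1 ℕ.+ testTime b ℕ.+ t ℕ.+ t′ ] s″
    exit : ∀ {s b P} → evalTest s b ≡ false →
           s ⊢ While b Do P ⇓[ 1 ℕ.+ testTime b ] s

pad : ∀ {a} {A : Set a} {n} → A → (Fin n → A) → ℕ → A
pad {n = ℕ.zero}  d f _         = d
pad {n = ℕ.suc n} d f ℕ.zero    = f Fin.zero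
pad {n = ℕ.suc n} d f (ℕ.suc i) = pad d (λ j → f (Fin.suc j)) i

scalar : ∀ {a} {A : Set a} → A → A → ℕ → A
scalar d x = pad {n = 1} d (λ _ → x)

-- Array names: 0–3 are input and 4 is output among the index arrays; 0–5 are
-- input and 6 is output among the number arrays.
pattern nodeCount = 0
pattern edgeCount = 1
pattern end₁      = 2
pattern end₂      = 3
pattern facility  = 4

pattern lengths    = 0
pattern weights    = 1
pattern radius₀    = 2
pattern bounds     = 3
pattern costs      = 4
pattern budget₀    = 5
pattern reductions = 6

module SingleFacility {c ℓ₁ ℓ₂} (K : OrderedField c ℓ₁ ℓ₂) where
  open OrderedField K
  open UpMCLP K public
  open Machine K public

  module _ (I : Instance) where
    private module I = Instance I

    -- All memory not used for the input holds 0.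
    input : State
    input .idx nodeCount = scalar 0 I.#nodes
    input .idx edgeCount = scalar 0 I.#edges
    input .idx end₁      = pad 0 λ e → toℕ (proj₁ (I.ends e))
    input .idx end₂      = pad 0 λ e → toℕ (proj₂ (I.ends e))
    input .idx _         = λ _ → 0
    input .num lengths   = pad 0# I.len
    input .num weights   = pad 0# I.weight
    input .num radius₀   = scalar 0# I.radius
    input .num bounds    = pad 0# I.bound
    input .num costs     = pad 0# I.cost
    input .num budget₀   = scalar 0# I.budget
    input .num _         = λ _ → 0#

    output : State → I.Node → Solution I
    output s x = ⁅ x ⁆ , λ e → num s reductions (toℕ e)

    record OutputsOptimum (s : State) : Set (c ⊔ ℓ₁ ⊔ ℓ₂) where
      field
        location : I.Node
        stored   : idx s facility 0 ≡ toℕ location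
        optimal  : IsOptimal I (output s location)

    Solves_within_ : Program → ℕ → Set (c ⊔ ℓ₁ ⊔ ℓ₂)
    Solves_within_ P T = Σ State λ s → Σ ℕ λ t →
      (input ⊢ P ⇓[ t ] s) × t ℕ.≤ T × OutputsOptimum s

{-# OPTIONS --safe #-}

-- On a path the nodes covered from a centre x lie in an interval a ≤ x ≤ b, and
-- the two sides of x do not interact: an interval can be afforded exactly when
-- the cheapest way to bring a within the radius plus the cheapest way for b fit
-- the budget.  Each of these is a continuous knapsack problem: the distance has
-- to drop by a given amount, so one reduces the edges in between in order of
-- increasing cost, each up to its bound.  After sorting the edges once this
-- takes O(n) time per pair of nodes; then all O(n³) triples a ≤ x ≤ b are
-- compared, with the weight of [a, b] accumulated along b.
--
-- Optimality of the greedy reductions δ is by exchange against the price λ of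
-- the last edge used: (C e − λ)(δ e − y) ≤ 0 for every admissible y, so summing
-- over the edges compares costs whenever the other solution reduces at least
-- as much in total.

module Submission where

open import Defs
open import Data.Bool.Base using (Bool; true; false; _∧_; _∨_; if_then_else_; T)
import Data.Bool.Base as Bool
open import Data.Bool.Properties using (T-≡; T-not-≡; ∧-zeroʳ; ¬-not)
open import Data.Empty using (⊥)
open import Data.Fin.Base as Fin using (Fin; toℕ; fromℕ<; inject₁; opposite)
open import Data.Fin.Permutation using (Permutation; permutation; _⟨$⟩ʳ_; _⟨$⟩ˡ_; _∘ₚ_; inverseˡ; inverseʳ; ↔⇒≡)
import Data.Fin.Permutation as Permutation
open import Data.Fin.Properties
  using (toℕ-injective; toℕ<n; toℕ-fromℕ<; toℕ-fromℕ; toℕ-inject₁; any?; punchOut-injective; injective⇒≤; _≟_)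
open import Data.Fin.Subset using (Subset; ⁅_⁆; _∈_; ∣_∣)
open import Data.Fin.Subset.Properties using (∣⁅x⁆∣≡1; x∈⁅x⁆; x∈⁅y⁆⇒x≡y)
open import Data.List.Relation.Unary.All as All using (All; []; _∷_)
open import Data.List.Relation.Unary.AllPairs.Core using ([]; _∷_)
open import Data.List.Relation.Unary.Unique.Propositional using (Unique)
open import Data.Nat.Base as ℕ
  using (ℕ; zero; suc; z≤n; s≤s; _≡ᵇ_; _≤′_; ≤′-reflexive; ≤′-step; _≤‴_; ≤‴-reflexive; ≤‴-step)
import Data.Nat.Properties as ℕ
open import Data.Nat.Solver using (module +-*-Solver)
open import Data.Product.Base using (Σ; _×_; _,_; proj₁; proj₂)
import Data.Product.Properties as Product
open import Data.Sum.Base as Sum using (_⊎_; inj₁; inj₂)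
open import Data.Unit.Base using (⊤; tt)
open import Data.Vec.Base using ([]; _∷_; here; there; lookup; tabulate)
open import Data.Vec.Properties using (lookup∘tabulate; []=⇒lookup; lookup⇒[]=)
open import Function.Base using (_∘_)
open import Function.Bundles using (Equivalence; Inverse; mk⇔)
open import Function.Definitions using (Injective)
import Level
open import Relation.Binary.Definitions using (tri<; tri≈; tri>)
open import Relation.Binary.PropositionalEquality.Core as ≡ using (_≡_)
open import Relation.Binary.Structures using (IsDecTotalOrder)
open import Relation.Nullary.Decidable using (Dec; yes; no; ⌊_⌋; _×-dec_; isYes≗does; dec-true)
open import Relation.Nullary.Negation using (¬_; contradiction)

-- The search never computes the set covered by a candidate; it only compares weights of intervals.
-- Two inequalities close the gap, both resting on non-negative weights: the solution returned
-- covers at least its interval, and whatever a competitor covers lies in an interval that the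
-- competitor's own reductions make affordable. The listing of the path in `IsPath` is not part of
-- the input. The machine has to recover one from arbitrarily numbered nodes and edges and may find
-- the opposite direction, so the later arguments refer to the listing that it found. The time bound
-- is read off from syntax: programs are written with counting loops only, so execution is a
-- function, and three nested loops with limits at most n give the exponent 3. During the search
-- only the prices seen from the current centre are kept; the reductions for the best triple are
-- computed anew at the end.

T⇒≡ : ∀ {b} → T b → b ≡ true
T⇒≡ = Equivalence.to T-≡

≤ᵇ≡true⇒≤ : ∀ {m n} → (m ℕ.≤ᵇ n) ≡ true → m ℕ.≤ n
≤ᵇ≡true⇒≤ m≤ᵇn = ℕ.≤ᵇ⇒≤ _ _ (Equivalence.from T-≡ m≤ᵇn)

≤ᵇ≡false⇒> : ∀ {m n} → (m ℕ.≤ᵇ n) ≡ false → n ℕ.< m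
≤ᵇ≡false⇒> m≰ᵇn = ℕ.≰⇒> (λ m≤n → contradiction (≡.trans (≡.sym (T⇒≡ (ℕ.≤⇒≤ᵇ m≤n))) m≰ᵇn) (λ ()))

≰⇒≤ᵇ≡false : ∀ {m n} → ¬ m ℕ.≤ n → (m ℕ.≤ᵇ n) ≡ false
≰⇒≤ᵇ≡false m≰n = ¬-not (m≰n ∘ ≤ᵇ≡true⇒≤)

<suc-elim : ∀ {ℓ k} (P : ℕ → Set ℓ) → (∀ {i} → i ℕ.< k → P i) → P k → ∀ {i} → i ℕ.< suc k → P i
<suc-elim P below at {i} i<1+k with ℕ.m≤n⇒m<n∨m≡n (ℕ.≤-pred i<1+k)
... | inj₁ i<k    = below i<k
... | inj₂ ≡.refl = at

-- Programs with counting loops, and their time bound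

infixr 2 _⨾_
infixr 2.5 IF_THEN_ELSE_ FOR_BELOW_DO_
infix  3 _[_]≔ᵢ_ _[_]≔ₙ_

-- Without general loops every code terminates. Its meaning can therefore be a total function,
-- `exec`, and correctness is proved about that function; derivations of the machine's evaluation
-- relation are built once, in `compile-correct`.
data Code : Set where
  skip            : Code
  _[_]≔ᵢ_         : (array : ℕ) (position value : IndexExp) → Code
  _[_]≔ₙ_         : (array : ℕ) (position : IndexExp) (value : NumExp) → Code
  _⨾_             : Code → Code → Code
  IF_THEN_ELSE_   : Test → Code → Code → Code
  FOR_BELOW_DO_   : (counter limit : ℕ) → Code → Code

scalarᵢ : ℕ → IndexExp
scalarᵢ a = idx[ a ] lit 0

scalarₙ : ℕ → NumExp
scalarₙ a = num[ a ] lit 0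

increment : ℕ → Program
increment i = i [ lit 0 ]≔ᵢ (lit 1 ⊕ scalarᵢ i)

compile : Code → Program
compile skip                  = skip
compile (a [ e ]≔ᵢ f)         = a [ e ]≔ᵢ f
compile (a [ e ]≔ₙ x)         = a [ e ]≔ₙ x
compile (c ⨾ d)               = compile c ⨾ compile d
compile (IF b THEN c ELSE d)  = If b Then compile c Else compile d
compile (FOR i BELOW N DO c)  =
  i [ lit 0 ]≔ᵢ lit 0 ⨾
  While lit 1 ⊕ scalarᵢ i ≤ᵢ scalarᵢ N Do (compile c ⨾ increment i)

writesᵢ writesₙ : Code → ℕ → Bool
writesᵢ skip                 b = false
writesᵢ (a [ _ ]≔ᵢ _)        b = a ≡ᵇ b
writesᵢ (_ [ _ ]≔ₙ _)        b = false
writesᵢ (c ⨾ d)              b = writesᵢ c b ∨ writesᵢ d b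
writesᵢ (IF _ THEN c ELSE d) b = writesᵢ c b ∨ writesᵢ d b
writesᵢ (FOR i BELOW _ DO c) b = (i ≡ᵇ b) ∨ writesᵢ c b

writesₙ skip                 b = false
writesₙ (_ [ _ ]≔ᵢ _)        b = false
writesₙ (a [ _ ]≔ₙ _)        b = a ≡ᵇ b
writesₙ (c ⨾ d)              b = writesₙ c b ∨ writesₙ d b
writesₙ (IF _ THEN c ELSE d) b = writesₙ c b ∨ writesₙ d b
writesₙ (FOR _ BELOW _ DO c) b = writesₙ c b

-- Phrased as a Boolean test so that for concrete code and a concrete array it computes to the unit
-- type: such side conditions are filled in automatically as implicit arguments or underscores.
Preservesᵢ Preservesₙ : Code → ℕ → Set
Preservesᵢ c a = T (Bool.not (writesᵢ c a))
Preservesₙ c a = T (Bool.not (writesₙ c a))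

-- Loops are nested at most d deep, every limit is the node count or the edge
-- count, these two are never written, and no loop body writes its own counter.
Nested : ℕ → Code → Set
Nested d       skip                 = ⊤
Nested d       (a [ _ ]≔ᵢ _)        = T (2 ℕ.≤ᵇ a)
Nested d       (_ [ _ ]≔ₙ _)        = ⊤
Nested d       (c ⨾ e)              = Nested d c × Nested d e
Nested d       (IF _ THEN c ELSE e) = Nested d c × Nested d e
Nested zero    (FOR i BELOW N DO c) = ⊥
Nested (suc d) (FOR i BELOW N DO c) =
  T (2 ℕ.≤ᵇ i) × T (N ℕ.≤ᵇ 1) × Preservesᵢ c i × Nested d c

-- Code of depth d runs in time timeFactor · nᵈ.  A loop spends 11 units on
-- setting its counter and on the last test, and 14 per iteration on the other
-- tests and on the increment.
timeFactor : Code → ℕ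
timeFactor skip                 = 1
timeFactor (_ [ e ]≔ᵢ f)        = 1 ℕ.+ indexTime e ℕ.+ indexTime f
timeFactor (_ [ e ]≔ₙ x)        = 1 ℕ.+ indexTime e ℕ.+ numTime x
timeFactor (c ⨾ d)              = timeFactor c ℕ.+ timeFactor d
timeFactor (IF b THEN c ELSE d) = 1 ℕ.+ testTime b ℕ.+ (timeFactor c ℕ.+ timeFactor d)
timeFactor (FOR _ BELOW _ DO c) = 11 ℕ.+ (14 ℕ.+ timeFactor c)

iterate : ∀ {a} {A : Set a} → ℕ → (A → A) → A → A
iterate zero    f x = x
iterate (suc n) f x = f (iterate n f x)

-- Memory updates.

≡ᵇ-refl : ∀ n → (n ≡ᵇ n) ≡ true
≡ᵇ-refl n = T⇒≡ (ℕ.≡⇒≡ᵇ n n ≡.refl)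

≢⇒≡ᵇ≡false : ∀ {m n} → ¬ m ≡ n → (m ≡ᵇ n) ≡ false
≢⇒≡ᵇ≡false {m} {n} m≢n = ¬-not (λ eq → m≢n (ℕ.≡ᵇ⇒≡ m n (Equivalence.from T-≡ eq)))

module _ {a} {A : Set a} where

  write-same : ∀ (M : Memory A) b i x → write M b i x b i ≡ x
  write-same M b i x rewrite ≡ᵇ-refl b | ≡ᵇ-refl i = ≡.refl

  write-position≢ : ∀ (M : Memory A) b {i j} x → ¬ i ≡ j → write M b i x b j ≡ M b j
  write-position≢ M b x i≢j rewrite ≢⇒≡ᵇ≡false i≢j | ∧-zeroʳ (b ≡ᵇ b) = ≡.refl

  write-array≢ : ∀ (M : Memory A) b {b′} i x j → (b ≡ᵇ b′) ≡ false → write M b i x b′ j ≡ M b′ j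
  write-array≢ M b i x j b≢b′ rewrite b≢b′ = ≡.refl

-- A loop test costs 8 units and an increment of the counter 6. One 8 is kept aside for the final,
-- failing test.
loop-arithmetic : ∀ x y → 8 ℕ.+ (x ℕ.+ 6) ℕ.+ (8 ℕ.+ y) ≡ 8 ℕ.+ (14 ℕ.+ x ℕ.+ y)
loop-arithmetic = solve 2 (λ x y → con 8 :+ (x :+ con 6) :+ (con 8 :+ y) := con 8 :+ (con 14 :+ x :+ y)) ≡.refl
  where open +-*-Solver

loop-factor : ∀ n x f → 11 ℕ.* (n ℕ.* x) ℕ.+ n ℕ.* (14 ℕ.* x ℕ.+ f ℕ.* x) ≡ (11 ℕ.+ (14 ℕ.+ f)) ℕ.* (n ℕ.* x)
loop-factor = solve 3 (λ n x f → con 11 :* (n :* x) :+ n :* (con 14 :* x :+ f :* x)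
                              := (con 11 :+ (con 14 :+ f)) :* (n :* x)) ≡.refl
  where open +-*-Solver

-- The algorithm

-- Scratch arrays, first of indices and then of numbers.  From nodeOrder and
-- edgeOrder on, nodes and edges are named by their position on the path;
-- shortfallTo and spentTo belong to the current centre.
pattern current    = 5
pattern previous   = 6
pattern found      = 7
pattern next       = 8
pattern endpoint   = 9
pattern nodeOrder  = 10
pattern edgeOrder  = 11
pattern rank       = 12
pattern sorted     = 13
pattern low        = 14
pattern high       = 15
pattern bestLow    = 16
pattern bestCentre = 17
pattern bestHigh   = 18
pattern outer      = 19
pattern middle     = 20
pattern inner      = 21

pattern lengthAt     = 7
pattern boundAt      = 8
pattern costAt       = 9
pattern weightAt     = 10
pattern reductionAt  = 11
pattern shortfall    = 12
pattern spent        = 13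
pattern shortfallTo  = 14
pattern spentTo      = 15
pattern bestWeight   = 16
pattern weightSoFar  = 17

infix 4 _=ᵢ_
-- The machine only compares by `≤`. Two naturals are equal when both truncated differences vanish.
_=ᵢ_ : IndexExp → IndexExp → Test
e =ᵢ f = (e ⊖ f) ⊕ (f ⊖ e) ≤ᵢ lit 0

infix 3 _≔ᵢ_ _≔ₙ_
_≔ᵢ_ : ℕ → IndexExp → Code
a ≔ᵢ e = a [ lit 0 ]≔ᵢ e

_≔ₙ_ : ℕ → NumExp → Code
a ≔ₙ x = a [ lit 0 ]≔ₙ x

-- Edge e is recorded as e + 1, so that 0 means no edge.
follow : ℕ → Code
follow far = found ≔ᵢ lit 1 ⊕ scalarᵢ inner ⨾ next ≔ᵢ idx[ far ] scalarᵢ inner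

-- Excluding `previous` keeps the walk along the path from turning back. A later hit overwrites an
-- earlier one, so the specification only promises some incident edge. A full scan per node is
-- quadratic in total, which the cubic bound allows.
inspect : Code
inspect =
  IF lit 1 ⊕ scalarᵢ inner =ᵢ scalarᵢ previous THEN skip ELSE
  IF idx[ end₁ ] scalarᵢ inner =ᵢ scalarᵢ current THEN follow end₂ ELSE
  IF idx[ end₂ ] scalarᵢ inner =ᵢ scalarᵢ current THEN follow end₁ ELSE skip

scan : Code
scan = found ≔ᵢ lit 0 ⨾ FOR inner BELOW edgeCount DO inspect

-- A node is an end of the path when it has at most one edge: the second scan excludes the edge
-- found by the first. On a path with a single node both scans find nothing, which is accepted as
-- well.
testNode : Code
testNode =
  current ≔ᵢ scalarᵢ outer ⨾
  previous ≔ᵢ lit 0 ⨾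
  scan ⨾
  previous ≔ᵢ scalarᵢ found ⨾
  scan ⨾
  IF scalarᵢ found ≤ᵢ lit 0 THEN endpoint ≔ᵢ scalarᵢ outer ELSE skip

findEndpoint : Code
findEndpoint = FOR outer BELOW nodeCount DO testNode

placeNode : IndexExp → Code
placeNode k =
  nodeOrder [ k ]≔ᵢ scalarᵢ current ⨾
  weightAt [ k ]≔ₙ num[ weights ] scalarᵢ current

placeEdge : IndexExp → Code
placeEdge k =
  edgeOrder [ k ]≔ᵢ scalarᵢ found ⊖ lit 1 ⨾
  lengthAt [ k ]≔ₙ num[ lengths ] (scalarᵢ found ⊖ lit 1) ⨾
  boundAt [ k ]≔ₙ num[ bounds ] (scalarᵢ found ⊖ lit 1) ⨾
  costAt [ k ]≔ₙ num[ costs ] (scalarᵢ found ⊖ lit 1)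

advance : Code
advance =
  scan ⨾
  placeNode (scalarᵢ outer) ⨾
  placeEdge (scalarᵢ outer) ⨾
  current ≔ᵢ scalarᵢ next ⨾
  previous ≔ᵢ scalarᵢ found

traverse : Code
traverse =
  current ≔ᵢ scalarᵢ endpoint ⨾
  previous ≔ᵢ lit 0 ⨾
  (FOR outer BELOW edgeCount DO advance) ⨾
  placeNode (scalarᵢ edgeCount)

-- Sorting the edges by cost.

bump : Code
bump = rank ≔ᵢ lit 1 ⊕ scalarᵢ rank

compareCosts : Code
compareCosts =
  IF lit 1 ⊕ scalarᵢ inner ≤ᵢ scalarᵢ outer
  THEN (IF num[ costAt ] scalarᵢ inner ≤ₙ num[ costAt ] scalarᵢ outer THEN bump ELSE skip)
  ELSE (IF num[ costAt ] scalarᵢ outer ≤ₙ num[ costAt ] scalarᵢ inner THEN skip ELSE bump)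

-- Each edge is stored directly at the slot given by the number of its predecessors. This quadratic
-- sort moves nothing afterwards, so its correctness is a statement about ranks alone.
rankEdge : Code
rankEdge =
  rank ≔ᵢ lit 0 ⨾
  (FOR inner BELOW edgeCount DO compareCosts) ⨾
  sorted [ scalarᵢ rank ]≔ᵢ scalarᵢ outer

sortByCost : Code
sortByCost = FOR outer BELOW edgeCount DO rankEdge

-- Greedy shortening of an interval.

whenBetween : IndexExp → Code → Code
whenBetween e c =
  IF scalarᵢ low ≤ᵢ e THEN (IF lit 1 ⊕ e ≤ᵢ scalarᵢ high THEN c ELSE skip) ELSE skip

addLength : Code
addLength = shortfall ≔ₙ scalarₙ shortfall +̂ num[ lengthAt ] scalarᵢ inner

computeShortfall : Code
computeShortfall =
  shortfall ≔ₙ 0̂ ⨾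
  (FOR inner BELOW edgeCount DO whenBetween (scalarᵢ inner) addLength) ⨾
  IF scalarₙ shortfall ≤ₙ scalarₙ radius₀
    THEN (shortfall ≔ₙ 0̂)
    ELSE (shortfall ≔ₙ scalarₙ shortfall -̂ scalarₙ radius₀)

cheapest : IndexExp
cheapest = idx[ sorted ] scalarᵢ inner

spend : NumExp → Code
spend x =
  reductionAt [ cheapest ]≔ₙ x ⨾
  spent ≔ₙ scalarₙ spent +̂ num[ costAt ] cheapest *̂ x ⨾
  shortfall ≔ₙ scalarₙ shortfall -̂ x

-- The amount is the smaller of bound and shortfall. There is no early exit: once the shortfall is
-- 0, the remaining edges receive 0, which also erases what an earlier run left there.
reduceEdge : Code
reduceEdge =
  IF num[ boundAt ] cheapest ≤ₙ scalarₙ shortfall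
  THEN spend (num[ boundAt ] cheapest)
  ELSE spend (scalarₙ shortfall)

-- Entries of `reductionAt` outside the interval stay as they are. Hence two runs, left and right of
-- the centre, build up one vector of reductions.
shorten : Code
shorten =
  computeShortfall ⨾
  spent ≔ₙ 0̂ ⨾
  FOR inner BELOW edgeCount DO whenBetween cheapest reduceEdge

-- The cost of reaching a node only depends on the interval between it and the
-- centre, whichever of the two is on the left.
selectInterval : Code
selectInterval =
  IF scalarᵢ middle ≤ᵢ scalarᵢ outer
  THEN (low ≔ᵢ scalarᵢ middle ⨾ high ≔ᵢ scalarᵢ outer)
  ELSE (low ≔ᵢ scalarᵢ outer ⨾ high ≔ᵢ scalarᵢ middle)

quoteInterval : Code
quoteInterval =
  shorten ⨾
  shortfallTo [ scalarᵢ middle ]≔ₙ scalarₙ shortfall ⨾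
  spentTo [ scalarᵢ middle ]≔ₙ scalarₙ spent

priceNode : Code
priceNode = selectInterval ⨾ quoteInterval

-- Comparison of all triples.

setBest : Code
setBest =
  bestWeight ≔ₙ scalarₙ weightSoFar ⨾
  bestLow ≔ᵢ scalarᵢ middle ⨾
  bestCentre ≔ᵢ scalarᵢ outer ⨾
  bestHigh ≔ᵢ scalarᵢ inner

addWeight : Code
addWeight = weightSoFar ≔ₙ scalarₙ weightSoFar +̂ num[ weightAt ] scalarᵢ inner

keepHeavier : Code
keepHeavier = IF scalarₙ bestWeight ≤ₙ scalarₙ weightSoFar THEN setBest ELSE skip

keepAffordable : Code
keepAffordable =
  IF num[ spentTo ] scalarᵢ middle +̂ num[ spentTo ] scalarᵢ inner ≤ₙ scalarₙ budget₀
  THEN keepHeavier ELSE skip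

keepReaching : IndexExp → Code → Code
keepReaching k c = IF num[ shortfallTo ] k ≤ₙ 0̂ THEN c ELSE skip

updateBest : Code
updateBest =
  IF scalarᵢ outer ≤ᵢ scalarᵢ inner
  THEN keepReaching (scalarᵢ middle) (keepReaching (scalarᵢ inner) keepAffordable)
  ELSE skip

-- Loops always start at 0, so the right end also passes positions left of `middle`, where no weight
-- is added, and left of `outer`, which `updateBest` skips. Accumulating the weight makes the work
-- per triple constant.
tryHigh : Code
tryHigh = (IF scalarᵢ middle ≤ᵢ scalarᵢ inner THEN addWeight ELSE skip) ⨾ updateBest

tryLow : Code
tryLow =
  IF scalarᵢ middle ≤ᵢ scalarᵢ outer
  THEN (weightSoFar ≔ₙ 0̂ ⨾ FOR inner BELOW nodeCount DO tryHigh)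
  ELSE skip

tryCentre : Code
tryCentre =
  (FOR middle BELOW nodeCount DO priceNode) ⨾
  (FOR middle BELOW nodeCount DO tryLow)

-- The initial triple 0, 0, 0 needs no reduction and is thus affordable. The recorded weight 0 is
-- merely a lower bound for the weight of its interval.
search : Code
search =
  bestWeight ≔ₙ 0̂ ⨾
  bestLow ≔ᵢ lit 0 ⨾
  bestCentre ≔ᵢ lit 0 ⨾
  bestHigh ≔ᵢ lit 0 ⨾
  FOR outer BELOW nodeCount DO tryCentre

-- Reconstruction and output.

resetReduction : Code
resetReduction = reductionAt [ scalarᵢ inner ]≔ₙ 0̂

outputReduction : Code
outputReduction =
  reductions [ idx[ edgeOrder ] scalarᵢ inner ]≔ₙ num[ reductionAt ] scalarᵢ inner

resetReductions : Code
resetReductions = FOR inner BELOW edgeCount DO resetReduction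

selectLeft selectRight : Code
selectLeft = low ≔ᵢ scalarᵢ bestLow ⨾ high ≔ᵢ scalarᵢ bestCentre
selectRight = low ≔ᵢ scalarᵢ bestCentre ⨾ high ≔ᵢ scalarᵢ bestHigh

emit : Code
emit =
  (FOR inner BELOW edgeCount DO outputReduction) ⨾
  facility ≔ᵢ idx[ nodeOrder ] scalarᵢ bestCentre

-- Pricing leaves unrelated values in `reductionAt`, so these are cleared before the winner's two
-- sides are shortened again.
solver : Code
solver =
  findEndpoint ⨾ traverse ⨾ sortByCost ⨾ search ⨾
  resetReductions ⨾ selectLeft ⨾ shorten ⨾ selectRight ⨾ shorten ⨾ emit

-- Injections of finite sets, and counting

-- Pigeonhole: punching out a missed value would inject `Fin (suc n)` into `Fin n`.
injective⇒surjective : ∀ {n} {f : Fin n → Fin n} → Injective _≡_ _≡_ f → ∀ y → Σ (Fin n) λ x → f x ≡ y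
injective⇒surjective {suc n} {f} f-injective y with any? (λ x → f x ≟ y)
... | yes hit = hit
... | no miss = contradiction
  (injective⇒≤ (f-injective ∘ punchOut-injective (y≢f _) (y≢f _))) ℕ.1+n≰n
  where
  y≢f : ∀ x → ¬ y ≡ f x
  y≢f x y≡fx = miss (x , ≡.sym y≡fx)

module _ {p} {P : ℕ → Set p} (P? : ∀ k → Dec (P k)) where

  count : ℕ → ℕ
  count zero    = 0
  count (suc n) = if ⌊ P? n ⌋ then suc (count n) else count n

  count-yes : ∀ n → P n → count (suc n) ≡ suc (count n)
  count-yes n Pn with P? n
  ... | yes _  = ≡.refl
  ... | no ¬Pn = contradiction Pn ¬Pn

  count-no : ∀ n → ¬ P n → count (suc n) ≡ count n
  count-no n ¬Pn with P? n
  ... | yes Pn = contradiction Pn ¬Pn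
  ... | no _   = ≡.refl

  count≤ : ∀ n → count n ℕ.≤ n
  count≤ zero = z≤n
  count≤ (suc n) with P? n
  ... | yes _ = s≤s (count≤ n)
  ... | no _  = ℕ.m≤n⇒m≤1+n (count≤ n)

  count< : ∀ {n k} → k ℕ.< n → ¬ P k → count n ℕ.< n
  count< {suc n} k<1+n ¬Pk with P? n | ℕ.m≤n⇒m<n∨m≡n (ℕ.≤-pred k<1+n)
  ... | yes _  | inj₁ k<n  = s≤s (count< k<n ¬Pk)
  ... | yes Pn | inj₂ ≡.refl = contradiction Pn ¬Pk
  ... | no _   | _         = s≤s (count≤ n)

module _ {p q} {P : ℕ → Set p} {Q : ℕ → Set q} (P? : ∀ k → Dec (P k)) (Q? : ∀ k → Dec (Q k))
         (P⇒Q : ∀ {k} → P k → Q k) where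

  count-mono : ∀ n → count P? n ℕ.≤ count Q? n
  count-mono zero = z≤n
  count-mono (suc n) with P? n | Q? n
  ... | yes _  | yes _  = s≤s (count-mono n)
  ... | yes Pn | no ¬Qn = contradiction (P⇒Q Pn) ¬Qn
  ... | no _   | yes _  = ℕ.m≤n⇒m≤1+n (count-mono n)
  ... | no _   | no _   = count-mono n

  count-strict : ∀ {n k} → k ℕ.< n → ¬ P k → Q k → count P? n ℕ.< count Q? n
  count-strict {suc n} k<1+n ¬Pk Qk with ℕ.m≤n⇒m<n∨m≡n (ℕ.≤-pred k<1+n) | P? n | Q? n
  ... | inj₁ k<n  | yes _  | yes _  = s≤s (count-strict k<n ¬Pk Qk)
  ... | inj₁ k<n  | yes Pn | no ¬Qn = contradiction (P⇒Q Pn) ¬Qn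
  ... | inj₁ k<n  | no _   | yes _  = ℕ.m≤n⇒m≤1+n (count-strict k<n ¬Pk Qk)
  ... | inj₁ k<n  | no _   | no _   = count-strict k<n ¬Pk Qk
  ... | inj₂ ≡.refl | yes Pn | _      = contradiction Pn ¬Pk
  ... | inj₂ ≡.refl | no _   | yes _  = s≤s (count-mono n)
  ... | inj₂ ≡.refl | no _   | no ¬Qn = contradiction Qk ¬Qn

-- Path graphs

pad-toℕ : ∀ {a} {A : Set a} {n} (d : A) (f : Fin n → A) i → pad d f (toℕ i) ≡ f i
pad-toℕ d f Fin.zero    = ≡.refl
pad-toℕ d f (Fin.suc i) = pad-toℕ d (λ j → f (Fin.suc j)) i

module _ {G : Graph} (isPath : IsPath G) where
  open Graph G
  open IsPath isPath

  private
    m : ℕ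
    m = #edges

    opposite-inject₁ : ∀ {n} (k : Fin n) → opposite (inject₁ k) ≡ Fin.suc (opposite k)
    opposite-inject₁ Fin.zero    = ≡.refl
    opposite-inject₁ (Fin.suc k) = ≡.cong inject₁ (opposite-inject₁ k)

  -- The machine may settle on the end that the given listing puts last; the listing then has to be
  -- read backwards.
  reverse : IsPath G
  reverse = record
    { nodeAt = Permutation.reverse ∘ₚ nodeAt
    ; edgeAt = Permutation.reverse ∘ₚ edgeAt
    ; joins  = λ k → Sum.swap (≡.subst (λ j → Joins (Inverse.to edgeAt (opposite k))
                 (Inverse.to nodeAt (inject₁ (opposite k))) (Inverse.to nodeAt j))
                 (≡.sym (opposite-inject₁ k)) (joins (opposite k)))
    }

  node : Fin (suc m) → Node
  node = Inverse.to nodeAt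

  edge : Fin m → Edge
  edge = Inverse.to edgeAt

  -- Indexed by naturals, as the memory is; beyond the last position the value is the first node,
  -- and lemmas about it assume a position of at most `m`.
  at : ℕ → Node
  at = pad (node Fin.zero) node

  position : Node → ℕ
  position i = toℕ (Inverse.from nodeAt i)

  position≤m : ∀ i → position i ℕ.≤ m
  position≤m i = ℕ.≤-pred (toℕ<n (Inverse.from nodeAt i))

  at-toℕ : ∀ k → at (toℕ k) ≡ node k
  at-toℕ = pad-toℕ (node Fin.zero) node

  at≡node : ∀ {k} (k≤m : k ℕ.≤ m) → at k ≡ node (fromℕ< (s≤s k≤m))
  at≡node k≤m = ≡.trans (≡.cong at (≡.sym (toℕ-fromℕ< (s≤s k≤m)))) (at-toℕ _)

  position-node : ∀ k → position (node k) ≡ toℕ k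
  position-node k = ≡.cong toℕ (inverseˡ nodeAt)

  at-position : ∀ i → at (position i) ≡ i
  at-position i = ≡.trans (at-toℕ _) (inverseʳ nodeAt)

  position-at : ∀ {k} → k ℕ.≤ m → position (at k) ≡ k
  position-at k≤m = ≡.trans (≡.cong position (at≡node k≤m)) (≡.trans (position-node _) (toℕ-fromℕ< (s≤s k≤m)))

  link : ∀ k → Joins (edge k) (at (toℕ k)) (at (suc (toℕ k)))
  link k = ≡.subst₂ (Joins (edge k))
    (≡.sym (≡.trans (≡.cong at (≡.sym (toℕ-inject₁ k))) (at-toℕ _))) (≡.sym (at-toℕ (Fin.suc k))) (joins k)

  link< : ∀ {k} (k<m : k ℕ.< m) → Joins (edge (fromℕ< k<m)) (at k) (at (suc k))
  link< {k} k<m = ≡.subst (λ j → Joins (edge (fromℕ< k<m)) (at j) (at (suc j))) (toℕ-fromℕ< k<m) (link _)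

  Between : Fin m → Node → Node → Set
  Between k i j = position i ≡ toℕ k × position j ≡ suc (toℕ k)

  -- The listing and the hypothesis both describe `ends e`, which determines the two end nodes up to
  -- their order.
  joins⇒between : ∀ {e i j} → Joins e i j → Σ (Fin m) λ k → e ≡ edge k × (Between k i j ⊎ Between k j i)
  joins⇒between {e} {i} {j} e-joins = k , ≡.sym (inverseʳ edgeAt) , compare (joins k) e-joins
    where
    k = Inverse.from edgeAt e
    left : position (node (inject₁ k)) ≡ toℕ k
    left = ≡.trans (position-node _) (toℕ-inject₁ k)
    right : position (node (Fin.suc k)) ≡ suc (toℕ k)
    right = position-node _
    ends≡ : ends (edge k) ≡ ends e
    ends≡ = ≡.cong ends (inverseʳ edgeAt)
    same : ∀ {a b i j} → ends (edge k) ≡ (a , b) → ends e ≡ (i , j) → a ≡ i × b ≡ j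
    same p q = let eq = ≡.trans (≡.sym p) (≡.trans ends≡ q) in Product.,-injectiveˡ eq , Product.,-injectiveʳ eq
    compare : Joins (edge k) (node (inject₁ k)) (node (Fin.suc k)) → Joins e i j → Between k i j ⊎ Between k j i
    compare (inj₁ p) (inj₁ q) with ≡.refl , ≡.refl ← same p q = inj₁ (left , right)
    compare (inj₁ p) (inj₂ q) with ≡.refl , ≡.refl ← same p q = inj₂ (left , right)
    compare (inj₂ p) (inj₁ q) with ≡.refl , ≡.refl ← same p q = inj₂ (left , right)
    compare (inj₂ p) (inj₂ q) with ≡.refl , ≡.refl ← same p q = inj₁ (left , right)

  open Walks G

  -- A walk is built from its first edge. `_≤‴_` recurses at the lower end and `_≤′_` at the upper
  -- one, which is where the ascending and the descending walk start.
  ascend : ∀ {a b} → a ≤‴ b → b ℕ.≤ m → Walk (at a) (at b)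
  ascend (≤‴-reflexive ≡.refl) b≤m = []
  ascend (≤‴-step a<b)         b≤m = link< (ℕ.≤-trans (ℕ.≤‴⇒≤ a<b) b≤m) ∷ ascend a<b b≤m

  descend : ∀ {a b} → a ≤′ b → b ℕ.≤ m → Walk (at b) (at a)
  descend (≤′-reflexive ≡.refl) b≤m = []
  descend (≤′-step a≤b)         b<m = Sum.swap (link< b<m) ∷ descend a≤b (ℕ.<⇒≤ b<m)

  private
    ascend-above : ∀ {a b} (a≤b : a ≤‴ b) (b≤m : b ℕ.≤ m) →
                   All (λ i → a ℕ.≤ position i) (nodes (ascend a≤b b≤m))
    ascend-above (≤‴-reflexive ≡.refl) b≤m = ℕ.≤-reflexive (≡.sym (position-at b≤m)) ∷ []
    ascend-above (≤‴-step a<b)         b≤m =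
      ℕ.≤-reflexive (≡.sym (position-at (ℕ.≤-trans (ℕ.<⇒≤ (ℕ.≤‴⇒≤ a<b)) b≤m))) ∷
      All.map ℕ.<⇒≤ (ascend-above a<b b≤m)

    descend-below : ∀ {a b} (a≤b : a ≤′ b) (b≤m : b ℕ.≤ m) →
                    All (λ i → position i ℕ.≤ b) (nodes (descend a≤b b≤m))
    descend-below (≤′-reflexive ≡.refl) b≤m = ℕ.≤-reflexive (position-at b≤m) ∷ []
    descend-below (≤′-step a≤b)         b<m =
      ℕ.≤-reflexive (position-at b<m) ∷ All.map ℕ.m≤n⇒m≤1+n (descend-below a≤b (ℕ.<⇒≤ b<m))

  ascend-unique : ∀ {a b} (a≤b : a ≤‴ b) (b≤m : b ℕ.≤ m) → Unique (nodes (ascend a≤b b≤m))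
  ascend-unique (≤‴-reflexive ≡.refl) b≤m = [] ∷ []
  ascend-unique (≤‴-step a<b)         b≤m =
    All.map (λ a<i at≡i → ℕ.<⇒≢ a<i
        (≡.trans (≡.sym (position-at (ℕ.≤-trans (ℕ.<⇒≤ (ℕ.≤‴⇒≤ a<b)) b≤m))) (≡.cong position at≡i)))
      (ascend-above a<b b≤m) ∷ ascend-unique a<b b≤m

  descend-unique : ∀ {a b} (a≤b : a ≤′ b) (b≤m : b ℕ.≤ m) → Unique (nodes (descend a≤b b≤m))
  descend-unique (≤′-reflexive ≡.refl) b≤m = [] ∷ []
  descend-unique (≤′-step a≤b)         b<m =
    All.map (λ i≤b at≡i → ℕ.<⇒≢ (s≤s i≤b)
        (≡.trans (≡.cong position (≡.sym at≡i)) (position-at b<m)))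
      (descend-below a≤b (ℕ.<⇒≤ b<m)) ∷ descend-unique a≤b (ℕ.<⇒≤ b<m)

-- The outcome of scan among the first n edges, where e₁ and e₂ are the ends,
-- f is the edge found (plus one) and x its other end.
record Scanned (e₁ e₂ : ℕ → ℕ) (origin excluded n f x : ℕ) : Set where
  constructor scanned
  field
    result : (f ≡ 0 × (∀ {e} → e ℕ.< n → ¬ suc e ≡ excluded → ¬ e₁ e ≡ origin × ¬ e₂ e ≡ origin)) ⊎
             (Σ ℕ λ e → e ℕ.< n × f ≡ suc e × ¬ suc e ≡ excluded ×
               ((e₁ e ≡ origin × x ≡ e₂ e) ⊎ (e₂ e ≡ origin × x ≡ e₁ e)))

module _ {G : Graph} (isPath : IsPath G) where
  open Graph G

  joins-at : ∀ {e i j k} → Joins e i j → position isPath i ≡ k →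
    (Σ (Fin #edges) λ t → e ≡ edge isPath t × toℕ t ≡ k × position isPath j ≡ suc k) ⊎
    (Σ (Fin #edges) λ t → e ≡ edge isPath t × suc (toℕ t) ≡ k)
  joins-at e-joins ≡.refl with joins⇒between isPath e-joins
  ... | t , e≡ , inj₁ (i≡ , j≡) = inj₁ (t , e≡ , ≡.sym i≡ , ≡.trans j≡ (≡.cong suc (≡.sym i≡)))
  ... | t , e≡ , inj₂ (j≡ , i≡) = inj₂ (t , e≡ , ≡.sym i≡)

  edge-injective : ∀ {t u} → edge isPath t ≡ edge isPath u → t ≡ u
  edge-injective eq = ≡.trans (≡.sym (inverseˡ edgeAt)) (≡.trans (≡.cong (Inverse.from edgeAt) eq) (inverseˡ edgeAt))
    where open IsPath isPath

  first-edge-unique : ∀ {e f i j k} → position isPath i ≡ 0 → Joins e i j → Joins f i k → e ≡ f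
  first-edge-unique i≡0 e-joins f-joins with joins-at e-joins i≡0 | joins-at f-joins i≡0
  ... | inj₁ (t , ≡.refl , t≡0 , _) | inj₁ (u , ≡.refl , u≡0 , _) =
    ≡.cong (edge isPath) (toℕ-injective (≡.trans t≡0 (≡.sym u≡0)))

module _ (G : Graph) where
  open Graph G

  -- Some listing has to start at `v`, not necessarily the given one, so that both ends qualify and
  -- the witness carries the direction of the traversal.
  Endpoint : ℕ → Set
  Endpoint v = Σ (IsPath G) λ isPath → toℕ (at isPath 0) ≡ v

  -- Two distinct edges meet at a node in the middle, so one of them is not
  -- excluded.
  dead-end⇒endpoint : IsPath G → ∀ i excluded →
    (∀ e → ¬ suc (toℕ e) ≡ excluded → ∀ j → ¬ Joins e i j) → Endpoint (toℕ i)
  dead-end⇒endpoint isPath i excluded dead = by-position (position isPath i) ≡.refl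
    where
    at≡i : ∀ {k} → position isPath i ≡ k → at isPath k ≡ i
    at≡i i≡ = ≡.trans (≡.cong (at isPath) (≡.sym i≡)) (at-position isPath i)

    used : ∀ {e j k} → position isPath i ≡ k → Joins e (at isPath k) j → suc (toℕ e) ≡ excluded
    used {e} {j} i≡ e-joins with suc (toℕ e) ℕ.≟ excluded
    ... | yes ≡excluded = ≡excluded
    ... | no ≢excluded  = contradiction (≡.subst (λ i → Joins e i j) (at≡i i≡) e-joins) (dead e ≢excluded j)

    by-position : ∀ q → position isPath i ≡ q → Endpoint (toℕ i)
    by-position zero i≡ = isPath , ≡.cong toℕ (at≡i i≡)
    by-position (suc q) i≡ with ℕ.m≤n⇒m<n∨m≡n (≡.subst (ℕ._≤ #edges) i≡ (position≤m isPath i))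
    -- At the last position, the reversed listing starts at `i`.
    ... | inj₂ 1+q≡m = reverse isPath ,
      ≡.cong toℕ (≡.trans (≡.sym (at-toℕ isPath (Fin.fromℕ #edges)))
        (at≡i (≡.trans i≡ (≡.trans 1+q≡m (≡.sym (toℕ-fromℕ #edges))))))
    ... | inj₁ 1+q<m = contradiction
      (≡.trans (≡.sym (toℕ-fromℕ< 1+q<m)) (≡.trans
        (≡.cong toℕ (edge-injective isPath (toℕ-injective (ℕ.suc-injective (≡.trans right (≡.sym left))))))
        (toℕ-fromℕ< q<m)))
      ℕ.1+n≢n
      where
      q<m : q ℕ.< #edges
      q<m = ℕ.<⇒≤ 1+q<m
      right : suc (toℕ (edge isPath (fromℕ< 1+q<m))) ≡ excluded
      right = used i≡ (link< isPath 1+q<m)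
      left : suc (toℕ (edge isPath (fromℕ< q<m))) ≡ excluded
      left = used i≡ (Sum.swap (link< isPath q<m))

-- Finite subsets

∣p∣≡0⇒∉ : ∀ {n} {p : Subset n} → ∣ p ∣ ≡ 0 → ∀ {x} → ¬ x ∈ p
∣p∣≡0⇒∉ {p = false ∷ p} ∣p∣≡0 (there x∈p) = ∣p∣≡0⇒∉ ∣p∣≡0 x∈p

∣p∣≡1⇒singleton : ∀ {n} (p : Subset n) → ∣ p ∣ ≡ 1 →
  Σ (Fin n) λ x → x ∈ p × (∀ {y} → y ∈ p → y ≡ x)
∣p∣≡1⇒singleton (true ∷ p) ∣p∣≡1 = Fin.zero , here , λ
  { here        → ≡.refl
  ; (there y∈p) → contradiction y∈p (∣p∣≡0⇒∉ (ℕ.suc-injective ∣p∣≡1)) }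
∣p∣≡1⇒singleton (false ∷ p) ∣p∣≡1 with x , x∈p , unique ← ∣p∣≡1⇒singleton p ∣p∣≡1 =
  Fin.suc x , there x∈p , λ { (there y∈p) → ≡.cong Fin.suc (unique y∈p) }

-- Together with `last-true` this yields the hull of the positions that a competitor covers.
first-true : ∀ (f : ℕ → Bool) n → (∀ {k} → k ℕ.< n → f k ≡ false) ⊎
  (Σ ℕ λ a → a ℕ.< n × f a ≡ true × (∀ {k} → k ℕ.< a → f k ≡ false))
first-true f zero = inj₁ λ ()
first-true f (suc n) with first-true f n | f n in fn≡
... | inj₂ (a , a<n , fa , before) | _     = inj₂ (a , ℕ.m<n⇒m<1+n a<n , fa , before)
... | inj₁ none                    | true  = inj₂ (n , ℕ.≤-refl , fn≡ , none)
... | inj₁ none                    | false = inj₁ (<suc-elim (λ k → f k ≡ false) none fn≡)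

last-true : ∀ (f : ℕ → Bool) n {x} → x ℕ.≤ n → f x ≡ true →
  Σ ℕ λ b → x ℕ.≤ b × b ℕ.≤ n × f b ≡ true × (∀ {k} → b ℕ.< k → k ℕ.≤ n → f k ≡ false)
last-true f n {x} x≤n fx with f n in fn≡
last-true f n x≤n fx | true =
  n , x≤n , ℕ.≤-refl , fn≡ , λ n<k k≤n → contradiction k≤n (ℕ.<⇒≱ n<k)
last-true f n x≤n fx | false with ℕ.m≤n⇒m<n∨m≡n x≤n
... | inj₂ ≡.refl = contradiction (≡.trans (≡.sym fx) fn≡) (λ ())
last-true f (suc n) x≤n fx | false | inj₁ (s≤s x≤n′) with b , x≤b , b≤n , fb , after ← last-true f n x≤n′ fx =
  b , x≤b , ℕ.m≤n⇒m≤1+n b≤n , fb , λ b<k k≤1+n →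
    Sum.[ (λ k<1+n → after b<k (ℕ.≤-pred k<1+n)) , (λ { ≡.refl → fn≡ }) ]′ (ℕ.m≤n⇒m<n∨m≡n k≤1+n)

module Solution {κ ℓ₁ ℓ₂} (K : OrderedField κ ℓ₁ ℓ₂) where
  open OrderedField K
  open Machine K
  private module O = IsDecTotalOrder isDecTotalOrder
  open O public
    using ()
    renaming (reflexive to ≤-reflexive; trans to ≤-trans; antisym to ≤-antisym; total to ≤-total)
  open import Algebra.Solver.Ring.NaturalCoefficients.Default commutativeSemiring public
    using (solve; _:+_; _:*_; _:=_; con)

  open import Algebra.Properties.CommutativeMonoid.Sum +-commutativeMonoid public
    using (sum-permute; sum-cong-≗; sum-init-last; sum-cong-≋)

  -- Arithmetic in the ordered field.

  ≤-refl : ∀ {x} → x ≤ x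
  ≤-refl = ≤-reflexive refl

  ≤-resp : ∀ {x x′ y y′} → x ≈ x′ → y ≈ y′ → x ≤ y → x′ ≤ y′
  ≤-resp x≈ y≈ x≤y = ≤-trans (≤-reflexive (sym x≈)) (≤-trans x≤y (≤-reflexive y≈))

  +-monoˡ-≤ : ∀ z {x y} → x ≤ y → x + z ≤ y + z
  +-monoˡ-≤ z x≤y = ≤-resp (+-comm _ _) (+-comm _ _) (+-monoʳ-≤ z x≤y)

  +-mono-≤ : ∀ {w x y z} → w ≤ x → y ≤ z → w + y ≤ x + z
  +-mono-≤ w≤x y≤z = ≤-trans (+-monoˡ-≤ _ w≤x) (+-monoʳ-≤ _ y≤z)

  x-y+y≈x : ∀ x y → (x - y) + y ≈ x
  x-y+y≈x x y = trans (+-assoc x (- y) y) (trans (+-congˡ (-‿inverseˡ y)) (+-identityʳ x))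

  x+y-y≈x : ∀ x y → (x + y) - y ≈ x
  x+y-y≈x x y = trans (+-assoc x y (- y)) (trans (+-congˡ (-‿inverseʳ y)) (+-identityʳ x))

  +-cancelʳ-≤ : ∀ z {x y} → x + z ≤ y + z → x ≤ y
  +-cancelʳ-≤ z p = ≤-resp (x+y-y≈x _ z) (x+y-y≈x _ z) (+-monoˡ-≤ (- z) p)

  x≤y⇒0≤y-x : ∀ {x y} → x ≤ y → 0# ≤ y - x
  x≤y⇒0≤y-x {x} p = ≤-resp (-‿inverseʳ x) refl (+-monoˡ-≤ (- x) p)

  0≤+ : ∀ {x y} → 0# ≤ x → 0# ≤ y → 0# ≤ x + y
  0≤+ p q = ≤-resp (+-identityʳ 0#) refl (+-mono-≤ p q)

  x≤x+y : ∀ {x y} → 0# ≤ y → x ≤ x + y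
  x≤x+y p = ≤-resp (+-identityʳ _) refl (+-monoʳ-≤ _ p)

  *-monoˡ-≤ : ∀ {z x y} → 0# ≤ z → x ≤ y → z * x ≤ z * y
  *-monoˡ-≤ {z} {x} {y} 0≤z x≤y =
    ≤-resp refl
      (trans (sym (distribˡ z x (y - x))) (*-congˡ (trans (+-comm x _) (x-y+y≈x y x))))
      (x≤x+y (*-nonNegative 0≤z (x≤y⇒0≤y-x x≤y)))

  -- The sides differ by (b - a)(y - x). The solver in use works over semirings, hence the
  -- substitutions b = a + d and y = x + e.
  rearrangement : ∀ {a b x y} → a ≤ b → x ≤ y → a * y + b * x ≤ a * x + b * y
  rearrangement {a} {b} {x} {y} a≤b x≤y =
    ≤-resp (+-cong (*-congˡ y≈) (*-congʳ b≈))
           (trans (regroup a (b - a) x (y - x)) (+-congˡ (*-cong b≈ y≈)))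
           (x≤x+y (*-nonNegative (x≤y⇒0≤y-x a≤b) (x≤y⇒0≤y-x x≤y)))
    where
    b≈ : a + (b - a) ≈ b
    b≈ = trans (+-comm a _) (x-y+y≈x b a)
    y≈ : x + (y - x) ≈ y
    y≈ = trans (+-comm x _) (x-y+y≈x y x)
    regroup : ∀ a d x e →
      (a * (x + e) + (a + d) * x) + d * e ≈ a * x + (a + d) * (x + e)
    regroup = solve 4 (λ a d x e →
      (a :* (x :+ e) :+ (a :+ d) :* x) :+ d :* e := a :* x :+ (a :+ d) :* (x :+ e)) refl

  -- Sums over initial segments and intervals

  -- Grows by its last term, as the loops do, whereas `sum` splits off the first one; `sumTo≈sum`
  -- mediates.
  sumTo : ℕ → (ℕ → Carrier) → Carrier
  sumTo zero    f = 0#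
  sumTo (suc n) f = sumTo n f + f n

  sumTo-cong : ∀ n {f g} → (∀ {k} → k ℕ.< n → f k ≈ g k) → sumTo n f ≈ sumTo n g
  sumTo-cong zero    f≈g = refl
  sumTo-cong (suc n) f≈g = +-cong (sumTo-cong n (λ k<n → f≈g (ℕ.m<n⇒m<1+n k<n))) (f≈g ℕ.≤-refl)

  sumTo-+ : ∀ n f g → sumTo n (λ k → f k + g k) ≈ sumTo n f + sumTo n g
  sumTo-+ zero    f g = sym (+-identityʳ 0#)
  sumTo-+ (suc n) f g = trans (+-congʳ (sumTo-+ n f g))
    (solve 4 (λ a b x y → (a :+ b) :+ (x :+ y) := (a :+ x) :+ (b :+ y)) refl _ _ _ _)

  sumTo-* : ∀ n z f → sumTo n (λ k → z * f k) ≈ z * sumTo n f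
  sumTo-* zero    z f = sym (zeroʳ z)
  sumTo-* (suc n) z f = trans (+-congʳ (sumTo-* n z f)) (sym (distribˡ z _ _))

  sumTo-mono : ∀ n {f g} → (∀ {k} → k ℕ.< n → f k ≤ g k) → sumTo n f ≤ sumTo n g
  sumTo-mono zero    f≤g = ≤-refl
  sumTo-mono (suc n) f≤g = +-mono-≤ (sumTo-mono n (λ k<n → f≤g (ℕ.m<n⇒m<1+n k<n))) (f≤g ℕ.≤-refl)

  sumTo-0 : ∀ n {f} → (∀ {k} → k ℕ.< n → f k ≈ 0#) → sumTo n f ≈ 0#
  sumTo-0 zero    f≈0 = refl
  sumTo-0 (suc n) f≈0 = trans
    (+-cong (sumTo-0 n (λ k<n → f≈0 (ℕ.m<n⇒m<1+n k<n))) (f≈0 ℕ.≤-refl)) (+-identityʳ 0#)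

  sumTo-nonNegative : ∀ n {f} → (∀ {k} → k ℕ.< n → 0# ≤ f k) → 0# ≤ sumTo n f
  sumTo-nonNegative zero    0≤f = ≤-refl
  sumTo-nonNegative (suc n) 0≤f = 0≤+ (sumTo-nonNegative n (λ k<n → 0≤f (ℕ.m<n⇒m<1+n k<n))) (0≤f ℕ.≤-refl)

  sumTo-extend : ∀ {m n f} → m ℕ.≤ n → (∀ {k} → m ℕ.≤ k → k ℕ.< n → 0# ≤ f k) →
                 sumTo m f ≤ sumTo n f
  sumTo-extend {n = zero}  z≤n 0≤f = ≤-refl
  sumTo-extend {n = suc n} m≤n 0≤f with ℕ.m≤n⇒m<n∨m≡n m≤n
  ... | inj₂ ≡.refl    = ≤-refl
  ... | inj₁ (s≤s m≤n′) = ≤-trans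
    (sumTo-extend m≤n′ (λ m≤k k<n → 0≤f m≤k (ℕ.m<n⇒m<1+n k<n))) (x≤x+y (0≤f m≤n′ ℕ.≤-refl))

  sumTo-truncate : ∀ {m n f} → m ℕ.≤ n → (∀ {k} → m ℕ.≤ k → k ℕ.< n → f k ≈ 0#) →
                   sumTo n f ≈ sumTo m f
  sumTo-truncate {n = zero}  z≤n f≈0 = refl
  sumTo-truncate {n = suc n} m≤n f≈0 with ℕ.m≤n⇒m<n∨m≡n m≤n
  ... | inj₂ ≡.refl    = refl
  ... | inj₁ (s≤s m≤n′) = trans
    (+-cong (sumTo-truncate m≤n′ (λ m≤k k<n → f≈0 m≤k (ℕ.m<n⇒m<1+n k<n))) (f≈0 m≤n′ ℕ.≤-refl))
    (+-identityʳ _)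

  term≤sumTo : ∀ n {f k} → k ℕ.< n → (∀ {j} → j ℕ.< n → 0# ≤ f j) → f k ≤ sumTo n f
  term≤sumTo n {f} {k} k<n 0≤f = ≤-trans
    (≤-resp (+-identityˡ _) refl
      (+-monoˡ-≤ (f k) (sumTo-nonNegative k (λ j<k → 0≤f (ℕ.<-trans j<k k<n)))))
    (sumTo-extend k<n (λ _ → 0≤f))

  sumTo≈sum : ∀ n f → sumTo n f ≈ sum {n} (λ i → f (toℕ i))
  sumTo≈sum zero    f = refl
  sumTo≈sum (suc n) f = trans
    (+-congʳ (sumTo≈sum n f))
    (trans (+-cong (reflexive (sum-cong-≗ {n} (λ i → ≡.cong f (≡.sym (toℕ-inject₁ i)))))
                   (reflexive (≡.cong f (≡.sym (toℕ-fromℕ n)))))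
           (sym (sum-init-last (λ (i : Fin (suc n)) → f (toℕ i)))))

  sumTo-permute : ∀ {n} f (π : Permutation n n) (σ : ℕ → ℕ) →
                  (∀ (i : Fin n) → σ (toℕ i) ≡ toℕ (π ⟨$⟩ʳ i)) →
                  sumTo n (λ k → f (σ k)) ≈ sumTo n f
  sumTo-permute {n} f π σ σ≗π = trans (sumTo≈sum n _)
    (trans (reflexive (sum-cong-≗ {n} (λ i → ≡.cong f (σ≗π i))))
    (trans (sym (sum-permute {n} (λ i → f (toℕ i)) π)) (sym (sumTo≈sum n f))))

  within : ℕ → ℕ → ℕ → Bool
  within lo hi k = (lo ℕ.≤ᵇ k) ∧ (suc k ℕ.≤ᵇ hi)

  -- Terms outside are set to 0 instead of being left out, so every sum runs over all edges and can
  -- be permuted into the order of costs. The interval is half-open because the edges between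
  -- positions lo and hi are lo, ..., hi - 1.
  onlyIn : ℕ → ℕ → (ℕ → Carrier) → ℕ → Carrier
  onlyIn lo hi f k = if within lo hi k then f k else 0#

  locate : ∀ lo hi k → (lo ℕ.≤ k × k ℕ.< hi) ⊎ (k ℕ.< lo ⊎ hi ℕ.≤ k)
  locate lo hi k with ℕ.<-≤-connex k lo | ℕ.<-≤-connex k hi
  ... | inj₁ k<lo | _         = inj₂ (inj₁ k<lo)
  ... | inj₂ lo≤k | inj₁ k<hi = inj₁ (lo≤k , k<hi)
  ... | inj₂ lo≤k | inj₂ hi≤k = inj₂ (inj₂ hi≤k)

  within-true : ∀ {lo hi k} → lo ℕ.≤ k → k ℕ.< hi → within lo hi k ≡ true
  within-true lo≤k k<hi = ≡.cong₂ _∧_ (T⇒≡ (ℕ.≤⇒≤ᵇ lo≤k)) (T⇒≡ (ℕ.≤⇒≤ᵇ k<hi))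

  within-false : ∀ {lo hi k} → k ℕ.< lo ⊎ hi ℕ.≤ k → within lo hi k ≡ false
  within-false {lo} {hi} {k} (inj₁ k<lo) = ≡.cong (_∧ _) (≰⇒≤ᵇ≡false (ℕ.<⇒≱ k<lo))
  within-false {lo} {hi} {k} (inj₂ hi≤k) =
    ≡.trans (≡.cong ((lo ℕ.≤ᵇ k) ∧_) (≰⇒≤ᵇ≡false (ℕ.<⇒≱ (s≤s hi≤k)))) (∧-zeroʳ _)

  onlyIn-inside : ∀ {lo hi k} f → lo ℕ.≤ k → k ℕ.< hi → onlyIn lo hi f k ≡ f k
  onlyIn-inside f lo≤k k<hi rewrite within-true lo≤k k<hi = ≡.refl

  onlyIn-outside : ∀ {lo hi k} f → k ℕ.< lo ⊎ hi ℕ.≤ k → onlyIn lo hi f k ≡ 0#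
  onlyIn-outside {lo} {hi} {k} f k∉ rewrite within-false {lo} {hi} {k} k∉ = ≡.refl

  onlyIn-cong : ∀ lo hi k {f g} → (lo ℕ.≤ k → k ℕ.< hi → f k ≈ g k) →
                onlyIn lo hi f k ≈ onlyIn lo hi g k
  onlyIn-cong lo hi k {f} {g} f≈g with locate lo hi k
  ... | inj₁ (p , q) rewrite within-true p q = f≈g p q
  ... | inj₂ r       rewrite within-false {lo} {hi} {k} r = refl

  onlyIn-mono : ∀ lo hi k {f g} → (lo ℕ.≤ k → k ℕ.< hi → f k ≤ g k) →
                onlyIn lo hi f k ≤ onlyIn lo hi g k
  onlyIn-mono lo hi k {f} {g} f≤g with locate lo hi k
  ... | inj₁ (p , q) rewrite within-true p q = f≤g p q
  ... | inj₂ r       rewrite within-false {lo} {hi} {k} r = ≤-refl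

  onlyIn-+ : ∀ lo hi k f g →
             onlyIn lo hi (λ j → f j + g j) k ≈ onlyIn lo hi f k + onlyIn lo hi g k
  onlyIn-+ lo hi k f g with within lo hi k
  ... | true  = refl
  ... | false = sym (+-identityʳ 0#)

  onlyIn-* : ∀ lo hi k z f → onlyIn lo hi (λ j → z * f j) k ≈ z * onlyIn lo hi f k
  onlyIn-* lo hi k z f with within lo hi k
  ... | true  = refl
  ... | false = sym (zeroʳ z)

  -- Links interval sums, in which the knapsack problem is stated, with prefix sums, which serve as
  -- coordinates along the path.
  sumTo-onlyIn : ∀ {lo hi n} f → lo ℕ.≤ hi → hi ℕ.≤ n →
                 sumTo lo f + sumTo n (onlyIn lo hi f) ≈ sumTo hi f
  sumTo-onlyIn {lo} {hi} {n} f lo≤hi hi≤n = trans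
    (+-congˡ (sumTo-truncate hi≤n (λ hi≤k _ → reflexive (onlyIn-outside {lo} {hi} f (inj₂ hi≤k)))))
    (prefix hi lo≤hi ℕ.≤-refl)
    where
    prefix : ∀ h → lo ℕ.≤ h → h ℕ.≤ hi → sumTo lo f + sumTo h (onlyIn lo hi f) ≈ sumTo h f
    prefix h lo≤h h≤hi with ℕ.m≤n⇒m<n∨m≡n lo≤h
    ... | inj₂ ≡.refl = trans
      (+-congˡ (sumTo-0 lo (λ k<lo → reflexive (onlyIn-outside {lo} {hi} f (inj₁ k<lo))))) (+-identityʳ _)
    prefix (suc h) _ h<hi | inj₁ (s≤s lo≤h) = trans
      (sym (+-assoc _ _ _))
      (+-cong (prefix h lo≤h (ℕ.<⇒≤ h<hi)) (reflexive (onlyIn-inside f lo≤h h<hi)))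

  -- Execution of code

  setCounter : ℕ → ℕ → State → State
  setCounter i v s = ⟪ write (idx s) i 0 v , num s ⟫

  tick : ℕ → State → State
  tick i s = setCounter i (suc (idx s i 0)) s

  -- The limit of a loop is read once here, whereas the compiled loop reads it before every
  -- iteration. The two agree on `Nested` code, which never writes a limit.
  exec : Code → State → State
  exec skip                 s = s
  exec (a [ e ]≔ᵢ f)        s = ⟪ write (idx s) a (evalIndex s e) (evalIndex s f) , num s ⟫
  exec (a [ e ]≔ₙ x)        s = ⟪ idx s , write (num s) a (evalIndex s e) (evalNum s x) ⟫
  exec (c ⨾ d)              s = exec d (exec c s)
  exec (IF b THEN c ELSE d) s = if evalTest s b then exec c s else exec d s
  exec (FOR i BELOW N DO c) s =
    iterate (idx s N 0) (λ s′ → tick i (exec c s′)) (setCounter i 0 s)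

  ∨-false : ∀ x {y} → T (Bool.not x) → T (Bool.not y) → T (Bool.not (x ∨ y))
  ∨-false false _ q = q

  ∨-falseˡ : ∀ x {y} → T (Bool.not (x ∨ y)) → T (Bool.not x)
  ∨-falseˡ false _ = tt

  ∨-falseʳ : ∀ x {y} → T (Bool.not (x ∨ y)) → T (Bool.not y)
  ∨-falseʳ false p = p

  exec-idx : ∀ c s a p → Preservesᵢ c a → idx (exec c s) a p ≡ idx s a p
  exec-idx skip                 s a p ok = ≡.refl
  exec-idx (b [ e ]≔ᵢ f)        s a p ok =
    write-array≢ (idx s) b (evalIndex s e) (evalIndex s f) p (Equivalence.to T-not-≡ ok)
  exec-idx (b [ e ]≔ₙ x)        s a p ok = ≡.refl
  exec-idx (c ⨾ d)              s a p ok =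
    ≡.trans (exec-idx d (exec c s) a p (∨-falseʳ (writesᵢ c a) ok)) (exec-idx c s a p (∨-falseˡ (writesᵢ c a) ok))
  exec-idx (IF b THEN c ELSE d) s a p ok with evalTest s b
  ... | true  = exec-idx c s a p (∨-falseˡ (writesᵢ c a) ok)
  ... | false = exec-idx d s a p (∨-falseʳ (writesᵢ c a) ok)
  exec-idx (FOR i BELOW N DO c) s a p ok = iterations (idx s N 0)
    where
    i≢a : (i ≡ᵇ a) ≡ false
    i≢a = Equivalence.to T-not-≡ (∨-falseˡ (i ≡ᵇ a) ok)
    start = setCounter i 0 s
    body : State → State
    body s′ = tick i (exec c s′)
    iterations : ∀ n → idx (iterate n body start) a p ≡ idx s a p
    iterations zero    = write-array≢ (idx s) i 0 0 p i≢a
    iterations (suc n) = ≡.trans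
      (write-array≢ (idx (exec c (iterate n body start))) i 0 _ p i≢a)
      (≡.trans (exec-idx c (iterate n body start) a p (∨-falseʳ (i ≡ᵇ a) ok)) (iterations n))

  exec-num : ∀ c s a p → Preservesₙ c a → num (exec c s) a p ≡ num s a p
  exec-num skip                 s a p ok = ≡.refl
  exec-num (b [ e ]≔ᵢ f)        s a p ok = ≡.refl
  exec-num (b [ e ]≔ₙ x)        s a p ok =
    write-array≢ (num s) b (evalIndex s e) (evalNum s x) p (Equivalence.to T-not-≡ ok)
  exec-num (c ⨾ d)              s a p ok =
    ≡.trans (exec-num d (exec c s) a p (∨-falseʳ (writesₙ c a) ok)) (exec-num c s a p (∨-falseˡ (writesₙ c a) ok))
  exec-num (IF b THEN c ELSE d) s a p ok with evalTest s b
  ... | true  = exec-num c s a p (∨-falseˡ (writesₙ c a) ok)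
  ... | false = exec-num d s a p (∨-falseʳ (writesₙ c a) ok)
  exec-num (FOR i BELOW N DO c) s a p ok = iterations (idx s N 0)
    where
    body : State → State
    body s′ = tick i (exec c s′)
    iterations : ∀ n → num (iterate n body (setCounter i 0 s)) a p ≡ num s a p
    iterations zero    = ≡.refl
    iterations (suc n) = ≡.trans
      (exec-num c (iterate n body (setCounter i 0 s)) a p ok) (iterations n)

  -- The frame condition, relative to the code that has been run. Loop invariants need to mention
  -- only what the loop changes; the rest is recovered from agreement with the state before the
  -- loop.
  record Agrees (c : Code) (s s′ : State) : Set κ where
    field
      idx≡ : ∀ a p {_ : Preservesᵢ c a} → idx s′ a p ≡ idx s a p
      num≡ : ∀ a p {_ : Preservesₙ c a} → num s′ a p ≡ num s a p
  open Agrees public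

  agrees-refl : ∀ {c s} → Agrees c s s
  agrees-refl = record { idx≡ = λ _ _ → ≡.refl ; num≡ = λ _ _ → ≡.refl }

  exec-agrees : ∀ c s → Agrees c s (exec c s)
  exec-agrees c s .idx≡ a p {ok} = exec-idx c s a p ok
  exec-agrees c s .num≡ a p {ok} = exec-num c s a p ok

  module Loop (i N : ℕ) (c : Code) (s : State) (i-kept : Preservesᵢ c i) where

    step : State → State
    step s′ = tick i (exec c s′)

    after : ℕ → State
    after k = iterate k step (setCounter i 0 s)

    counter : ∀ k → idx (after k) i 0 ≡ k
    counter zero    = write-same (idx s) i 0 0
    counter (suc k) = ≡.trans (write-same (idx (exec c (after k))) i 0 _)
      (≡.cong suc (≡.trans (exec-idx c (after k) i 0 i-kept) (counter k)))

    after-agrees : ∀ k → Agrees (FOR i BELOW N DO c) s (after k)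
    after-agrees k = record { idx≡ = λ a p {ok} → idx-after k a p ok
                            ; num≡ = λ a p {ok} → num-after k a p ok }
      where
      idx-after : ∀ k a p → Preservesᵢ (FOR i BELOW N DO c) a → idx (after k) a p ≡ idx s a p
      idx-after zero    a p ok =
        write-array≢ (idx s) i 0 0 p (Equivalence.to T-not-≡ (∨-falseˡ (i ≡ᵇ a) ok))
      idx-after (suc k) a p ok = ≡.trans
        (write-array≢ (idx (exec c (after k))) i 0 _ p (Equivalence.to T-not-≡ (∨-falseˡ (i ≡ᵇ a) ok)))
        (≡.trans (exec-idx c (after k) a p (∨-falseʳ (i ≡ᵇ a) ok)) (idx-after k a p ok))
      num-after : ∀ k a p → Preservesₙ c a → num (after k) a p ≡ num s a p
      num-after zero    a p ok = ≡.refl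
      num-after (suc k) a p ok = ≡.trans (exec-num c (after k) a p ok) (num-after k a p ok)

  for-invariant : ∀ {ℓ} i N c s {_ : Preservesᵢ c i} (Inv : ℕ → State → Set ℓ) →
    Inv 0 (setCounter i 0 s) →
    (∀ k s′ → k ℕ.< idx s N 0 → Agrees (FOR i BELOW N DO c) s s′ → idx s′ i 0 ≡ k →
       Inv k s′ → Inv (suc k) (tick i (exec c s′))) →
    Inv (idx s N 0) (exec (FOR i BELOW N DO c) s)
  for-invariant i N c s {i-kept} Inv base step = holds (idx s N 0) ℕ.≤-refl
    where
    open Loop i N c s i-kept using (after; after-agrees; counter)
    holds : ∀ k → k ℕ.≤ idx s N 0 → Inv k (after k)
    holds zero    _   = base
    holds (suc k) k<N = step k (after k) k<N (after-agrees k) (counter k) (holds k (ℕ.<⇒≤ k<N))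

  if-rule : ∀ {ℓ} (P : State → Set ℓ) b c d {s} →
            (evalTest s b ≡ true → P (exec c s)) → (evalTest s b ≡ false → P (exec d s)) →
            P (exec (IF b THEN c ELSE d) s)
  if-rule P b c d {s} onTrue onFalse with evalTest s b
  ... | true  = onTrue ≡.refl
  ... | false = onFalse ≡.refl

  -- Correctness and running time of compiled code.

  nested⇒limits-kept : ∀ d c → Nested d c → ∀ a → a ℕ.≤ 1 → Preservesᵢ c a
  nested⇒limits-kept d skip                 ok a a≤1 = tt
  nested⇒limits-kept d (b [ _ ]≔ᵢ _)        ok a a≤1 =
    Equivalence.from T-not-≡ (≢⇒≡ᵇ≡false {b} {a} λ { ≡.refl → ℕ.<⇒≱ (ℕ.≤ᵇ⇒≤ 2 b ok) a≤1 })
  nested⇒limits-kept d (_ [ _ ]≔ₙ _)        ok a a≤1 = tt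
  nested⇒limits-kept d (c ⨾ e)              (ok , ok′) a a≤1 =
    ∨-false (writesᵢ c a) (nested⇒limits-kept d c ok a a≤1) (nested⇒limits-kept d e ok′ a a≤1)
  nested⇒limits-kept d (IF _ THEN c ELSE e) (ok , ok′) a a≤1 =
    ∨-false (writesᵢ c a) (nested⇒limits-kept d c ok a a≤1) (nested⇒limits-kept d e ok′ a a≤1)
  nested⇒limits-kept (suc d) (FOR i BELOW N DO c) (2≤i , _ , _ , ok) a a≤1
    rewrite ≢⇒≡ᵇ≡false {i} {a} (λ { ≡.refl → ℕ.<⇒≱ (ℕ.≤ᵇ⇒≤ 2 i 2≤i) a≤1 })
    = nested⇒limits-kept d c ok a a≤1

  module _ {n} (1≤n : 1 ℕ.≤ n) where

    Limited : State → Set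
    Limited s = ∀ a → a ℕ.≤ 1 → idx s a 0 ℕ.≤ n

    limited-exec : ∀ d c {s} → Nested d c → Limited s → Limited (exec c s)
    limited-exec d c {s} ok lim a a≤1
      rewrite exec-idx c s a 0 (nested⇒limits-kept d c ok a a≤1) = lim a a≤1

    1≤n^ : ∀ d → 1 ℕ.≤ n ℕ.^ d
    1≤n^ zero    = ℕ.≤-refl
    1≤n^ (suc d) = ℕ.*-mono-≤ 1≤n (1≤n^ d)

    ≤*n^ : ∀ x d → x ℕ.≤ x ℕ.* n ℕ.^ d
    ≤*n^ x d = ≡.subst (ℕ._≤ x ℕ.* n ℕ.^ d) (ℕ.*-identityʳ x) (ℕ.*-monoʳ-≤ x (1≤n^ d))

    branch-time : ∀ d {t x y z} → x ℕ.≤ y → t ℕ.≤ x ℕ.* n ℕ.^ d → z ℕ.+ t ℕ.≤ (z ℕ.+ y) ℕ.* n ℕ.^ d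
    branch-time d {t} {x} {y} {z} x≤y t≤ =
      ≡.subst (z ℕ.+ t ℕ.≤_) (≡.sym (ℕ.*-distribʳ-+ (n ℕ.^ d) z y))
        (ℕ.+-mono-≤ (≤*n^ z d) (ℕ.≤-trans t≤ (ℕ.*-monoˡ-≤ (n ℕ.^ d) x≤y)))

    record Runs (d : ℕ) (c : Code) (s s′ : State) : Set κ where
      constructor runs
      field
        {time} : ℕ
        steps  : s ⊢ compile c ⇓[ time ] s′
        time≤  : time ℕ.≤ timeFactor c ℕ.* n ℕ.^ d

    infixr 5 _▸_
    _▸_ : ∀ {d c e s s′ s″} → Runs d c s s′ → Runs d e s′ s″ → Runs d (c ⨾ e) s s″
    _▸_ {d} {c} {e} (runs {t} steps t≤) (runs {t′} steps′ t′≤) = runs (seq steps steps′)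
      (≡.subst (t ℕ.+ t′ ℕ.≤_) (≡.sym (ℕ.*-distribʳ-+ (n ℕ.^ d) (timeFactor c) (timeFactor e)))
        (ℕ.+-mono-≤ t≤ t′≤))

    -- A loop runs its body at most n times, which accounts for one more power of n; constant costs
    -- are absorbed because n is at least 1.
    compile-correct : ∀ d c → Nested d c → ∀ s → Limited s → Runs d c s (exec c s)
    compile-correct d skip          ok s lim = runs skip (≤*n^ 1 d)
    compile-correct d (a [ e ]≔ᵢ f) ok s lim = runs setᵢ (≤*n^ (timeFactor (a [ e ]≔ᵢ f)) d)
    compile-correct d (a [ e ]≔ₙ x) ok s lim = runs setₙ (≤*n^ (timeFactor (a [ e ]≔ₙ x)) d)
    compile-correct d (c ⨾ e) (ok , ok′) s lim =
      compile-correct d c ok s lim ▸ compile-correct d e ok′ (exec c s) (limited-exec d c ok lim)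
    compile-correct d (IF b THEN c ELSE e) (ok , ok′) s lim with evalTest s b in eq
    ... | true with runs steps time≤ ← compile-correct d c ok s lim =
      runs (ifᵗ eq steps) (branch-time d (ℕ.m≤m+n (timeFactor c) (timeFactor e)) time≤)
    ... | false with runs steps time≤ ← compile-correct d e ok′ s lim =
      runs (ifᶠ eq steps) (branch-time d (ℕ.m≤n+m (timeFactor e) (timeFactor c)) time≤)
    compile-correct (suc d) (FOR i BELOW N DO c) (2≤i , N≤ᵇ1 , i-kept , ok) s lim =
      runs (seq setᵢ (proj₁ (proj₂ (run v 0 (ℕ.+-identityʳ v))))) total
      where
      open Loop i N c s i-kept
      N≤1 : N ℕ.≤ 1
      N≤1 = ℕ.≤ᵇ⇒≤ N 1 N≤ᵇ1
      v = idx s N 0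
      limit : ∀ k → idx (after k) N 0 ≡ v
      limit k = idx≡ (after-agrees k) N 0
        {nested⇒limits-kept (suc d) (FOR i BELOW N DO c) (2≤i , N≤ᵇ1 , i-kept , ok) N N≤1}
      lim-after : ∀ k → Limited (after k)
      lim-after k a a≤1 rewrite idx≡ (after-agrees k) a 0
        {nested⇒limits-kept (suc d) (FOR i BELOW N DO c) (2≤i , N≤ᵇ1 , i-kept , ok) a a≤1} = lim a a≤1
      -- `r` iterations remain after the first `k`. The induction is on `r`, since a derivation for
      -- the loop unfolds from its next test.
      run : ∀ r k → r ℕ.+ k ≡ v → Σ ℕ λ t →
        (after k ⊢ While lit 1 ⊕ scalarᵢ i ≤ᵢ scalarᵢ N Do (compile c ⨾ increment i) ⇓[ t ] after v)
        × t ℕ.≤ 8 ℕ.+ r ℕ.* (14 ℕ.+ timeFactor c ℕ.* n ℕ.^ d)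
      run zero    k ≡.refl = _ , exit test , ℕ.≤-refl
        where
        test : (suc (idx (after k) i 0) ℕ.≤ᵇ idx (after k) N 0) ≡ false
        test rewrite counter k | limit k = ≰⇒≤ᵇ≡false (ℕ.1+n≰n {k})
      run (suc r) k eq
        with runs {t} body t≤ ← compile-correct d c ok (after k) (lim-after k)
           | t′ , rest , t′≤ ← run r (suc k) (≡.trans (ℕ.+-suc r k) eq)
        = _ , loop test (seq body setᵢ) rest , time
        where
        test : (suc (idx (after k) i 0) ℕ.≤ᵇ idx (after k) N 0) ≡ true
        test rewrite counter k | limit k = T⇒≡ (ℕ.≤⇒≤ᵇ (≡.subst (suc k ℕ.≤_) eq (s≤s (ℕ.m≤n+m k r))))
        time : 8 ℕ.+ (t ℕ.+ 6) ℕ.+ t′ ℕ.≤ 8 ℕ.+ suc r ℕ.* (14 ℕ.+ timeFactor c ℕ.* n ℕ.^ d)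
        time = ℕ.≤-trans (ℕ.+-mono-≤ (ℕ.+-monoʳ-≤ 8 (ℕ.+-monoˡ-≤ 6 t≤)) t′≤)
          (ℕ.≤-reflexive (loop-arithmetic (timeFactor c ℕ.* n ℕ.^ d) (r ℕ.* (14 ℕ.+ timeFactor c ℕ.* n ℕ.^ d))))
      total : 3 ℕ.+ proj₁ (run v 0 (ℕ.+-identityʳ v)) ℕ.≤ (11 ℕ.+ (14 ℕ.+ timeFactor c)) ℕ.* n ℕ.^ suc d
      total = ℕ.≤-trans (ℕ.+-monoʳ-≤ 3 (proj₂ (proj₂ (run v 0 (ℕ.+-identityʳ v))))) (begin
        11 ℕ.+ v ℕ.* (14 ℕ.+ F)
          ≤⟨ ℕ.+-mono-≤ (≤*n^ 11 (suc d)) (ℕ.*-mono-≤ (lim N N≤1) (ℕ.+-monoˡ-≤ F (≤*n^ 14 d))) ⟩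
        11 ℕ.* (n ℕ.* n ℕ.^ d) ℕ.+ n ℕ.* (14 ℕ.* n ℕ.^ d ℕ.+ F)
          ≡⟨ loop-factor n (n ℕ.^ d) (timeFactor c) ⟩
        (11 ℕ.+ (14 ℕ.+ timeFactor c)) ℕ.* n ℕ.^ suc d ∎)
        where
        open ℕ.≤-Reasoning
        F = timeFactor c ℕ.* n ℕ.^ d

  -- Branching on comparisons.

  ≤ₙ-true : ∀ {x y s} → evalTest s (x ≤ₙ y) ≡ true → evalNum s x ≤ evalNum s y
  ≤ₙ-true {x} {y} {s} eq with evalNum s x ≤? evalNum s y
  ... | yes x≤y = x≤y

  ≤ₙ-false : ∀ {x y s} → evalTest s (x ≤ₙ y) ≡ false → ¬ evalNum s x ≤ evalNum s y
  ≤ₙ-false {x} {y} {s} eq with evalNum s x ≤? evalNum s y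
  ... | no x≰y = x≰y

  ≰⇒≥ : ∀ {x y} → ¬ x ≤ y → y ≤ x
  ≰⇒≥ {x} {y} x≰y with ≤-total x y
  ... | inj₁ x≤y = contradiction x≤y x≰y
  ... | inj₂ y≤x = y≤x

  if-≤ᵢ : ∀ {ℓ} (P : State → Set ℓ) e f c d {s} →
          (evalIndex s e ℕ.≤ evalIndex s f → P (exec c s)) →
          (evalIndex s f ℕ.< evalIndex s e → P (exec d s)) →
          P (exec (IF e ≤ᵢ f THEN c ELSE d) s)
  if-≤ᵢ P e f c d onTrue onFalse = if-rule P (e ≤ᵢ f) c d
    (λ eq → onTrue (≤ᵇ≡true⇒≤ eq)) (λ eq → onFalse (≤ᵇ≡false⇒> eq))

  if-≤ₙ : ∀ {ℓ} (P : State → Set ℓ) x y c d {s} →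
          (evalNum s x ≤ evalNum s y → P (exec c s)) →
          (¬ evalNum s x ≤ evalNum s y → P (exec d s)) →
          P (exec (IF x ≤ₙ y THEN c ELSE d) s)
  if-≤ₙ P x y c d {s} onTrue onFalse = if-rule P (x ≤ₙ y) c d
    (λ eq → onTrue (≤ₙ-true {x} {y} {s} eq)) (λ eq → onFalse (≤ₙ-false {x} {y} {s} eq))

  if-between : ∀ {ℓ} (P : State → Set ℓ) e c {s} →
    (idx s low 0 ℕ.≤ evalIndex s e → evalIndex s e ℕ.< idx s high 0 → P (exec c s)) →
    (evalIndex s e ℕ.< idx s low 0 ⊎ idx s high 0 ℕ.≤ evalIndex s e → P s) →
    P (exec (whenBetween e c) s)
  if-between P e c {s} inside outside =
    if-≤ᵢ P (scalarᵢ low) e (IF lit 1 ⊕ e ≤ᵢ scalarᵢ high THEN c ELSE skip) skip {s}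
    (λ low≤e → if-≤ᵢ P (lit 1 ⊕ e) (scalarᵢ high) c skip {s}
       (λ e<high → inside low≤e e<high) (λ high≤e → outside (inj₂ (ℕ.≤-pred high≤e))))
    (λ e<low → outside (inj₁ e<low))

  open import Algebra.Properties.Ring ring using (-0#≈0#)

  -- The continuous knapsack problem

  -- `σ` is the content of an array and is controlled only below `m`; `π` is the same map as a
  -- permutation, which is what reordering a sum requires.
  record Sorting (m : ℕ) (C : ℕ → Carrier) (σ : ℕ → ℕ) : Set ℓ₂ where
    field
      π         : Permutation m m
      σ≗π       : ∀ i → σ (toℕ i) ≡ toℕ (π ⟨$⟩ʳ i)
      ascending : ∀ {i j} → i ℕ.< j → j ℕ.< m → C (σ i) ≤ C (σ j)

    σ≡π : ∀ {k} (k<m : k ℕ.< m) → σ k ≡ toℕ (π ⟨$⟩ʳ fromℕ< k<m)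
    σ≡π k<m = ≡.trans (≡.cong σ (≡.sym (toℕ-fromℕ< k<m))) (σ≗π (fromℕ< k<m))

    σ<m : ∀ {k} → k ℕ.< m → σ k ℕ.< m
    σ<m k<m = ≡.subst (ℕ._< m) (≡.sym (σ≡π k<m)) (toℕ<n _)

    σ-injective : ∀ {i j} → i ℕ.< m → j ℕ.< m → σ i ≡ σ j → i ≡ j
    σ-injective i<m j<m σi≡σj = ≡.trans (≡.sym (toℕ-fromℕ< i<m)) (≡.trans (≡.cong toℕ i≡j) (toℕ-fromℕ< j<m))
      where
      πi≡πj = toℕ-injective (≡.trans (≡.sym (σ≡π i<m)) (≡.trans σi≡σj (σ≡π j<m)))
      i≡j : fromℕ< i<m ≡ fromℕ< j<m
      i≡j = ≡.trans (≡.sym (inverseˡ π)) (≡.trans (≡.cong (π ⟨$⟩ˡ_) πi≡πj) (inverseˡ π))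

    σ-surjective : ∀ {e} → e ℕ.< m → Σ ℕ λ j → j ℕ.< m × σ j ≡ e
    σ-surjective e<m = toℕ j , toℕ<n j ,
      ≡.trans (σ≗π j) (≡.trans (≡.cong toℕ (inverseʳ π)) (toℕ-fromℕ< e<m))
      where j = π ⟨$⟩ˡ fromℕ< e<m

    sumTo-σ : ∀ f → sumTo m (λ k → f (σ k)) ≈ sumTo m f
    sumTo-σ f = sumTo-permute f π σ σ≗π

  -- The greedy solution of the continuous knapsack problem: N units have to be
  -- removed from the edges lo, …, hi − 1, at cost C and with capacity U, and
  -- the first k edges in the order σ have been treated.
  module Greedy {m} {U C : ℕ → Carrier} {σ} (sorting : Sorting m C σ)
                (0≤C : ∀ {e} → e ℕ.< m → 0# ≤ C e)
                (lo hi : ℕ) (N : Carrier) where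
    open Sorting sorting

    Inside : ℕ → Set
    Inside e = lo ℕ.≤ e × e ℕ.< hi

    -- (C e − price) (x − y) ≤ 0 for every admissible y.
    Exchange : Carrier → ℕ → Carrier → Set _
    Exchange price e x = ∀ y → 0# ≤ y → y ≤ U e → C e * x + price * y ≤ C e * y + price * x

    Saturated : ℕ → (ℕ → Carrier) → Set _
    Saturated k δ = ∀ {i} → i ℕ.< k → Inside (σ i) → δ (σ i) ≈ U (σ i)

    -- The price is a dual multiplier for the required total. The last clause looks ahead: edges
    -- still to come cost at least the price, so leaving them at 0 will satisfy `Exchange`.
    Priced : ℕ → (ℕ → Carrier) → Set _
    Priced k δ = Σ Carrier λ price → 0# ≤ price ×
      (∀ {i} → i ℕ.< k → Inside (σ i) → Exchange price (σ i) (δ (σ i))) ×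
      (∀ {j} → k ℕ.≤ j → j ℕ.< m → price ≤ C (σ j))

    record Progress (k : ℕ) (remaining spending : Carrier) (δ : ℕ → Carrier) : Set (κ Level.⊔ ℓ₁ Level.⊔ ℓ₂) where
      field
        0≤remaining : 0# ≤ remaining
        balance     : remaining + sumTo k (λ i → onlyIn lo hi δ (σ i)) ≈ N
        spending≈   : spending ≈ sumTo k (λ i → onlyIn lo hi (λ e → C e * δ e) (σ i))
        admissible  : ∀ {i} → i ℕ.< k → Inside (σ i) → 0# ≤ δ (σ i) × δ (σ i) ≤ U (σ i)
        -- Either every edge so far is used up to its bound, or the demand is met and the price has
        -- been fixed.
        phase       : Saturated k δ ⊎ (remaining ≈ 0# × Priced k δ)
    open Progress

    -- The product (C e - price)(x - y) has the right sign in three cases: a dear edge at 0, where y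
    -- can only be larger; a cheap edge at its bound, where y can only be smaller; and an edge that
    -- sets the price itself.
    exchange-above : ∀ {price e x} → price ≤ C e → x ≈ 0# → Exchange price e x
    exchange-above price≤C x≈0 y 0≤y y≤U =
      ≤-resp (trans (+-comm _ _) (+-congʳ (*-congˡ (sym x≈0))))
             (trans (+-comm _ _) (+-congˡ (*-congˡ (sym x≈0))))
             (rearrangement price≤C 0≤y)

    exchange-below : ∀ {price e x} → C e ≤ price → x ≈ U e → Exchange price e x
    exchange-below C≤price x≈U y 0≤y y≤U = rearrangement C≤price (≤-resp refl (sym x≈U) y≤U)

    exchange-at : ∀ {e x} → Exchange (C e) e x
    exchange-at _ _ _ = ≤-reflexive (+-comm _ _)

    initially : ∀ {δ} → 0# ≤ N → Progress 0 N 0# δ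
    initially 0≤N = record
      { 0≤remaining = 0≤N
      ; balance     = +-identityʳ N
      ; spending≈   = refl
      ; admissible  = λ ()
      ; phase       = inj₁ λ ()
      }

    pass : ∀ {k r s δ} → σ k ℕ.< lo ⊎ hi ℕ.≤ σ k → Progress k r s δ → Progress (suc k) r s δ
    pass {k} {r} {s} {δ} σk∉ p = record
      { 0≤remaining = 0≤remaining p
      ; balance     = trans (+-congˡ (unchanged δ)) (balance p)
      ; spending≈   = trans (spending≈ p) (sym (unchanged (λ e → C e * δ e)))
      ; admissible  = <suc-elim _ (admissible p) (λ inside → contradiction inside outside)
      ; phase       = phase′ (phase p)
      }
      where
      outside : ¬ Inside (σ k)
      outside (lo≤ , <hi) = Sum.[ (λ <lo → ℕ.<⇒≱ <lo lo≤) , (λ hi≤ → ℕ.<⇒≱ <hi hi≤) ]′ σk∉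
      unchanged : ∀ f → sumTo (suc k) (λ i → onlyIn lo hi f (σ i)) ≈ sumTo k (λ i → onlyIn lo hi f (σ i))
      unchanged f = trans (+-congˡ (reflexive (onlyIn-outside {lo} {hi} f σk∉))) (+-identityʳ _)
      phase′ : Saturated k δ ⊎ (r ≈ 0# × Priced k δ) → Saturated (suc k) δ ⊎ (r ≈ 0# × Priced (suc k) δ)
      phase′ (inj₁ sat) = inj₁ (<suc-elim _ sat (λ inside → contradiction inside outside))
      phase′ (inj₂ (r≈0 , price , 0≤price , ex , above)) = inj₂ (r≈0 , price , 0≤price ,
        <suc-elim _ ex (λ inside → contradiction inside outside) , λ k<j → above (ℕ.<⇒≤ k<j))

    -- x is the smaller of U (σ k) and the remaining amount.
    module _ {k} {r s : Carrier} {δ δ′ : ℕ → Carrier} {x : Carrier} (k<m : k ℕ.< m) (inside : Inside (σ k))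
             (δ′≈x : δ′ (σ k) ≈ x) (δ′≡δ : ∀ {e} → ¬ σ k ≡ e → δ′ e ≡ δ e)
             (0≤x : 0# ≤ x) (x≤U : x ≤ U (σ k)) (x≤r : x ≤ r)
             (extremal : x ≈ U (σ k) ⊎ x ≈ r) where

      private
        earlier : ∀ {i} → i ℕ.< k → δ′ (σ i) ≡ δ (σ i)
        earlier i<k = δ′≡δ λ σk≡σi →
          ℕ.<⇒≢ i<k (≡.sym (σ-injective k<m (ℕ.<-trans i<k k<m) σk≡σi))

        r-x≈0 : x ≈ r → r - x ≈ 0#
        r-x≈0 x≈r = trans (+-congʳ (sym x≈r)) (-‿inverseʳ x)

        extend : (f f′ : ℕ → Carrier) {v : Carrier} → (∀ {i} → i ℕ.< k → f′ (σ i) ≈ f (σ i)) → f′ (σ k) ≈ v →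
                 sumTo (suc k) (λ i → onlyIn lo hi f′ (σ i)) ≈ sumTo k (λ i → onlyIn lo hi f (σ i)) + v
        extend f f′ f′≈f f′≈v = +-cong
          (sumTo-cong k (λ {i} i<k → onlyIn-cong lo hi (σ i) {f′} {f} (λ _ _ → f′≈f i<k)))
          (trans (reflexive (onlyIn-inside f′ (proj₁ inside) (proj₂ inside))) f′≈v)

      take : Progress k r s δ → Progress (suc k) (r - x) (s + C (σ k) * x) δ′
      take p = record
        { 0≤remaining = x≤y⇒0≤y-x x≤r
        ; balance     = trans (+-congˡ (extend δ δ′ (λ i<k → reflexive (earlier i<k)) δ′≈x))
            (trans (solve 3 (λ a b y → a :+ (b :+ y) := (a :+ y) :+ b) refl (r - x) _ x)
            (trans (+-congʳ (x-y+y≈x r x)) (balance p)))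
        ; spending≈   = trans (+-congʳ (spending≈ p))
            (sym (extend (λ e → C e * δ e) (λ e → C e * δ′ e)
              (λ i<k → *-congˡ (reflexive (earlier i<k))) (*-congˡ δ′≈x)))
        ; admissible  = <suc-elim _
            (λ i<k in-i → ≡.subst (λ d → 0# ≤ d × d ≤ U _) (≡.sym (earlier i<k)) (admissible p i<k in-i))
            (λ _ → ≤-resp refl (sym δ′≈x) 0≤x , ≤-resp (sym δ′≈x) refl x≤U)
        ; phase       = phase′ (phase p)
        }
        where
        last-saturated : Saturated k δ → x ≈ U (σ k) ⊎ x ≈ r →
                         Saturated (suc k) δ′ ⊎ (r - x ≈ 0# × Priced (suc k) δ′)
        last-saturated sat (inj₁ x≈U) = inj₁ (<suc-elim _
          (λ i<k in-i → trans (reflexive (earlier i<k)) (sat i<k in-i)) (λ _ → trans δ′≈x x≈U))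
        -- The demand is met on this edge, whose cost becomes the price: earlier edges are full and
        -- cost no more, later ones cost no less.
        last-saturated sat (inj₂ x≈r) = inj₂ (r-x≈0 x≈r , C (σ k) , 0≤C (σ<m k<m) ,
          <suc-elim _
            (λ i<k in-i → exchange-below (ascending i<k k<m)
                            (trans (reflexive (earlier i<k)) (sat i<k in-i)))
            (λ _ → exchange-at) ,
          λ k<j j<m → ascending k<j j<m)

        phase′ : Saturated k δ ⊎ (r ≈ 0# × Priced k δ) →
                 Saturated (suc k) δ′ ⊎ (r - x ≈ 0# × Priced (suc k) δ′)
        phase′ (inj₁ sat) = last-saturated sat extremal
        -- Nothing remains, so x is 0, and the price stays below the cost of this edge by the clause
        -- that looked ahead.
        phase′ (inj₂ (r≈0 , price , 0≤price , ex , above)) = inj₂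
          ( trans (+-cong r≈0 (trans (-‿cong x≈0) -0#≈0#)) (+-identityʳ 0#)
          , price , 0≤price
          , <suc-elim _
              (λ i<k in-i → ≡.subst (Exchange price _) (≡.sym (earlier i<k)) (ex i<k in-i))
              (λ _ → exchange-above (above ℕ.≤-refl k<m) (trans δ′≈x x≈0))
          , λ k<j → above (ℕ.<⇒≤ k<j))
          where
          x≈0 : x ≈ 0#
          x≈0 = ≤-antisym (≤-resp refl r≈0 x≤r) 0≤x

    module _ {r s δ} (p : Progress m r s δ) where

      total : (ℕ → Carrier) → Carrier
      total f = sumTo m (onlyIn lo hi f)

      finally-balance : r + total δ ≈ N
      finally-balance = trans (+-congˡ (sym (sumTo-σ (onlyIn lo hi δ)))) (balance p)

      finally-spending : s ≈ total (λ e → C e * δ e)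
      finally-spending = trans (spending≈ p) (sumTo-σ (onlyIn lo hi λ e → C e * δ e))

      finally-admissible : ∀ {e} → e ℕ.< m → Inside e → 0# ≤ δ e × δ e ≤ U e
      finally-admissible e<m inside with j , j<m , ≡.refl ← σ-surjective e<m = admissible p j<m inside

      module _ {δ* : ℕ → Carrier} (0≤δ* : ∀ {e} → e ℕ.< m → Inside e → 0# ≤ δ* e)
               (δ*≤U : ∀ {e} → e ℕ.< m → Inside e → δ* e ≤ U e)
               (N≤total : N ≤ total δ*) where

        r+total≤total* : r + total δ ≤ total δ*
        r+total≤total* = ≤-resp (sym finally-balance) refl N≤total

        -- When all edges are at their bounds, `δ*` cannot reduce more than `δ` in total; yet it
        -- reduces at least as much as `δ` and r together.
        finally-complete : r ≤ 0#
        finally-complete with phase p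
        ... | inj₂ (r≈0 , _) = ≤-reflexive r≈0
        ... | inj₁ sat = +-cancelʳ-≤ (total δ)
          (≤-trans r+total≤total* (≤-resp refl (sym (+-identityˡ _)) total*≤total))
          where
          saturated : ∀ {e} → e ℕ.< m → Inside e → δ e ≈ U e
          saturated e<m inside with j , j<m , ≡.refl ← σ-surjective e<m = sat j<m inside
          total*≤total : total δ* ≤ total δ
          total*≤total = sumTo-mono m λ {e} e<m → onlyIn-mono lo hi e {δ*} {δ} λ p q →
            ≤-resp refl (sym (saturated e<m (p , q))) (δ*≤U e<m (p , q))

        exchange : Σ Carrier λ price → 0# ≤ price ×
          (∀ {e} → e ℕ.< m → Inside e → Exchange price e (δ e))
        exchange with phase p
        ... | inj₂ (_ , price , 0≤price , ex , _) = price , 0≤price , ex′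
          where
          ex′ : ∀ {e} → e ℕ.< m → Inside e → Exchange price e (δ e)
          ex′ e<m inside with j , j<m , ≡.refl ← σ-surjective e<m = ex j<m inside
        -- No edge has set a price. All of them are full, so any price above every cost will do, and
        -- the sum of all costs is one.
        ... | inj₁ sat = sumTo m C , sumTo-nonNegative m 0≤C , ex′
          where
          ex′ : ∀ {e} → e ℕ.< m → Inside e → Exchange (sumTo m C) e (δ e)
          ex′ e<m inside with j , j<m , ≡.refl ← σ-surjective e<m =
            exchange-below (term≤sumTo m e<m 0≤C) (sat j<m inside)

        finally-optimal : s ≤ total (λ e → C e * δ* e)
        finally-optimal with price , 0≤price , ex ← exchange =
          ≤-resp (sym finally-spending) refl (+-cancelʳ-≤ (price * total δ*) (≤-trans
            (≤-resp (linear δ δ*) (linear δ* δ)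
              (sumTo-mono m λ {e} e<m → onlyIn-mono lo hi e
                {λ e → C e * δ e + price * δ* e} {λ e → C e * δ* e + price * δ e} λ p q →
                ex e<m (p , q) _ (0≤δ* e<m (p , q)) (δ*≤U e<m (p , q))))
            -- A non-negative price turns the comparison of total reductions into one of their
            -- prices, which then cancel.
            (+-monoʳ-≤ _ (*-monoˡ-≤ 0≤price
              (≤-trans (≤-resp (+-identityˡ _) refl (+-monoˡ-≤ _ (0≤remaining p))) r+total≤total*)))))
          where
          linear : ∀ f g → total (λ e → C e * f e + price * g e) ≈ total (λ e → C e * f e) + price * total g
          linear f g = trans
            (sumTo-cong m λ {e} _ → trans (onlyIn-+ lo hi e (λ e → C e * f e) (λ e → price * g e)) (+-congˡ (onlyIn-* lo hi e price g)))
            (trans (sumTo-+ m _ _) (+-congˡ (sumTo-* m price _)))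

  -- The search over all centres and intervals

  module Search (m : ℕ) (L U C W : ℕ → Carrier) (R B : Carrier) (σ : ℕ → ℕ)
    (0≤U : ∀ {e} → e ℕ.< m → 0# ≤ (U e))
    (0≤C : ∀ {e} → e ℕ.< m → 0# ≤ (C e))
    (0≤W : ∀ {k} → k ℕ.≤ m → 0# ≤ (W k))
    (0≤R : 0# ≤ R)
    (0≤B : 0# ≤ B)
    (sorting : Sorting m C σ)
    where
    open Sorting sorting

    record Holds (s : State) : Set κ where
      field
        edges≡  : idx s edgeCount 0 ≡ m
        nodes≡  : idx s nodeCount 0 ≡ suc m
        sorted≡ : ∀ k → idx s sorted k ≡ σ k
        length≡ : ∀ k → num s lengthAt k ≡ L k
        bound≡  : ∀ k → num s boundAt k ≡ U k
        cost≡   : ∀ k → num s costAt k ≡ C k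
        weight≡ : ∀ k → num s weightAt k ≡ W k
        radius≡ : num s radius₀ 0 ≡ R
        budget≡ : num s budget₀ 0 ≡ B
    open Holds public

    Untouched : Code → Set
    Untouched c =
      (Preservesᵢ c edgeCount × Preservesᵢ c nodeCount × Preservesᵢ c sorted) ×
      (Preservesₙ c lengthAt × Preservesₙ c boundAt × Preservesₙ c costAt × Preservesₙ c weightAt) ×
      (Preservesₙ c radius₀ × Preservesₙ c budget₀)

    transfer : ∀ {c s s′} {_ : Untouched c} → Agrees c s s′ → Holds s → Holds s′
    transfer {s = s} {s′} {(i₁ , i₂ , i₃) , (n₁ , n₂ , n₃ , n₄) , (n₅ , n₆)} ag h = record
      { edges≡  = ≡.trans (idx≡ ag _ _ {i₁}) (edges≡ h)
      ; nodes≡  = ≡.trans (idx≡ ag _ _ {i₂}) (nodes≡ h)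
      ; sorted≡ = λ k → ≡.trans (idx≡ ag _ _ {i₃}) (sorted≡ h k)
      ; length≡ = λ k → ≡.trans (num≡ ag _ _ {n₁}) (length≡ h k)
      ; bound≡  = λ k → ≡.trans (num≡ ag _ _ {n₂}) (bound≡ h k)
      ; cost≡   = λ k → ≡.trans (num≡ ag _ _ {n₃}) (cost≡ h k)
      ; weight≡ = λ k → ≡.trans (num≡ ag _ _ {n₄}) (weight≡ h k)
      ; radius≡ = ≡.trans (num≡ ag _ _ {n₅}) (radius≡ h)
      ; budget≡ = ≡.trans (num≡ ag _ _ {n₆}) (budget≡ h)
      }

    -- Shortening one interval.

    total : ℕ → ℕ → (ℕ → Carrier) → Carrier
    total lo hi f = sumTo m (onlyIn lo hi f)

    -- The positive part of length minus radius, by its universal property. What follows need not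
    -- distinguish whether the interval is short enough from the outset.
    record Shortfall (lo hi : ℕ) (N : Carrier) : Set (κ Level.⊔ ℓ₂) where
      field
        0≤N        : 0# ≤ N
        sufficient : total lo hi L ≤ R + N
        necessary  : ∀ {y} → 0# ≤ y → total lo hi L ≤ R + y → N ≤ y

    computeShortfall-correct : ∀ {s} → Holds s →
      Shortfall (idx s low 0) (idx s high 0) (num (exec computeShortfall s) shortfall 0)
    computeShortfall-correct {s} h =
      if-≤ₙ (λ s′ → Shortfall lo hi (num s′ shortfall 0)) (scalarₙ shortfall) (scalarₙ radius₀)
        (shortfall ≔ₙ 0̂) (shortfall ≔ₙ scalarₙ shortfall -̂ scalarₙ radius₀) {s₂}
        (λ S≤R → record
          { 0≤N        = ≤-refl
          ; sufficient = ≤-resp S≈ (trans radius (sym (+-identityʳ R))) S≤R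
          ; necessary  = λ 0≤y _ → 0≤y
          })
        (λ S≰R → record
          { 0≤N        = x≤y⇒0≤y-x (≰⇒≥ S≰R)
          ; sufficient = ≤-reflexive (sym (trans (+-comm R _)
                           (trans (+-cong (+-cong S≈ (-‿cong radius)) refl) (x-y+y≈x _ R))))
          ; necessary  = λ {y} _ S≤R+y → +-cancelʳ-≤ R (≤-resp
                           (sym (trans (+-congʳ (+-cong S≈ (-‿cong radius))) (x-y+y≈x _ R)))
                           (+-comm R y) S≤R+y)
          })
      where
      lo = idx s low 0
      hi = idx s high 0
      s₁ = exec (shortfall ≔ₙ 0̂) s
      loop-code = FOR inner BELOW edgeCount DO whenBetween (scalarᵢ inner) addLength
      s₂ = exec loop-code s₁
      Inv : ℕ → State → Set _
      Inv k s′ = num s′ shortfall 0 ≈ sumTo k (onlyIn lo hi L)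
      summed : Inv (idx s₁ edgeCount 0) s₂
      summed = for-invariant inner edgeCount (whenBetween (scalarᵢ inner) addLength) s₁ Inv refl λ k s′ k<m ag k≡ inv →
        if-between (λ s″ → num s″ shortfall 0 ≈ sumTo (suc k) (onlyIn lo hi L)) (scalarᵢ inner)
          addLength {s′}
          (λ p q → +-cong inv (trans (reflexive (≡.trans (num≡ ag lengthAt _) (length≡ h _)))
            (reflexive (≡.trans (≡.cong L k≡) (≡.sym (onlyIn-inside L
              (≡.subst₂ ℕ._≤_ (idx≡ ag low 0) k≡ p) (≡.subst₂ ℕ._<_ k≡ (idx≡ ag high 0) q)))))))
          (λ r → trans inv (trans (sym (+-identityʳ _)) (+-congˡ (reflexive (≡.sym (onlyIn-outside {lo} {hi} L
            (Sum.map (≡.subst₂ ℕ._<_ k≡ (idx≡ ag low 0)) (≡.subst₂ ℕ._≤_ (idx≡ ag high 0) k≡) r)))))))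
      S≈ : num s₂ shortfall 0 ≈ total lo hi L
      S≈ = ≡.subst (λ k → Inv k s₂) (edges≡ h) summed
      radius : num s₂ radius₀ 0 ≈ R
      radius = reflexive (≡.trans (exec-num (shortfall ≔ₙ 0̂ ⨾ loop-code) s radius₀ 0 _) (radius≡ h))

    -- The reductions δ bring hi within the radius of lo.
    record Reaches (lo hi : ℕ) (δ : ℕ → Carrier) : Set (κ Level.⊔ ℓ₂) where
      field
        0≤δ    : ∀ {e} → e ℕ.< m → lo ℕ.≤ e → e ℕ.< hi → 0# ≤ δ e
        δ≤U    : ∀ {e} → e ℕ.< m → lo ℕ.≤ e → e ℕ.< hi → δ e ≤ U e
        enough : total lo hi L ≤ R + total lo hi δ
    open Reaches public

    expense : ℕ → ℕ → (ℕ → Carrier) → Carrier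
    expense lo hi δ = total lo hi (λ e → C e * δ e)

    -- Unlike `Quote`, this keeps hold of the reductions themselves, since the reconstruction
    -- outputs them.
    record Shortened (lo hi : ℕ) (r s : Carrier) (δ : ℕ → Carrier) : Set (κ Level.⊔ ℓ₁ Level.⊔ ℓ₂) where
      field
        complete : r ≤ 0# → Reaches lo hi δ
        spent≈   : s ≈ expense lo hi δ
        optimal  : ∀ {δ*} → Reaches lo hi δ* → r ≤ 0# × s ≤ expense lo hi δ*
    open Shortened public

    shorten-correct : ∀ {s lo hi} → Holds s → idx s low 0 ≡ lo → idx s high 0 ≡ hi →
      let s′ = exec shorten s in
      Shortened lo hi (num s′ shortfall 0) (num s′ spent 0) (num s′ reductionAt) ×
      (∀ {e} → e ℕ.< lo ⊎ hi ℕ.≤ e → num s′ reductionAt e ≡ num s reductionAt e)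
    shorten-correct {s} {lo} {hi} h ≡.refl ≡.refl =
      record { complete = complete′ ; spent≈ = finally-spending progress ; optimal = optimal′ } ,
      λ e∉ → ≡.trans (proj₂ reduced e∉) (exec-num (computeShortfall ⨾ spent ≔ₙ 0̂) s reductionAt _ _)
      where
      s₁ = exec (computeShortfall ⨾ spent ≔ₙ 0̂) s
      h₁ : Holds s₁
      h₁ = transfer (exec-agrees (computeShortfall ⨾ spent ≔ₙ 0̂) s) h
      N = num s₁ shortfall 0
      needed : Shortfall lo hi N
      needed = computeShortfall-correct h
      module N = Shortfall needed
      open Greedy sorting 0≤C lo hi N hiding (total)
      loop-code = FOR inner BELOW edgeCount DO whenBetween cheapest reduceEdge
      Inv : ℕ → State → Set _
      Inv k s′ = Progress k (num s′ shortfall 0) (num s′ spent 0) (num s′ reductionAt) ×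
        (∀ {e} → e ℕ.< lo ⊎ hi ℕ.≤ e → num s′ reductionAt e ≡ num s₁ reductionAt e)

      module Step {k s′} (k<m : k ℕ.< m) (ag : Agrees loop-code s₁ s′) (k≡ : idx s′ inner 0 ≡ k)
                  (inv : Inv k s′) where
        h′ = transfer ag h₁
        v = evalIndex s′ cheapest
        r = num s′ shortfall 0
        v≡ : v ≡ σ k
        v≡ = ≡.trans (≡.cong (idx s′ sorted) k≡) (sorted≡ h′ k)
        lo≡ : idx s′ low 0 ≡ lo
        lo≡ = ≡.trans (idx≡ ag low 0) (exec-idx (computeShortfall ⨾ spent ≔ₙ 0̂) s low 0 _)
        hi≡ : idx s′ high 0 ≡ hi
        hi≡ = ≡.trans (idx≡ ag high 0) (exec-idx (computeShortfall ⨾ spent ≔ₙ 0̂) s high 0 _)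
        bound≈ : num s′ boundAt v ≈ U (σ k)
        bound≈ = reflexive (≡.trans (bound≡ h′ v) (≡.cong U v≡))

        module _ (lo≤v : lo ℕ.≤ σ k) (v<hi : σ k ℕ.< hi) (x : Carrier) where
          δ′ : ℕ → Carrier
          δ′ = write (num s′) reductionAt v x reductionAt

          spend-step : 0# ≤ x → x ≤ U (σ k) → x ≤ r → x ≈ U (σ k) ⊎ x ≈ r →
            Progress (suc k) (r - x) (num s′ spent 0 + num s′ costAt v * x) δ′ ×
            (∀ {e} → e ℕ.< lo ⊎ hi ℕ.≤ e → δ′ e ≡ num s₁ reductionAt e)
          spend-step 0≤x x≤U x≤r extremal =
            ≡.subst (λ c → Progress (suc k) (r - x) (num s′ spent 0 + c * x) δ′)
              (≡.sym (≡.trans (cost≡ h′ v) (≡.cong C v≡)))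
              (take k<m (lo≤v , v<hi)
                (reflexive (≡.subst (λ e → δ′ e ≡ x) v≡ (write-same (num s′) reductionAt v x)))
                (λ σk≢e → unchanged (λ v≡e → σk≢e (≡.trans (≡.sym v≡) v≡e)))
                0≤x x≤U x≤r extremal (proj₁ inv)) ,
            λ e∉ → ≡.trans (unchanged (λ v≡e → outside (≡.trans (≡.sym v≡) v≡e) e∉)) (proj₂ inv e∉)
            where
            unchanged : ∀ {e} → ¬ v ≡ e → δ′ e ≡ num s′ reductionAt e
            unchanged = write-position≢ (num s′) reductionAt x
            outside : ∀ {e} → σ k ≡ e → ¬ (e ℕ.< lo ⊎ hi ℕ.≤ e)
            outside ≡.refl (inj₁ <lo) = ℕ.<⇒≱ <lo lo≤v
            outside ≡.refl (inj₂ hi≤) = ℕ.<⇒≱ v<hi hi≤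

        step : Inv (suc k) (tick inner (exec (whenBetween cheapest reduceEdge) s′))
        step = if-between (Inv (suc k)) cheapest reduceEdge {s′}
          (λ p q → let p′ = ≡.subst₂ ℕ._≤_ lo≡ v≡ p ; q′ = ≡.subst₂ ℕ._<_ v≡ hi≡ q in
            if-≤ₙ (Inv (suc k)) (num[ boundAt ] cheapest) (scalarₙ shortfall)
              (spend (num[ boundAt ] cheapest)) (spend (scalarₙ shortfall)) {s′}
              (λ U≤r → spend-step p′ q′ (num s′ boundAt v)
                (≤-resp refl (sym bound≈) (0≤U (σ<m k<m))) (≤-reflexive bound≈) U≤r (inj₁ bound≈))
              (λ U≰r → spend-step p′ q′ r
                (Progress.0≤remaining (proj₁ inv)) (≤-resp refl bound≈ (≰⇒≥ U≰r)) ≤-refl (inj₂ refl)))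
          (λ e∉ → pass (Sum.map (≡.subst₂ ℕ._<_ v≡ lo≡) (≡.subst₂ ℕ._≤_ hi≡ v≡) e∉) (proj₁ inv) , proj₂ inv)

      reduced : Inv m (exec loop-code s₁)
      reduced = ≡.subst (λ k → Inv k (exec loop-code s₁)) (edges≡ h₁)
        (for-invariant inner edgeCount (whenBetween cheapest reduceEdge) s₁ Inv
          (initially N.0≤N , λ _ → ≡.refl)
          (λ k s′ k<m ag k≡ inv → Step.step (≡.subst (k ℕ.<_) (edges≡ h₁) k<m) ag k≡ inv))
      progress = proj₁ reduced
      r = num (exec loop-code s₁) shortfall 0
      δ = num (exec loop-code s₁) reductionAt

      complete′ : r ≤ 0# → Reaches lo hi δ
      complete′ r≤0 = record
        { 0≤δ    = λ e<m p q → proj₁ (finally-admissible progress e<m (p , q))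
        ; δ≤U    = λ e<m p q → proj₂ (finally-admissible progress e<m (p , q))
        ; enough = ≤-trans N.sufficient (+-monoʳ-≤ R
            (≤-resp (finally-balance progress) (+-identityˡ _) (+-monoˡ-≤ _ r≤0)))
        }

      optimal′ : ∀ {δ*} → Reaches lo hi δ* → r ≤ 0# × num (exec loop-code s₁) spent 0 ≤ expense lo hi δ*
      optimal′ {δ*} reach =
        finally-complete progress 0≤δ* δ*≤U N≤total , finally-optimal progress 0≤δ* δ*≤U N≤total
        where
        0≤δ* : ∀ {e} → e ℕ.< m → Inside e → 0# ≤ δ* e
        0≤δ* e<m (p , q) = 0≤δ reach e<m p q
        δ*≤U : ∀ {e} → e ℕ.< m → Inside e → δ* e ≤ U e
        δ*≤U e<m (p , q) = δ≤U reach e<m p q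
        N≤total : N ≤ total lo hi δ*
        N≤total = N.necessary
          (sumTo-nonNegative m λ {e} e<m → ≤-resp (reflexive (onlyIn-0 e)) refl
            (onlyIn-mono lo hi e {λ _ → 0#} {δ*} λ p q → 0≤δ reach e<m p q))
          (enough reach)
          where
          onlyIn-0 : ∀ e → onlyIn lo hi (λ _ → 0#) e ≡ 0#
          onlyIn-0 e with within lo hi e
          ... | true  = ≡.refl
          ... | false = ≡.refl

    -- r ≤ 0 says that hi can be brought within the radius of lo, and s is then
    -- the least cost of doing so.
    record Quote (lo hi : ℕ) (r s : Carrier) : Set (κ Level.⊔ ℓ₁ Level.⊔ ℓ₂) where
      field
        attained : r ≤ 0# → Σ (ℕ → Carrier) λ δ → Reaches lo hi δ × s ≈ expense lo hi δ
        least    : ∀ {δ} → Reaches lo hi δ → r ≤ 0# × s ≤ expense lo hi δ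
    open Quote public

    QuotedAt : ℕ → State → ℕ → ℕ → Set (κ Level.⊔ ℓ₁ Level.⊔ ℓ₂)
    QuotedAt k s lo hi = Quote lo hi (num s shortfallTo k) (num s spentTo k)

    SamePriceAt : ℕ → State → State → Set κ
    SamePriceAt k s s′ = num s′ shortfallTo k ≡ num s shortfallTo k × num s′ spentTo k ≡ num s spentTo k

    quoteInterval-correct : ∀ {s k lo hi} → Holds s →
      idx s middle 0 ≡ k → idx s low 0 ≡ lo → idx s high 0 ≡ hi →
      let s′ = exec quoteInterval s in
      QuotedAt k s′ lo hi × (∀ {a} → ¬ k ≡ a → SamePriceAt a s s′)
    quoteInterval-correct {s} h ≡.refl ≡.refl ≡.refl =
      ≡.subst₂ (Quote _ _)
        (≡.sym (≡.subst (λ j → num s′ shortfallTo j ≡ num s₂ shortfall 0) slot≡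
          (write-same (num s₂) shortfallTo slot _)))
        (≡.sym (≡.subst (λ j → num s′ spentTo j ≡ num s₂ spent 0) slot≡
          (write-same (num s₂) spentTo slot _)))
        (record { attained = λ r≤0 → _ , complete shortened r≤0 , spent≈ shortened
                ; least    = optimal shortened }) ,
      λ k≢a → let p≢a = λ p≡a → k≢a (≡.trans (≡.sym slot≡) p≡a) in
        ≡.trans (write-position≢ (num s₂) shortfallTo (num s₂ shortfall 0) p≢a) (exec-num shorten s shortfallTo _ _) ,
        ≡.trans (write-position≢ (num s₂) spentTo (num s₂ spent 0) p≢a) (exec-num shorten s spentTo _ _)
      where
      s′ = exec quoteInterval s
      s₂ = exec shorten s
      shortened = proj₁ (shorten-correct h ≡.refl ≡.refl)
      slot = idx s₂ middle 0
      slot≡ : slot ≡ idx s middle 0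
      slot≡ = exec-idx shorten s middle 0 _

    -- Prices of all nodes from one centre.

    PricedFrom : ℕ → ℕ → State → Set (κ Level.⊔ ℓ₁ Level.⊔ ℓ₂)
    PricedFrom x k s = (k ℕ.≤ x → QuotedAt k s k x) × (x ℕ.≤ k → QuotedAt k s x k)

    pricedFrom-cong : ∀ {x k s s′} → SamePriceAt k s s′ → PricedFrom x k s → PricedFrom x k s′
    pricedFrom-cong (r≡ , s≡) (p , q) =
      (λ k≤x → ≡.subst₂ (Quote _ _) (≡.sym r≡) (≡.sym s≡) (p k≤x)) ,
      (λ x≤k → ≡.subst₂ (Quote _ _) (≡.sym r≡) (≡.sym s≡) (q x≤k))

    priceNode-correct : ∀ {s x k} → Holds s → idx s outer 0 ≡ x → idx s middle 0 ≡ k →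
      let s′ = exec priceNode s in
      PricedFrom x k s′ × (∀ {a} → ¬ k ≡ a → SamePriceAt a s s′)
    priceNode-correct {s} {x} {k} h ≡.refl ≡.refl =
      if-≤ᵢ (λ s₁ → Goal (exec quoteInterval s₁)) (scalarᵢ middle) (scalarᵢ outer) upward downward {s}
        (λ k≤x → let quoted , same = quoteInterval-correct (transfer (exec-agrees upward s) h) ≡.refl ≡.refl ≡.refl in
          ( (λ _ → quoted)
          -- Both orders at once force k = x, where the same quote, for an empty interval, serves
          -- either direction.
          , (λ x≤k → ≡.subst₂ (QuotedAt k (exec (upward ⨾ quoteInterval) s))
                       (ℕ.≤-antisym k≤x x≤k) (ℕ.≤-antisym x≤k k≤x) quoted)) , same)
        (λ x<k → let quoted , same = quoteInterval-correct (transfer (exec-agrees downward s) h) ≡.refl ≡.refl ≡.refl in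
          ( (λ k≤x → contradiction k≤x (ℕ.<⇒≱ x<k)) , (λ _ → quoted)) , same)
      where
      upward downward : Code
      upward = low ≔ᵢ scalarᵢ middle ⨾ high ≔ᵢ scalarᵢ outer
      downward = low ≔ᵢ scalarᵢ outer ⨾ high ≔ᵢ scalarᵢ middle
      Goal : State → Set _
      Goal s′ = PricedFrom x k s′ × (∀ {a} → ¬ k ≡ a → SamePriceAt a s s′)

    AllPricedFrom : ℕ → State → Set (κ Level.⊔ ℓ₁ Level.⊔ ℓ₂)
    AllPricedFrom x s = ∀ {k} → k ℕ.≤ m → PricedFrom x k s

    pricing : Code
    pricing = FOR middle BELOW nodeCount DO priceNode

    pricing-correct : ∀ {s} → Holds s → AllPricedFrom (idx s outer 0) (exec pricing s)
    pricing-correct {s} h {k} k≤m = ≡.subst (λ n → Inv n (exec pricing s)) (nodes≡ h)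
      (for-invariant middle nodeCount priceNode s Inv (λ ()) step) (s≤s k≤m)
      where
      x = idx s outer 0
      Inv : ℕ → State → Set _
      Inv n s′ = ∀ {k} → k ℕ.< n → PricedFrom x k s′
      step : ∀ n s′ → n ℕ.< idx s nodeCount 0 → Agrees pricing s s′ → idx s′ middle 0 ≡ n →
             Inv n s′ → Inv (suc n) (tick middle (exec priceNode s′))
      step n s′ _ ag n≡ inv = <suc-elim (λ k → PricedFrom x k (exec priceNode s′))
        (λ {k} k<n → pricedFrom-cong {s = s′} {exec priceNode s′} (proj₂ priced (ℕ.>⇒≢ k<n)) (inv k<n))
        (proj₁ priced)
        where priced = priceNode-correct (transfer ag h) (idx≡ ag outer 0) n≡

    -- Affordable intervals and the nested search loops.

    from : ℕ → (ℕ → Carrier) → ℕ → Carrier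
    from a f k = if a ℕ.≤ᵇ k then f k else 0#

    intervalWeight : ℕ → ℕ → Carrier
    intervalWeight a b = sumTo (suc b) (from a W)

    -- Each side has a vector of its own, of which only the entries on that side count: no edge lies
    -- on both sides of `x`, so the sides interact through the budget alone.
    record Affordable (a x b : ℕ) : Set (κ Level.⊔ ℓ₂) where
      field
        a≤x       : a ℕ.≤ x
        x≤b       : x ℕ.≤ b
        b≤m       : b ℕ.≤ m
        {δˡ} {δʳ} : ℕ → Carrier
        reachesˡ  : Reaches a x δˡ
        reachesʳ  : Reaches x b δʳ
        affords   : expense a x δˡ + expense x b δʳ ≤ B
    open Affordable public

    best : State → Carrier
    best s = num s bestWeight 0

    -- An inequality suffices: the recorded weight has to dominate all intervals tried and must not
    -- exceed the champion's own. This admits the initial value 0.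
    Champion : State → Set (κ Level.⊔ ℓ₂)
    Champion s = Affordable (idx s bestLow 0) (idx s bestCentre 0) (idx s bestHigh 0) ×
                 best s ≤ intervalWeight (idx s bestLow 0) (idx s bestHigh 0)

    champion-agrees : ∀ {c s s′}
      {_ : Preservesᵢ c bestLow × Preservesᵢ c bestCentre × Preservesᵢ c bestHigh} {_ : Preservesₙ c bestWeight} →
      Agrees c s s′ → Champion s → Champion s′
    champion-agrees {s′ = s′} {p , q , r} {t} ag (affordable , worth) =
      ≡.subst (λ a → Affordable a (idx s′ bestCentre 0) (idx s′ bestHigh 0)) (≡.sym low≡)
        (≡.subst₂ (Affordable _) (≡.sym (idx≡ ag bestCentre 0 {q})) (≡.sym high≡) affordable) ,
      ≡.subst₂ (λ a b → best s′ ≤ intervalWeight a b) (≡.sym low≡) (≡.sym high≡)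
        (≡.subst (_≤ _) (≡.sym (num≡ ag bestWeight 0 {t})) worth)
      where
      low≡ = idx≡ ag bestLow 0 {p}
      high≡ = idx≡ ag bestHigh 0 {r}

    allPriced-agrees : ∀ {c s s′ x} {_ : Preservesₙ c shortfallTo} {_ : Preservesₙ c spentTo} →
      Agrees c s s′ → AllPricedFrom x s → AllPricedFrom x s′
    allPriced-agrees {s = s} {s′} {_} {p} {q} ag priced {k} k≤m =
      pricedFrom-cong {s = s} {s′} (num≡ ag shortfallTo k {p} , num≡ ag spentTo k {q}) (priced k≤m)

    -- Every failing test but the last refutes affordability, because quotes are minimal; the last
    -- one says that the champion is already at least as heavy.
    updateBest-correct : ∀ {s a x b} → Holds s →
      idx s middle 0 ≡ a → idx s outer 0 ≡ x → idx s inner 0 ≡ b →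
      let s′ = exec updateBest s in
      a ℕ.≤ x → b ℕ.≤ m → AllPricedFrom x s → Champion s → num s weightSoFar 0 ≈ intervalWeight a b →
         Champion s′ × best s ≤ best s′ × (Affordable a x b → intervalWeight a b ≤ best s′)
    updateBest-correct {s} {a} {x} {b} h ≡.refl ≡.refl ≡.refl a≤x b≤m priced ch w≈ =
      if-≤ᵢ P (scalarᵢ outer) (scalarᵢ inner)
        (keepReaching (scalarᵢ middle) (keepReaching (scalarᵢ inner) keepAffordable)) skip {s}
        (λ x≤b →
          let quoteˡ = proj₁ (priced (ℕ.≤-trans a≤x (ℕ.≤-trans x≤b b≤m))) a≤x
              quoteʳ = proj₂ (priced b≤m) x≤b
          in
          if-≤ₙ P (num[ shortfallTo ] scalarᵢ middle) 0̂
            (keepReaching (scalarᵢ inner) keepAffordable) skip {s}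
          (λ rˡ≤0 → if-≤ₙ P (num[ shortfallTo ] scalarᵢ inner) 0̂ keepAffordable skip {s}
          (λ rʳ≤0 → if-≤ₙ P (num[ spentTo ] scalarᵢ middle +̂ num[ spentTo ] scalarᵢ inner) (scalarₙ budget₀)
            keepHeavier skip {s}
          (λ cost≤B → if-≤ₙ P (scalarₙ bestWeight) (scalarₙ weightSoFar) setBest skip {s}
            (λ best≤w →
              let _ , reachˡ , costˡ = attained quoteˡ rˡ≤0
                  _ , reachʳ , costʳ = attained quoteʳ rʳ≤0
              in (record { a≤x = a≤x ; x≤b = x≤b ; b≤m = b≤m
                         ; reachesˡ = reachˡ ; reachesʳ = reachʳ
                         ; affords = ≤-resp (+-cong costˡ costʳ) (reflexive (budget≡ h)) cost≤B } ,
                  ≤-reflexive w≈) ,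
                 best≤w , λ _ → ≤-reflexive (sym w≈))
            (λ best≰w → reject λ _ → ≤-resp w≈ refl (≰⇒≥ best≰w)))
          (λ cost≰B → reject λ aff → contradiction
            (≤-trans (+-mono-≤ (proj₂ (least quoteˡ (reachesˡ aff))) (proj₂ (least quoteʳ (reachesʳ aff))))
                     (≤-resp refl (reflexive (≡.sym (budget≡ h))) (affords aff))) cost≰B))
          (λ rʳ≰0 → reject λ aff → contradiction (proj₁ (least quoteʳ (reachesʳ aff))) rʳ≰0))
          (λ rˡ≰0 → reject λ aff → contradiction (proj₁ (least quoteˡ (reachesˡ aff))) rˡ≰0))
        (λ b<x → reject λ aff → contradiction (x≤b aff) (ℕ.<⇒≱ b<x))
      where
      P : State → Set _
      P s′ = Champion s′ × best s ≤ best s′ × (Affordable a x b → intervalWeight a b ≤ best s′)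
      reject : (Affordable a x b → intervalWeight a b ≤ best s) → P s
      reject dominated = ch , ≤-refl , dominated

    module _ {s} (h : Holds s) {a x} (a≡ : idx s middle 0 ≡ a) (x≡ : idx s outer 0 ≡ x) (a≤x : a ℕ.≤ x)
             (priced : AllPricedFrom x s) (champion : Champion s) (w≈0 : num s weightSoFar 0 ≈ 0#) where

      private
        highs : Code
        highs = FOR inner BELOW nodeCount DO tryHigh

        Inv : ℕ → State → Set _
        Inv n s′ = Champion s′ × best s ≤ best s′ × num s′ weightSoFar 0 ≈ sumTo n (from a W) ×
          (∀ {b} → b ℕ.< n → Affordable a x b → intervalWeight a b ≤ best s′)

        step : ∀ n s′ → n ℕ.< idx s nodeCount 0 → Agrees highs s s′ → idx s′ inner 0 ≡ n →
               Inv n s′ → Inv (suc n) (tick inner (exec tryHigh s′))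
        step n s′ n<nodes ag n≡ (champion′ , best≤ , w≈ , tried) =
          if-≤ᵢ (λ s₁ → Inv (suc n) (exec updateBest s₁)) (scalarᵢ middle) (scalarᵢ inner) addWeight skip {s′}
            (λ a≤n → update (exec addWeight s′) (exec-agrees addWeight s′) ≡.refl (+-cong w≈
              (reflexive (≡.trans (≡.trans (weight≡ h′ _) (≡.cong W n≡))
                (≡.sym (from-≤ (≡.subst₂ ℕ._≤_ middle≡ n≡ a≤n)))))))
            (λ n<a → update s′ agrees-refl ≡.refl
              (trans w≈ (trans (sym (+-identityʳ _)) (+-congˡ (reflexive (≡.sym
                (from-> (≡.subst₂ ℕ._<_ n≡ middle≡ n<a))))))))
          where
          h′ = transfer ag h
          middle≡ = ≡.trans (idx≡ ag middle 0) a≡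
          from-≤ : a ℕ.≤ n → from a W n ≡ W n
          from-≤ a≤n rewrite T⇒≡ (ℕ.≤⇒≤ᵇ a≤n) = ≡.refl
          from-> : n ℕ.< a → from a W n ≡ 0#
          from-> n<a rewrite ≰⇒≤ᵇ≡false (ℕ.<⇒≱ n<a) = ≡.refl
          update : ∀ s₁ → Agrees addWeight s′ s₁ → best s₁ ≡ best s′ →
                   num s₁ weightSoFar 0 ≈ intervalWeight a n → Inv (suc n) (exec updateBest s₁)
          update s₁ ag₁ best≡ w₁≈ =
            let champion₂ , best₁≤best₂ , new = updateBest-correct {s₁} (transfer ag₁ h′)
                  (≡.trans (idx≡ ag₁ middle 0) middle≡)
                  (≡.trans (idx≡ ag₁ outer 0) (≡.trans (idx≡ ag outer 0) x≡))
                  (≡.trans (idx≡ ag₁ inner 0) n≡) a≤x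
                  (ℕ.≤-pred (≡.subst (n ℕ.<_) (nodes≡ h) n<nodes))
                  (allPriced-agrees ag₁ (allPriced-agrees ag priced))
                  (champion-agrees ag₁ champion′) w₁≈
                best′≤ = ≡.subst (_≤ best (exec updateBest s₁)) best≡ best₁≤best₂
            in champion₂ , ≤-trans best≤ best′≤ ,
               trans (reflexive (exec-num updateBest s₁ weightSoFar 0 _)) w₁≈ ,
               <suc-elim (λ b → Affordable a x b → intervalWeight a b ≤ best (exec updateBest s₁))
                 (λ b<n aff → ≤-trans (tried b<n aff) best′≤) new

      highs-correct : let s′ = exec highs s in
        Champion s′ × best s ≤ best s′ × (∀ {b} → Affordable a x b → intervalWeight a b ≤ best s′)
      highs-correct =
        let champion′ , best≤ , _ , tried = ≡.subst (λ n → Inv n (exec highs s)) (nodes≡ h)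
              (for-invariant inner nodeCount tryHigh s Inv (champion , ≤-refl , w≈0 , λ ()) step)
        in champion′ , best≤ , λ aff → tried (s≤s (b≤m aff)) aff

    module _ {s} (h : Holds s) {x} (x≡ : idx s outer 0 ≡ x)
             (priced : AllPricedFrom x s) (champion : Champion s) where

      private
        lows : Code
        lows = FOR middle BELOW nodeCount DO tryLow

        Inv : ℕ → State → Set _
        Inv n s′ = Champion s′ × best s ≤ best s′ ×
          (∀ {a} → a ℕ.< n → ∀ {b} → Affordable a x b → intervalWeight a b ≤ best s′)

        step : ∀ n s′ → n ℕ.< idx s nodeCount 0 → Agrees lows s s′ → idx s′ middle 0 ≡ n →
               Inv n s′ → Inv (suc n) (tick middle (exec tryLow s′))
        step n s′ _ ag n≡ (champion′ , best≤ , tried) =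
          if-≤ᵢ (Inv (suc n)) (scalarᵢ middle) (scalarᵢ outer)
            (weightSoFar ≔ₙ 0̂ ⨾ FOR inner BELOW nodeCount DO tryHigh) skip {s′}
            (λ n≤x →
              let s₁ = exec (weightSoFar ≔ₙ 0̂) s′
                  ag₁ = exec-agrees (weightSoFar ≔ₙ 0̂) s′
                  champion₂ , best′≤ , new = highs-correct {s₁} (transfer ag₁ (transfer ag h)) n≡ x≡′
                    (≡.subst₂ ℕ._≤_ n≡ x≡′ n≤x) (allPriced-agrees ag₁ (allPriced-agrees ag priced))
                    (champion-agrees ag₁ champion′) refl
              in champion₂ , ≤-trans best≤ best′≤ ,
                 <suc-elim (λ a → ∀ {b} → Affordable a x b → intervalWeight a b ≤ _)
                   (λ a<n aff → ≤-trans (tried a<n aff) best′≤) new)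
            (λ x<n → champion′ , best≤ ,
              <suc-elim (λ a → ∀ {b} → Affordable a x b → intervalWeight a b ≤ best s′) tried
                (λ aff → contradiction (a≤x aff) (ℕ.<⇒≱ (≡.subst₂ ℕ._<_ x≡′ n≡ x<n))))
          where
          x≡′ = ≡.trans (idx≡ ag outer 0) x≡

      lows-correct : let s′ = exec lows s in
        Champion s′ × best s ≤ best s′ × (∀ {a b} → Affordable a x b → intervalWeight a b ≤ best s′)
      lows-correct =
        let champion′ , best≤ , tried = ≡.subst (λ n → Inv n (exec lows s)) (nodes≡ h)
              (for-invariant middle nodeCount tryLow s Inv (champion , ≤-refl , λ ()) step)
        in champion′ , best≤ ,
           λ aff → tried (s≤s (ℕ.≤-trans (a≤x aff) (ℕ.≤-trans (x≤b aff) (b≤m aff)))) aff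

    Optimum : State → Set _
    Optimum s = Affordable (idx s bestLow 0) (idx s bestCentre 0) (idx s bestHigh 0) ×
      (∀ {a x b} → Affordable a x b → intervalWeight a b ≤ intervalWeight (idx s bestLow 0) (idx s bestHigh 0))

    trivial-affordable : Affordable 0 0 0
    trivial-affordable = record
      { a≤x = z≤n ; x≤b = z≤n ; b≤m = z≤n ; reachesˡ = reaches ; reachesʳ = reaches
      ; affords = ≤-resp (sym (trans (+-cong (empty λ e → C e * 0#) (empty λ e → C e * 0#)) (+-identityʳ 0#))) refl 0≤B }
      where
      empty : ∀ f → total 0 0 f ≈ 0#
      empty f = sumTo-0 m (λ _ → refl)
      reaches : Reaches 0 0 (λ _ → 0#)
      reaches = record { 0≤δ = λ _ _ () ; δ≤U = λ _ _ ()
                       ; enough = ≤-resp (sym (empty L)) (sym (trans (+-congˡ (empty λ _ → 0#)) (+-identityʳ R))) 0≤R }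

    search-correct : ∀ {s} → Holds s → Optimum (exec search s)
    search-correct {s} h = proj₁ champion , λ aff →
      ≤-trans (tried (s≤s (ℕ.≤-trans (x≤b aff) (b≤m aff))) aff) (proj₂ champion)
      where
      initialise loop-code : Code
      initialise = bestWeight ≔ₙ 0̂ ⨾ bestLow ≔ᵢ lit 0 ⨾ bestCentre ≔ᵢ lit 0 ⨾ bestHigh ≔ᵢ lit 0
      loop-code = FOR outer BELOW nodeCount DO tryCentre
      s₁ = exec initialise s
      h₁ : Holds s₁
      h₁ = transfer (exec-agrees initialise s) h
      Inv : ℕ → State → Set _
      Inv n s′ = Champion s′ ×
        (∀ {x} → x ℕ.< n → ∀ {a b} → Affordable a x b → intervalWeight a b ≤ best s′)
      step : ∀ n s′ → n ℕ.< idx s₁ nodeCount 0 → Agrees loop-code s₁ s′ → idx s′ outer 0 ≡ n →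
             Inv n s′ → Inv (suc n) (tick outer (exec tryCentre s′))
      step n s′ _ ag n≡ (champion′ , tried) =
        let s₂ = exec pricing s′
            ag₂ = exec-agrees pricing s′
            h′ = transfer ag h₁
            champion₃ , best≤ , new = lows-correct {s₂} (transfer ag₂ h′) (≡.trans (idx≡ ag₂ outer 0) n≡)
              (≡.subst (λ x → AllPricedFrom x s₂) n≡ (pricing-correct h′)) (champion-agrees ag₂ champion′)
        in champion₃ ,
           <suc-elim (λ x → ∀ {a b} → Affordable a x b → intervalWeight a b ≤ best (exec tryCentre s′))
             (λ x<n aff → ≤-trans (tried x<n aff)
                (≡.subst (_≤ best (exec tryCentre s′)) (num≡ ag₂ bestWeight 0) best≤)) new
      result : Inv (suc m) (exec loop-code s₁)
      result = ≡.subst (λ n → Inv n (exec loop-code s₁)) (nodes≡ h₁)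
        (for-invariant outer nodeCount tryCentre s₁ Inv
          ((trivial-affordable , sumTo-nonNegative 1 {from 0 W} (λ { {zero} _ → 0≤W z≤n ; {suc _} (s≤s ()) })) , λ ()) step)
      champion = proj₁ result
      tried = proj₂ result

    -- Reductions for the best triple.

    record Reconstructed (a x b : ℕ) (δ : ℕ → Carrier) : Set (κ Level.⊔ ℓ₂) where
      field
        nonNegative  : ∀ {e} → e ℕ.< m → 0# ≤ δ e
        bounded      : ∀ {e} → e ℕ.< m → δ e ≤ U e
        withinBudget : sumTo m (λ e → C e * δ e) ≤ B
        covers       : total a x L ≤ R + total a x δ × total x b L ≤ R + total x b δ

    total-cong : ∀ {lo hi f g} → (∀ {e} → lo ℕ.≤ e → e ℕ.< hi → f e ≈ g e) → total lo hi f ≈ total lo hi g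
    total-cong {lo} {hi} {f} {g} f≈g = sumTo-cong m λ {e} _ → onlyIn-cong lo hi e {f} {g} f≈g

    reaches-cong : ∀ {lo hi δ δ′} → (∀ {e} → lo ℕ.≤ e → e ℕ.< hi → δ e ≈ δ′ e) → Reaches lo hi δ → Reaches lo hi δ′
    reaches-cong {lo} {hi} δ≈δ′ reach = record
      { 0≤δ    = λ e<m p q → ≤-resp refl (δ≈δ′ p q) (0≤δ reach e<m p q)
      ; δ≤U    = λ e<m p q → ≤-resp (δ≈δ′ p q) refl (δ≤U reach e<m p q)
      ; enough = ≤-resp refl (+-congˡ (total-cong {lo} {hi} δ≈δ′)) (enough reach)
      }

    module _ {a x b} {δ₂ δ₃ : ℕ → Carrier} (aff : Affordable a x b)
      (zero-outside : ∀ {e} → e ℕ.< m → e ℕ.< a ⊎ x ℕ.≤ e → δ₂ e ≡ 0#)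
      (kept-outside : ∀ {e} → e ℕ.< x ⊎ b ℕ.≤ e → δ₃ e ≡ δ₂ e)
      (reach₂ : Reaches a x δ₂) (expense₂≤ : expense a x δ₂ ≤ expense a x (δˡ aff))
      (reach₃ : Reaches x b δ₃) (expense₃≤ : expense x b δ₃ ≤ expense x b (δʳ aff))
      where

      private
        δ₂≈δ₃ : ∀ {e} → e ℕ.< x → δ₂ e ≈ δ₃ e
        δ₂≈δ₃ e<x = reflexive (≡.sym (kept-outside (inj₁ e<x)))

        reach₃ˡ : Reaches a x δ₃
        reach₃ˡ = reaches-cong (λ _ → δ₂≈δ₃) reach₂

        unreduced : ∀ {e} → e ℕ.< m → e ℕ.< a ⊎ x ℕ.≤ e → e ℕ.< x ⊎ b ℕ.≤ e → δ₃ e ≡ 0#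
        unreduced e<m e∉ˡ e∉ʳ = ≡.trans (kept-outside e∉ʳ) (zero-outside e<m e∉ˡ)

        bounds-at : ∀ {e} → e ℕ.< m → 0# ≤ δ₃ e × δ₃ e ≤ U e
        bounds-at {e} e<m with locate a x e | locate x b e
        ... | inj₁ (a≤e , e<x) | _ = 0≤δ reach₃ˡ e<m a≤e e<x , δ≤U reach₃ˡ e<m a≤e e<x
        ... | inj₂ _ | inj₁ (x≤e , e<b) = 0≤δ reach₃ e<m x≤e e<b , δ≤U reach₃ e<m x≤e e<b
        ... | inj₂ e∉ˡ | inj₂ e∉ʳ = ≡.subst (λ d → 0# ≤ d × d ≤ U e) (≡.sym (unreduced e<m e∉ˡ e∉ʳ))
          (≤-refl , 0≤U e<m)

        cost : ℕ → Carrier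
        cost e = C e * δ₃ e

        split : ∀ {e} → e ℕ.< m → cost e ≈ onlyIn a x cost e + onlyIn x b cost e
        split {e} e<m with locate a x e | locate x b e
        ... | inj₁ (a≤e , e<x) | _ = sym (trans
          (+-cong (reflexive (onlyIn-inside cost a≤e e<x)) (reflexive (onlyIn-outside {x} {b} cost (inj₁ e<x))))
          (+-identityʳ _))
        ... | inj₂ e∉ˡ | inj₁ (x≤e , e<b) = sym (trans
          (+-cong (reflexive (onlyIn-outside {a} {x} cost e∉ˡ)) (reflexive (onlyIn-inside cost x≤e e<b)))
          (+-identityˡ _))
        ... | inj₂ e∉ˡ | inj₂ e∉ʳ = trans (*-congˡ (reflexive (unreduced e<m e∉ˡ e∉ʳ))) (trans (zeroʳ (C e))
          (sym (trans (+-cong (reflexive (onlyIn-outside {a} {x} cost e∉ˡ))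
                              (reflexive (onlyIn-outside {x} {b} cost e∉ʳ))) (+-identityʳ 0#))))

      -- `δ₂` is the vector after the left run and `δ₃` the one after the right run. The second run
      -- leaves the left side alone and everything else was 0, so the cost of `δ₃` splits into the
      -- expenses of the two sides.
      assemble : Reconstructed a x b δ₃
      assemble = record
        { nonNegative  = λ e<m → proj₁ (bounds-at e<m)
        ; bounded      = λ e<m → proj₂ (bounds-at e<m)
        ; withinBudget = ≤-resp (sym (trans (sumTo-cong m split) (sumTo-+ m _ _))) refl
            (≤-trans (+-mono-≤
              (≤-resp (total-cong {a} {x} λ _ e<x → *-congˡ (δ₂≈δ₃ e<x)) refl expense₂≤) expense₃≤)
              (affords aff))
        ; covers       = enough reach₃ˡ , enough reach₃
        }

    reset-correct : ∀ {s} → Holds s → ∀ {e} → e ℕ.< m →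
      num (exec resetReductions s) reductionAt e ≡ 0#
    reset-correct {s} h = ≡.subst (λ n → Inv n (exec resetReductions s)) (edges≡ h)
      (for-invariant inner edgeCount resetReduction s Inv (λ ()) step)
      where
      Inv : ℕ → State → Set _
      Inv n s′ = ∀ {e} → e ℕ.< n → num s′ reductionAt e ≡ 0#
      step : ∀ n s′ → n ℕ.< idx s edgeCount 0 → Agrees _ s s′ → idx s′ inner 0 ≡ n → Inv n s′ →
             Inv (suc n) (tick inner (exec resetReduction s′))
      step n s′ _ _ ≡.refl inv = <suc-elim (λ e → write (num s′) reductionAt n 0# reductionAt e ≡ 0#)
        (λ e<n → ≡.trans (write-position≢ (num s′) reductionAt 0# (ℕ.>⇒≢ e<n)) (inv e<n))
        (write-same (num s′) reductionAt n 0#)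

    -- The two runs are compared with the vectors inside `aff`, not with prices from the search,
    -- which have been overwritten: by minimality each run costs no more than its counterpart.
    reconstruct-correct : ∀ {s} → Holds s → ∀ {a x b} →
      idx s bestLow 0 ≡ a → idx s bestCentre 0 ≡ x → idx s bestHigh 0 ≡ b → Affordable a x b →
      let s₁ = exec resetReductions s
          s₂ = exec shorten (exec selectLeft s₁)
          s₃ = exec shorten (exec selectRight s₂)
      in Reconstructed a x b (num s₃ reductionAt)
    reconstruct-correct {s} h {a} {x} {b} low≡ centre≡ high≡ aff =
      let s₁ = exec resetReductions s
          s₂ = exec shorten (exec selectLeft s₁)
          s₃ = exec shorten (exec selectRight s₂)
          ag₁ = exec-agrees resetReductions s
          ag₂ = exec-agrees shorten (exec selectLeft s₁)
          h₁ = transfer (exec-agrees selectLeft s₁) (transfer ag₁ h)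
          h₂ = transfer (exec-agrees selectRight s₂) (transfer ag₂ h₁)
          centre₁≡ = ≡.trans (idx≡ ag₁ bestCentre 0) centre≡
          left , keptˡ = shorten-correct {exec selectLeft s₁} h₁ (≡.trans (idx≡ ag₁ bestLow 0) low≡) centre₁≡
          right , keptʳ = shorten-correct {exec selectRight s₂} h₂ (≡.trans (idx≡ ag₂ bestCentre 0) centre₁≡)
            (≡.trans (idx≡ ag₂ bestHigh 0) (≡.trans (idx≡ ag₁ bestHigh 0) high≡))
          r₂≤0 , expense₂≤ = optimal left (reachesˡ aff)
          r₃≤0 , expense₃≤ = optimal right (reachesʳ aff)
      in assemble {δ₂ = num s₂ reductionAt} {num s₃ reductionAt} aff
           (λ e<m e∉ → ≡.trans (keptˡ e∉) (reset-correct h e<m)) keptʳ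
           (complete left r₂≤0) (≤-trans (≤-reflexive (sym (spent≈ left))) expense₂≤)
           (complete right r₃≤0) (≤-trans (≤-reflexive (sym (spent≈ right))) expense₃≤)

  -- Sorting by rank

  module Ranking (m : ℕ) (C : ℕ → Carrier) where

    -- The strict order by cost, where ties are broken by position.
    infix 4 _≺_
    _≺_ : ℕ → ℕ → Set ℓ₂
    f ≺ e = (f ℕ.< e × C f ≤ C e) ⊎ (e ℕ.≤ f × ¬ C e ≤ C f)

    _≺?_ : ∀ f e → Dec (f ≺ e)
    f ≺? e with ℕ.<-≤-connex f e | C f ≤? C e | C e ≤? C f
    ... | inj₁ f<e | yes Cf≤Ce | _ = yes (inj₁ (f<e , Cf≤Ce))
    ... | inj₁ f<e | no Cf≰Ce  | _ =
      no Sum.[ (λ (_ , Cf≤Ce) → Cf≰Ce Cf≤Ce) , (λ (e≤f , _) → ℕ.<⇒≱ f<e e≤f) ]′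
    ... | inj₂ e≤f | _ | yes Ce≤Cf =
      no Sum.[ (λ (f<e , _) → ℕ.<⇒≱ f<e e≤f) , (λ (_ , Ce≰Cf) → Ce≰Cf Ce≤Cf) ]′
    ... | inj₂ e≤f | _ | no Ce≰Cf  = yes (inj₂ (e≤f , Ce≰Cf))

    ≺-irrefl : ∀ {e} → ¬ e ≺ e
    ≺-irrefl (inj₁ (e<e , _)) = ℕ.<-irrefl ≡.refl e<e
    ≺-irrefl (inj₂ (_ , Ce≰Ce)) = Ce≰Ce ≤-refl

    cheaper⇒≺ : ∀ {f e} → ¬ C e ≤ C f → f ≺ e
    cheaper⇒≺ {f} {e} Ce≰Cf with ℕ.<-≤-connex f e
    ... | inj₁ f<e = inj₁ (f<e , ≰⇒≥ Ce≰Cf)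
    ... | inj₂ e≤f = inj₂ (e≤f , Ce≰Cf)

    ≺-trans : ∀ {f e g} → f ≺ e → e ≺ g → f ≺ g
    ≺-trans (inj₁ (f<e , Cf≤Ce)) (inj₁ (e<g , Ce≤Cg)) = inj₁ (ℕ.<-trans f<e e<g , ≤-trans Cf≤Ce Ce≤Cg)
    ≺-trans (inj₁ (_ , Cf≤Ce)) (inj₂ (_ , Cg≰Ce)) = cheaper⇒≺ λ Cg≤Cf → Cg≰Ce (≤-trans Cg≤Cf Cf≤Ce)
    ≺-trans (inj₂ (_ , Ce≰Cf)) (inj₁ (_ , Ce≤Cg)) = cheaper⇒≺ λ Cg≤Cf → Ce≰Cf (≤-trans Ce≤Cg Cg≤Cf)
    ≺-trans (inj₂ (_ , Ce≰Cf)) (inj₂ (_ , Cg≰Ce)) = cheaper⇒≺ λ Cg≤Cf → Cg≰Ce (≤-trans Cg≤Cf (≰⇒≥ Ce≰Cf))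

    ≺-connex : ∀ {f e} → f ℕ.< e → f ≺ e ⊎ e ≺ f
    ≺-connex {f} {e} f<e with C f ≤? C e
    ... | yes Cf≤Ce = inj₁ (inj₁ (f<e , Cf≤Ce))
    ... | no Cf≰Ce  = inj₂ (inj₂ (ℕ.<⇒≤ f<e , Cf≰Ce))

    rankOf : ℕ → ℕ
    rankOf e = count (_≺? e) m

    rankOf<m : ∀ {e} → e ℕ.< m → rankOf e ℕ.< m
    rankOf<m e<m = count< _ e<m ≺-irrefl

    rankOf-mono : ∀ {f e} → f ℕ.< m → f ≺ e → rankOf f ℕ.< rankOf e
    rankOf-mono f<m f≺e = count-strict _ _ (λ g≺f → ≺-trans g≺f f≺e) f<m ≺-irrefl f≺e

    rankOf-injective : ∀ {f e} → f ℕ.< m → e ℕ.< m → rankOf f ≡ rankOf e → f ≡ e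
    rankOf-injective {f} {e} f<m e<m eq with ℕ.<-cmp f e
    ... | tri≈ _ f≡e _ = f≡e
    ... | tri< f<e _ _ = contradiction eq
      (Sum.[ (λ f≺e → ℕ.<⇒≢ (rankOf-mono f<m f≺e)) , (λ e≺f → ℕ.>⇒≢ (rankOf-mono e<m e≺f)) ]′ (≺-connex f<e))
    ... | tri> _ _ e<f = contradiction eq
      (Sum.[ (λ e≺f → ℕ.>⇒≢ (rankOf-mono e<m e≺f)) , (λ f≺e → ℕ.<⇒≢ (rankOf-mono f<m f≺e)) ]′ (≺-connex e<f))

    module _ (σ : ℕ → ℕ) (σ∘rank : ∀ {e} → e ℕ.< m → σ (rankOf e) ≡ e) where

      private
        ρ : Fin m → Fin m
        ρ e = fromℕ< (rankOf<m (toℕ<n e))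

        toℕ-ρ : ∀ e → toℕ (ρ e) ≡ rankOf (toℕ e)
        toℕ-ρ e = toℕ-fromℕ< (rankOf<m (toℕ<n e))

        ρ-injective : Injective _≡_ _≡_ ρ
        ρ-injective {f} {e} eq = toℕ-injective (rankOf-injective (toℕ<n f) (toℕ<n e)
          (≡.trans (≡.sym (toℕ-ρ f)) (≡.trans (≡.cong toℕ eq) (toℕ-ρ e))))

        ρ⁻¹ : Fin m → Fin m
        ρ⁻¹ j = proj₁ (injective⇒surjective ρ-injective j)

        ρ∘ρ⁻¹ : ∀ j → ρ (ρ⁻¹ j) ≡ j
        ρ∘ρ⁻¹ j = proj₂ (injective⇒surjective ρ-injective j)

        σ≗ρ⁻¹ : ∀ j → σ (toℕ j) ≡ toℕ (ρ⁻¹ j)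
        σ≗ρ⁻¹ j = ≡.trans (≡.cong σ (≡.trans (≡.sym (≡.cong toℕ (ρ∘ρ⁻¹ j))) (toℕ-ρ (ρ⁻¹ j))))
                          (σ∘rank (toℕ<n (ρ⁻¹ j)))

        rank∘σ : ∀ {j} → j ℕ.< m → σ j ℕ.< m × rankOf (σ j) ≡ j
        rank∘σ {j} j<m = ≡.subst (λ j → σ j ℕ.< m × rankOf (σ j) ≡ j) (toℕ-fromℕ< j<m)
          ( ≡.subst (ℕ._< m) (≡.sym (σ≗ρ⁻¹ i)) (toℕ<n (ρ⁻¹ i))
          , ≡.trans (≡.cong rankOf (σ≗ρ⁻¹ i)) (≡.trans (≡.sym (toℕ-ρ (ρ⁻¹ i))) (≡.cong toℕ (ρ∘ρ⁻¹ i))))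
          where i = fromℕ< j<m

      -- About `σ` only σ (rank e) = e is known. The rank is injective on a finite set, hence
      -- bijective, which makes `σ` its inverse below `m`; an inversion of costs would contradict
      -- the monotonicity of the rank.
      sorting : Sorting m C σ
      sorting = record
        { π         = permutation ρ⁻¹ ρ (λ e → ρ-injective (ρ∘ρ⁻¹ (ρ e))) ρ∘ρ⁻¹
        ; σ≗π       = σ≗ρ⁻¹
        ; ascending = ascending′
        }
        where
        ascending′ : ∀ {i j} → i ℕ.< j → j ℕ.< m → C (σ i) ≤ C (σ j)
        ascending′ {i} {j} i<j j<m with C (σ i) ≤? C (σ j)
        ... | yes Cσi≤Cσj = Cσi≤Cσj
        ... | no Cσi≰Cσj =
          let σj<m , rank-σj = rank∘σ j<m
              _ , rank-σi = rank∘σ (ℕ.<-trans i<j j<m)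
          in contradiction (≡.subst₂ ℕ._<_ rank-σj rank-σi (rankOf-mono σj<m (cheaper⇒≺ Cσi≰Cσj)))
                           (ℕ.<-asym i<j)

  -- The ranking loops.

  module _ (s : State) where
    private
      m : ℕ
      m = idx s edgeCount 0
      C : ℕ → Carrier
      C = num s costAt

    open Ranking m C

    module _ {e s₁} (m≡ : idx s₁ edgeCount 0 ≡ m) (C≡ : ∀ k → num s₁ costAt k ≡ C k)
             (e≡ : idx s₁ outer 0 ≡ e) (zero-rank : idx s₁ rank 0 ≡ 0) where
      private
        ranking : Code
        ranking = FOR inner BELOW edgeCount DO compareCosts

        Inv : ℕ → State → Set
        Inv n s′ = idx s′ rank 0 ≡ count (_≺? e) n

        module Step {n s′} (ag : Agrees ranking s₁ s′) (n≡ : idx s′ inner 0 ≡ n) (inv : Inv n s′) where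
          C≡′ : ∀ {a k} → idx s′ a 0 ≡ k → num s′ costAt (idx s′ a 0) ≡ C k
          C≡′ {a} a≡k = ≡.trans (num≡ ag costAt _) (≡.trans (C≡ _) (≡.cong C a≡k))
          e≡′ : idx s′ outer 0 ≡ e
          e≡′ = ≡.trans (idx≡ ag outer 0) e≡
          step : Inv (suc n) (tick inner (exec compareCosts s′))
          step = if-≤ᵢ (Inv (suc n)) (lit 1 ⊕ scalarᵢ inner) (scalarᵢ outer)
            (IF num[ costAt ] scalarᵢ inner ≤ₙ num[ costAt ] scalarᵢ outer THEN bump ELSE skip)
            (IF num[ costAt ] scalarᵢ outer ≤ₙ num[ costAt ] scalarᵢ inner THEN skip ELSE bump) {s′}
            (λ n<e → let n<e′ = ≡.subst₂ ℕ._<_ n≡ e≡′ n<e in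
              if-≤ₙ (Inv (suc n)) (num[ costAt ] scalarᵢ inner) (num[ costAt ] scalarᵢ outer) bump skip {s′}
              (λ Cn≤Ce → counted (inj₁ (n<e′ , ≡.subst₂ _≤_ (C≡′ {inner} n≡) (C≡′ {outer} e≡′) Cn≤Ce)))
              (λ Cn≰Ce → skipped Sum.[ (λ (_ , Cn≤Ce) →
                             Cn≰Ce (≡.subst₂ _≤_ (≡.sym (C≡′ {inner} n≡)) (≡.sym (C≡′ {outer} e≡′)) Cn≤Ce))
                         , (λ (e≤n , _) → ℕ.<⇒≱ n<e′ e≤n) ]′))
            (λ e≤n → let e≤n′ = ≡.subst₂ ℕ._≤_ e≡′ n≡ (ℕ.≤-pred e≤n) in
              if-≤ₙ (Inv (suc n)) (num[ costAt ] scalarᵢ outer) (num[ costAt ] scalarᵢ inner) skip bump {s′}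
              (λ Ce≤Cn → skipped Sum.[ (λ (n<e , _) → ℕ.<⇒≱ n<e e≤n′)
                         , (λ (_ , Ce≰Cn) → Ce≰Cn (≡.subst₂ _≤_ (C≡′ {outer} e≡′) (C≡′ {inner} n≡) Ce≤Cn)) ]′)
              (λ Ce≰Cn → counted (inj₂ (e≤n′ , λ Ce≤Cn →
                             Ce≰Cn (≡.subst₂ _≤_ (≡.sym (C≡′ {outer} e≡′)) (≡.sym (C≡′ {inner} n≡)) Ce≤Cn)))))
            where
            counted : n ≺ e → suc (idx s′ rank 0) ≡ count (_≺? e) (suc n)
            counted n≺e = ≡.trans (≡.cong suc inv) (≡.sym (count-yes (_≺? e) n n≺e))
            skipped : ¬ n ≺ e → idx s′ rank 0 ≡ count (_≺? e) (suc n)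
            skipped n⊀e = ≡.trans inv (≡.sym (count-no (_≺? e) n n⊀e))

      ranking-correct : idx (exec ranking s₁) rank 0 ≡ rankOf e
      ranking-correct = ≡.subst (λ n → Inv n (exec ranking s₁)) m≡
        (for-invariant inner edgeCount compareCosts s₁ Inv zero-rank
          λ _ _ _ ag n≡ inv → Step.step ag n≡ inv)

    sortByCost-correct : Sorting m C (idx (exec sortByCost s) sorted)
    sortByCost-correct = sorting (idx (exec sortByCost s) sorted)
      (for-invariant outer edgeCount rankEdge s Inv (λ _ ()) step ℕ.≤-refl)
      where
      Inv : ℕ → State → Set
      Inv n s′ = n ℕ.≤ m → ∀ {e} → e ℕ.< n → idx s′ sorted (rankOf e) ≡ e
      step : ∀ n s′ → n ℕ.< m → Agrees sortByCost s s′ → idx s′ outer 0 ≡ n → Inv n s′ →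
             Inv (suc n) (tick outer (exec rankEdge s′))
      step n s′ n<m ag n≡ inv _ =
        let s₁ = exec (rank ≔ᵢ lit 0) s′
            s₂ = exec (FOR inner BELOW edgeCount DO compareCosts) s₁
            rank≡ = ranking-correct {n} {s₁} (idx≡ ag edgeCount 0) (λ k → num≡ ag costAt k) n≡ ≡.refl
            stores = λ {e} → exec-idx (FOR inner BELOW edgeCount DO compareCosts) s₁ sorted (rankOf e) _
            outer≡ = ≡.trans (exec-idx (FOR inner BELOW edgeCount DO compareCosts) s₁ outer 0 _) n≡
        in <suc-elim (λ e → write (idx s₂) sorted (idx s₂ rank 0) (idx s₂ outer 0) sorted (rankOf e) ≡ e)
          (λ {e} e<n → ≡.trans
            -- Ties are broken by position, so ranks differ and no earlier slot is overwritten.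
            (write-position≢ (idx s₂) sorted _ λ eq → ℕ.<⇒≢ e<n (rankOf-injective (ℕ.<-trans e<n n<m) n<m
              (≡.trans (≡.sym eq) rank≡)))
            (≡.trans stores (inv (ℕ.<⇒≤ n<m) e<n)))
          (≡.subst (λ j → write (idx s₂) sorted (idx s₂ rank 0) (idx s₂ outer 0) sorted j ≡ n) rank≡
            (≡.trans (write-same (idx s₂) sorted (idx s₂ rank 0) _) outer≡))

  -- Scanning the edges at a node.

  if-=ᵢ : ∀ {ℓ} (P : State → Set ℓ) e f c d {s} →
          (evalIndex s e ≡ evalIndex s f → P (exec c s)) →
          (¬ evalIndex s e ≡ evalIndex s f → P (exec d s)) →
          P (exec (IF e =ᵢ f THEN c ELSE d) s)
  if-=ᵢ P e f c d {s} onTrue onFalse = if-≤ᵢ P ((e ⊖ f) ⊕ (f ⊖ e)) (lit 0) c d {s}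
    (λ ≤0 → let ≡0 = ℕ.n≤0⇒n≡0 ≤0 ; u = evalIndex s e ; v = evalIndex s f in
      onTrue (ℕ.≤-antisym (ℕ.m∸n≡0⇒m≤n (ℕ.m+n≡0⇒m≡0 (u ℕ.∸ v) ≡0))
                          (ℕ.m∸n≡0⇒m≤n (ℕ.m+n≡0⇒n≡0 (u ℕ.∸ v) ≡0))))
    (λ 0< → onFalse λ u≡v → ℕ.<⇒≢ 0< (≡.sym (≡.cong₂ ℕ._+_ (ℕ.m≤n⇒m∸n≡0 (ℕ.≤-reflexive u≡v))
                                                       (ℕ.m≤n⇒m∸n≡0 (ℕ.≤-reflexive (≡.sym u≡v))))))

  scan-correct : ∀ {s origin excluded m} →
    idx s current 0 ≡ origin → idx s previous 0 ≡ excluded → idx s edgeCount 0 ≡ m →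
    Scanned (idx s end₁) (idx s end₂) origin excluded m (idx (exec scan s) found 0) (idx (exec scan s) next 0)
  scan-correct {s} {origin} {excluded} origin≡ excluded≡ m≡ = ≡.subst (λ n → Inv n (exec scanning s₁)) m≡
    (for-invariant inner edgeCount inspect s₁ Inv (scanned (inj₁ (≡.refl , λ ()))) step)
    where
    scanning : Code
    scanning = FOR inner BELOW edgeCount DO inspect
    s₁ = exec (found ≔ᵢ lit 0) s
    Inv : ℕ → State → Set
    Inv n s′ = Scanned (idx s end₁) (idx s end₂) origin excluded n (idx s′ found 0) (idx s′ next 0)
    step : ∀ n s′ → n ℕ.< idx s₁ edgeCount 0 → Agrees scanning s₁ s′ → idx s′ inner 0 ≡ n → Inv n s′ →
           Inv (suc n) (tick inner (exec inspect s′))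
    step n s′ _ ag n≡ (scanned inv) =
      if-=ᵢ (Inv (suc n)) (lit 1 ⊕ scalarᵢ inner) (scalarᵢ previous) skip tests {s′}
        (λ 1+n≡ → keep λ 1+n≢ → contradiction (≡.trans (≡.sym (≡.cong suc n≡)) (≡.trans 1+n≡ previous≡)) 1+n≢)
        (λ 1+n≢ →
          let 1+n≢′ = λ eq → 1+n≢ (≡.trans (≡.cong suc n≡) (≡.trans eq (≡.sym previous≡))) in
          if-=ᵢ (Inv (suc n)) (idx[ end₁ ] scalarᵢ inner) (scalarᵢ current) (follow end₂) test₂ {s′}
          (λ e₁≡ → take 1+n≢′ (inj₁ (≡.trans (≡.sym (end≡ end₁)) (≡.trans e₁≡ current≡) , end≡ end₂)))
          (λ e₁≢ → if-=ᵢ (Inv (suc n)) (idx[ end₂ ] scalarᵢ inner) (scalarᵢ current) (follow end₁) skip {s′}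
            (λ e₂≡ → take 1+n≢′ (inj₂ (≡.trans (≡.sym (end≡ end₂)) (≡.trans e₂≡ current≡) , end≡ end₁)))
            (λ e₂≢ → keep λ _ →
              (λ eq → e₁≢ (≡.trans (end≡ end₁) (≡.trans eq (≡.sym current≡)))) ,
              (λ eq → e₂≢ (≡.trans (end≡ end₂) (≡.trans eq (≡.sym current≡)))))))
      where
      test₂ tests : Code
      test₂ = IF idx[ end₂ ] scalarᵢ inner =ᵢ scalarᵢ current THEN follow end₁ ELSE skip
      tests = IF idx[ end₁ ] scalarᵢ inner =ᵢ scalarᵢ current THEN follow end₂ ELSE test₂
      current≡ = ≡.trans (idx≡ ag current 0) origin≡
      previous≡ = ≡.trans (idx≡ ag previous 0) excluded≡
      end≡ : ∀ a {_ : Preservesᵢ scanning a} {_ : Preservesᵢ (found ≔ᵢ lit 0) a} →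
             idx s′ a (idx s′ inner 0) ≡ idx s a n
      end≡ a {p} {q} = ≡.trans (idx≡ ag a _ {p})
        (≡.trans (exec-idx (found ≔ᵢ lit 0) s a _ q) (≡.cong (idx s a) n≡))
      keep : (¬ suc n ≡ excluded → ¬ idx s end₁ n ≡ origin × ¬ idx s end₂ n ≡ origin) → Inv (suc n) s′
      keep new = scanned (Sum.map
        (λ (f≡0 , none) → f≡0 ,
          <suc-elim (λ e → ¬ suc e ≡ excluded → ¬ idx s end₁ e ≡ origin × ¬ idx s end₂ e ≡ origin) none new)
        (λ (e , e<n , rest) → e , ℕ.m<n⇒m<1+n e<n , rest) inv)
      take : ∀ {x} → ¬ suc n ≡ excluded →
        (idx s end₁ n ≡ origin × x ≡ idx s end₂ n) ⊎ (idx s end₂ n ≡ origin × x ≡ idx s end₁ n) →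
        Scanned (idx s end₁) (idx s end₂) origin excluded (suc n) (suc (idx s′ inner 0)) x
      take 1+n≢ incident = scanned (inj₂ (n , ℕ.≤-refl , ≡.cong suc n≡ , 1+n≢ , incident))

  -- Distances and coverage on a path

  module Coverage (I : UpMCLP.Instance K)
    (isPath : IsPath (UpMCLP.Instance.graph I)) (δ : UpMCLP.Instance.Edge I → Carrier) (gap : ℕ → Carrier)
    (gap≈ : ∀ k → gap (toℕ k) ≈ UpMCLP.Instance.len I (edge isPath k) - δ (edge isPath k))
    (0≤gap : ∀ {k} → k ℕ.< UpMCLP.Instance.#edges I → 0# ≤ gap k)
    where
    open UpMCLP.Instance I
    open UpMCLP K using (walkLength; pathLength; IsShortest; IsDistance; Covered)

    private
      m : ℕ
      m = #edges
      length : ∀ {i j} → Walk i j → Carrier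
      length = walkLength I δ
      pos : Node → ℕ
      pos = position isPath
      nd : ℕ → Node
      nd = at isPath

    -- Coordinates in which the reduced edges have their reduced lengths.
    φ : ℕ → Carrier
    φ k = sumTo k gap

    φ-mono : ∀ {a b} → a ℕ.≤ b → b ℕ.≤ m → φ a ≤ φ b
    φ-mono a≤b b≤m = sumTo-extend a≤b (λ _ k<b → 0≤gap (ℕ.<-≤-trans k<b b≤m))

    -- The coordinates differ by at most `radius`, written without an absolute value.
    Near : ℕ → ℕ → Set ℓ₂
    Near a b = φ a ≤ φ b + radius × φ b ≤ φ a + radius

    private
      -- This and the next three are the induction steps of `walk-bounds`: the first edge, of length
      -- g, raises or lowers the coordinate, and each of the two inequalities has to be extended by
      -- g.
      toward : ∀ {a b c g w} → b ≈ a + g → 0# ≤ g → b ≤ c + w → a ≤ c + (g + w)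
      toward b≈a+g 0≤g b≤c+w = ≤-trans (x≤x+y 0≤g) (≤-trans (≤-reflexive (sym b≈a+g))
        (≤-trans b≤c+w (+-monoʳ-≤ _ (≤-resp (+-identityˡ _) refl (+-monoˡ-≤ _ 0≤g)))))

      away : ∀ {a b c g w} → a ≈ b + g → b ≤ c + w → a ≤ c + (g + w)
      away {c = c} a≈b+g b≤c+w = ≤-resp (sym a≈b+g)
        (trans (+-assoc c _ _) (+-congˡ (+-comm _ _))) (+-monoˡ-≤ _ b≤c+w)

      away′ : ∀ {a b c g w} → b ≈ a + g → c ≤ b + w → c ≤ a + (g + w)
      away′ b≈a+g c≤b+w = ≤-resp refl (trans (+-congʳ b≈a+g) (+-assoc _ _ _)) c≤b+w

      toward′ : ∀ {a b c g w} → a ≈ b + g → 0# ≤ g → c ≤ b + w → c ≤ a + (g + w)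
      toward′ {a} {b} a≈b+g 0≤g c≤b+w = ≤-trans c≤b+w
        (+-mono-≤ (≤-resp refl (sym a≈b+g) (x≤x+y 0≤g)) (≤-resp (+-identityˡ _) refl (+-monoˡ-≤ _ 0≤g)))

    -- One edge changes the coordinate by exactly its reduced length, so no walk is shorter than the
    -- difference of the coordinates, even one that turns back. The straight walk attains this
    -- difference and is therefore shortest.
    walk-bounds : ∀ {i j} (w : Walk i j) → φ (pos i) ≤ φ (pos j) + length w × φ (pos j) ≤ φ (pos i) + length w
    walk-bounds [] = ≤-reflexive (sym (+-identityʳ _)) , ≤-reflexive (sym (+-identityʳ _))
    walk-bounds (_∷_ {e} {i} {j} {k} e-joins w)
      with t , ≡.refl , between ← joins⇒between isPath e-joins | below , above ← walk-bounds w
      with between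
    ... | inj₁ (posᵢ≡ , posₖ≡) = toward φk≈ 0≤g below , away′ φk≈ above
      where
      0≤g = ≤-resp refl (gap≈ t) (0≤gap (toℕ<n t))
      φk≈ : φ (pos k) ≈ φ (pos i) + (len (edge isPath t) - δ (edge isPath t))
      φk≈ rewrite posᵢ≡ | posₖ≡ = +-congˡ (gap≈ t)
    ... | inj₂ (posₖ≡ , posᵢ≡) = away φi≈ below , toward′ φi≈ 0≤g above
      where
      0≤g = ≤-resp refl (gap≈ t) (0≤gap (toℕ<n t))
      φi≈ : φ (pos i) ≈ φ (pos k) + (len (edge isPath t) - δ (edge isPath t))
      φi≈ rewrite posᵢ≡ | posₖ≡ = +-congˡ (gap≈ t)

    private
      gap<≈ : ∀ {k} (k<m : k ℕ.< m) → len (edge isPath (fromℕ< k<m)) - δ (edge isPath (fromℕ< k<m)) ≈ gap k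
      gap<≈ k<m = trans (sym (gap≈ _)) (reflexive (≡.cong gap (toℕ-fromℕ< k<m)))

      ascend-length : ∀ {a b} (a≤b : a ≤‴ b) (b≤m : b ℕ.≤ m) → φ a + length (ascend isPath a≤b b≤m) ≈ φ b
      ascend-length (≤‴-reflexive ≡.refl) b≤m = +-identityʳ _
      ascend-length (≤‴-step a<b)         b≤m = trans (sym (+-assoc _ _ _))
        (trans (+-congʳ (+-congˡ (gap<≈ (ℕ.≤-trans (ℕ.≤‴⇒≤ a<b) b≤m)))) (ascend-length a<b b≤m))

      descend-length : ∀ {a b} (a≤b : a ≤′ b) (b≤m : b ℕ.≤ m) → φ a + length (descend isPath a≤b b≤m) ≈ φ b
      descend-length (≤′-reflexive ≡.refl) b≤m = +-identityʳ _
      descend-length {a} (≤′-step a≤b)     b<m = trans (+-congˡ (+-comm _ _))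
        (trans (sym (+-assoc _ _ _)) (+-cong (descend-length a≤b (ℕ.<⇒≤ b<m)) (gap<≈ b<m)))

      ≤-from-φ : ∀ {x y l d} → x + l ≈ y → y ≤ x + d → l ≤ d
      ≤-from-φ x+l≈y y≤x+d = +-cancelʳ-≤ _ (≤-resp (trans (sym x+l≈y) (+-comm _ _)) (+-comm _ _) y≤x+d)

    near⇒distance : ∀ {a b} → a ℕ.≤ m → b ℕ.≤ m → Near a b →
      Σ Carrier λ d → IsDistance I (nd a) (nd b) δ d × d ≤ radius
    near⇒distance {a} {b} a≤m b≤m (near , near′) with ℕ.≤-total a b
    ... | inj₁ a≤b = _ , (((w , ascend-unique isPath (ℕ.≤⇒≤‴ a≤b) b≤m) , shortest , refl)) , ≤-from-φ w≈ near′
      where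
      w = ascend isPath (ℕ.≤⇒≤‴ a≤b) b≤m
      w≈ = ascend-length (ℕ.≤⇒≤‴ a≤b) b≤m
      shortest : ∀ (Q : Path (nd a) (nd b)) → length w ≤ length (proj₁ Q)
      shortest (w′ , _) = ≤-from-φ w≈ (≡.subst₂ (λ x y → φ y ≤ φ x + length w′)
        (position-at isPath a≤m) (position-at isPath b≤m) (proj₂ (walk-bounds w′)))
    ... | inj₂ b≤a = _ , (((w , descend-unique isPath (ℕ.≤⇒≤′ b≤a) a≤m) , shortest , refl)) , ≤-from-φ w≈ near
      where
      w = descend isPath (ℕ.≤⇒≤′ b≤a) a≤m
      w≈ = descend-length (ℕ.≤⇒≤′ b≤a) a≤m
      shortest : ∀ (Q : Path (nd a) (nd b)) → length w ≤ length (proj₁ Q)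
      shortest (w′ , _) = ≤-from-φ w≈ (≡.subst₂ (λ x y → φ x ≤ φ y + length w′)
        (position-at isPath a≤m) (position-at isPath b≤m) (proj₁ (walk-bounds w′)))

    near⇒covered : ∀ {X i x} → x ∈ X → Near (pos i) (pos x) → Covered I X δ i
    near⇒covered {X} {i} {x} x∈X near = x , x∈X ,
      ≡.subst₂ (λ i x → Σ Carrier λ d → IsDistance I i x δ d × d ≤ radius)
        (at-position isPath i) (at-position isPath x)
        (near⇒distance (position≤m isPath i) (position≤m isPath x) near)

    covered⇒near : ∀ {X i x} → (∀ {j} → j ∈ X → j ≡ x) → Covered I X δ i → Near (pos i) (pos x)
    covered⇒near X⊆x (j , j∈X , d , ((w , _) , _ , w≈d) , d≤R) with ≡.refl ← X⊆x j∈X =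
      let below , above = walk-bounds w
          w≤R = ≤-resp (sym w≈d) refl d≤R
      in ≤-trans below (+-monoʳ-≤ _ w≤R) , ≤-trans above (+-monoʳ-≤ _ w≤R)

  -- Finding an endpoint of the path and walking along it

  module PathInput (I : UpMCLP.Instance K) where
    open UpMCLP.Instance I

    record Loaded (s : State) : Set κ where
      field
        nodes≡   : idx s nodeCount 0 ≡ #nodes
        edges≡   : idx s edgeCount 0 ≡ #edges
        end₁≡    : ∀ e → idx s end₁ (toℕ e) ≡ toℕ (proj₁ (ends e))
        end₂≡    : ∀ e → idx s end₂ (toℕ e) ≡ toℕ (proj₂ (ends e))
        lengths≡ : ∀ e → num s lengths (toℕ e) ≡ len e
        weights≡ : ∀ i → num s weights (toℕ i) ≡ weight i
        bounds≡  : ∀ e → num s bounds (toℕ e) ≡ bound e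
        costs≡   : ∀ e → num s costs (toℕ e) ≡ cost e
        radius≡  : num s radius₀ 0 ≡ radius
        budget≡  : num s budget₀ 0 ≡ budget
    open Loaded public

    KeepsInput : Code → Set
    KeepsInput c =
      (Preservesᵢ c nodeCount × Preservesᵢ c edgeCount × Preservesᵢ c end₁ × Preservesᵢ c end₂) ×
      (Preservesₙ c lengths × Preservesₙ c weights × Preservesₙ c bounds × Preservesₙ c costs) ×
      (Preservesₙ c radius₀ × Preservesₙ c budget₀)

    loaded-agrees : ∀ {c s s′} {_ : KeepsInput c} → Agrees c s s′ → Loaded s → Loaded s′
    loaded-agrees {s = s} {s′} {(i₁ , i₂ , i₃ , i₄) , (n₁ , n₂ , n₃ , n₄) , (n₅ , n₆)} ag l = record
      { nodes≡   = ≡.trans (idx≡ ag _ _ {i₁}) (nodes≡ l)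
      ; edges≡   = ≡.trans (idx≡ ag _ _ {i₂}) (edges≡ l)
      ; end₁≡    = λ e → ≡.trans (idx≡ ag _ _ {i₃}) (end₁≡ l e)
      ; end₂≡    = λ e → ≡.trans (idx≡ ag _ _ {i₄}) (end₂≡ l e)
      ; lengths≡ = λ e → ≡.trans (num≡ ag _ _ {n₁}) (lengths≡ l e)
      ; weights≡ = λ e → ≡.trans (num≡ ag _ _ {n₂}) (weights≡ l e)
      ; bounds≡  = λ e → ≡.trans (num≡ ag _ _ {n₃}) (bounds≡ l e)
      ; costs≡   = λ e → ≡.trans (num≡ ag _ _ {n₄}) (costs≡ l e)
      ; radius≡  = ≡.trans (num≡ ag _ _ {n₅}) (radius≡ l)
      ; budget≡  = ≡.trans (num≡ ag _ _ {n₆}) (budget≡ l)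
      }

    -- Finding an endpoint.

    Departs : Node → ℕ → ℕ → ℕ → Set
    Departs i excluded f x =
      (f ≡ 0 × (∀ e → ¬ suc (toℕ e) ≡ excluded → ∀ j → ¬ Joins e i j)) ⊎
      (Σ Edge λ e → Σ Node λ j → f ≡ suc (toℕ e) × x ≡ toℕ j × ¬ suc (toℕ e) ≡ excluded × Joins e i j)

    departs : ∀ {s i excluded} → Loaded s → idx s current 0 ≡ toℕ i → idx s previous 0 ≡ excluded →
      Departs i excluded (idx (exec scan s) found 0) (idx (exec scan s) next 0)
    departs {s} {i} l origin≡ excluded≡ = interpret (scan-correct {s} origin≡ excluded≡ (edges≡ l))
      where
      joins-from-ends : ∀ e → (toℕ (proj₁ (ends e)) ≡ toℕ i → Joins e i (proj₂ (ends e))) ×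
                              (toℕ (proj₂ (ends e)) ≡ toℕ i → Joins e i (proj₁ (ends e)))
      joins-from-ends e = (λ eq → inj₁ (≡.cong (_, proj₂ (ends e)) (toℕ-injective eq))) ,
                          (λ eq → inj₂ (≡.cong (proj₁ (ends e) ,_) (toℕ-injective eq)))
      interpret : ∀ {excluded f x} → Scanned (idx s end₁) (idx s end₂) (toℕ i) excluded #edges f x →
                  Departs i excluded f x
      interpret (scanned (inj₁ (f≡0 , none))) = inj₁ (f≡0 , λ e e≢ j → λ
        { (inj₁ p) → proj₁ (none (toℕ<n e) e≢) (≡.trans (end₁≡ l e) (≡.cong (λ q → toℕ (proj₁ q)) p))
        ; (inj₂ p) → proj₂ (none (toℕ<n e) e≢) (≡.trans (end₂≡ l e) (≡.cong (λ q → toℕ (proj₂ q)) p)) })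
      interpret {excluded} {f} {x} (scanned (inj₂ (n , n<m , f≡ , ≢excluded , incident))) =
        inj₂ (found-edge (fromℕ< n<m) (toℕ-fromℕ< n<m) f≡ ≢excluded incident)
        where
        found-edge : ∀ e {n} → toℕ e ≡ n → f ≡ suc n → ¬ suc n ≡ excluded →
          (idx s end₁ n ≡ toℕ i × x ≡ idx s end₂ n) ⊎ (idx s end₂ n ≡ toℕ i × x ≡ idx s end₁ n) →
          Σ Edge λ e → Σ Node λ j → f ≡ suc (toℕ e) × x ≡ toℕ j × ¬ suc (toℕ e) ≡ excluded × Joins e i j
        found-edge e ≡.refl f≡ ≢ex (inj₁ (e₁≡ , x≡)) =
          e , proj₂ (ends e) , f≡ , ≡.trans x≡ (end₂≡ l e) , ≢ex ,
          proj₁ (joins-from-ends e) (≡.trans (≡.sym (end₁≡ l e)) e₁≡)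
        found-edge e ≡.refl f≡ ≢ex (inj₂ (e₂≡ , x≡)) =
          e , proj₁ (ends e) , f≡ , ≡.trans x≡ (end₁≡ l e) , ≢ex ,
          proj₂ (joins-from-ends e) (≡.trans (≡.sym (end₂≡ l e)) e₂≡)

    -- The second scan has found an edge other than the first one, but only one edge meets the first
    -- node of a listing.
    live⇒¬endpoint : ∀ {i f x f′ x′} → Departs i 0 f x → Departs i f f′ x′ → ¬ f′ ≡ 0 → ¬ Endpoint graph (toℕ i)
    live⇒¬endpoint _ (inj₁ (f′≡0 , _)) f′≢0 = contradiction f′≡0 f′≢0
    live⇒¬endpoint {i} first (inj₂ (e , _ , _ , _ , e≢f , e-joins)) _ (isPath , at0≡i) with first
    ... | inj₁ (_ , dead) = dead e (λ ()) _ e-joins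
    ... | inj₂ (e′ , _ , f≡ , _ , _ , e′-joins) = e≢f (≡.trans
      (≡.cong (λ e → suc (toℕ e)) (first-edge-unique isPath i≡0 e-joins e′-joins)) (≡.sym f≡))
      where
      i≡0 : position isPath i ≡ 0
      i≡0 = ≡.trans (≡.cong (position isPath) (≡.sym (toℕ-injective at0≡i))) (position-at isPath z≤n)

    findEndpoint-correct : ∀ {s} → Loaded s → IsPath graph → Endpoint graph (idx (exec findEndpoint s) endpoint 0)
    findEndpoint-correct {s} l isPath = conclude (≡.subst (λ n → Inv n (exec findEndpoint s)) (nodes≡ l)
      (for-invariant outer nodeCount testNode s Inv (inj₂ λ _ ()) step))
      where
      Inv : ℕ → State → Set
      Inv n s′ = Endpoint graph (idx s′ endpoint 0) ⊎ (∀ k → k ℕ.< n → ¬ Endpoint graph k)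

      conclude : ∀ {v} → Endpoint graph v ⊎ (∀ k → k ℕ.< #nodes → ¬ Endpoint graph k) → Endpoint graph v
      conclude (inj₁ isEnd) = isEnd
      -- The first node of the given listing would be among the nodes ruled out.
      conclude (inj₂ none) = contradiction (isPath , ≡.refl) (none _ (toℕ<n (at isPath 0)))

      startScan excludeFound decide : Code
      startScan = current ≔ᵢ scalarᵢ outer ⨾ previous ≔ᵢ lit 0
      excludeFound = previous ≔ᵢ scalarᵢ found
      decide = IF scalarᵢ found ≤ᵢ lit 0 THEN endpoint ≔ᵢ scalarᵢ outer ELSE skip

      decide-correct : ∀ {s₁ n f x} (i : Node) → toℕ i ≡ n → idx s₁ outer 0 ≡ n → Departs i 0 f x →
        Departs i f (idx s₁ found 0) (idx s₁ next 0) → Inv n s₁ → Inv (suc n) (exec decide s₁)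
      decide-correct {s₁} {n} {f} i ≡.refl outer≡ first second inv =
        if-≤ᵢ (Inv (suc n)) (scalarᵢ found) (lit 0) (endpoint ≔ᵢ scalarᵢ outer) skip {s₁}
          (λ f′≤0 → inj₁ (≡.subst (Endpoint graph) (≡.sym outer≡) (dead (ℕ.n≤0⇒n≡0 f′≤0) second)))
          (λ 0<f′ → Sum.map₂ (λ none k → <suc-elim (λ k → ¬ Endpoint graph k) (λ {k} → none k)
            (live⇒¬endpoint first second (ℕ.>⇒≢ 0<f′))) inv)
        where
        dead : ∀ {f′ x′} → f′ ≡ 0 → Departs i f f′ x′ → Endpoint graph (toℕ i)
        dead _ (inj₁ (_ , dead)) = dead-end⇒endpoint graph isPath i f dead
        dead f′≡0 (inj₂ (_ , _ , f′≡suc , _)) = contradiction (≡.trans (≡.sym f′≡0) f′≡suc) (λ ())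

      step : ∀ n s′ → n ℕ.< idx s nodeCount 0 → Agrees findEndpoint s s′ → idx s′ outer 0 ≡ n → Inv n s′ →
             Inv (suc n) (tick outer (exec testNode s′))
      step n s′ n< ag n≡ inv =
        let n<nodes = ≡.subst (n ℕ.<_) (nodes≡ l) n<
            i = fromℕ< n<nodes
            i≡ = toℕ-fromℕ< n<nodes
            l′ = loaded-agrees ag l
            s₁ = exec startScan s′
            s₂ = exec scan s₁
            s₃ = exec excludeFound s₂
            s₄ = exec scan s₃
            l₁ = loaded-agrees (exec-agrees startScan s′) l′
            l₃ = loaded-agrees (exec-agrees excludeFound s₂) (loaded-agrees (exec-agrees scan s₁) l₁)
            origin≡ = ≡.trans n≡ (≡.sym i≡)
            first = departs {s₁} {i} l₁ origin≡ ≡.refl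
            second = departs {s₃} {i} l₃ (≡.trans (exec-idx scan s₁ current 0 _) origin≡) ≡.refl
            outer₄≡ = ≡.trans (exec-idx scan s₃ outer 0 _) (≡.trans (exec-idx scan s₁ outer 0 _) n≡)
            endpoint₄≡ = ≡.trans (exec-idx scan s₃ endpoint 0 _) (exec-idx scan s₁ endpoint 0 _)
        in decide-correct {s₄} i i≡ outer₄≡ first second
             (≡.subst (λ v → Endpoint graph v ⊎ (∀ k → k ℕ.< n → ¬ Endpoint graph k)) (≡.sym endpoint₄≡) inv)

    -- Walking along the path.

    module Traversal (isPath : IsPath graph) where
      private
        m : ℕ
        m = #edges

      edgeNumber : ℕ → ℕ
      edgeNumber = pad 0 (λ t → toℕ (edge isPath t))

      -- The value of `previous` at position k. The 0 at the start excludes nothing, as edges are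
      -- recorded plus one.
      lastEdge : ℕ → ℕ
      lastEdge zero    = 0
      lastEdge (suc k) = suc (edgeNumber k)

      record PlacedNode (s : State) (k : ℕ) : Set κ where
        field
          order≡  : idx s nodeOrder k ≡ toℕ (at isPath k)
          weight≡ : num s weightAt k ≡ weight (at isPath k)
      open PlacedNode public

      record PlacedEdge (s : State) (k : ℕ) (e : Edge) : Set κ where
        field
          order≡  : idx s edgeOrder k ≡ toℕ e
          length≡ : num s lengthAt k ≡ len e
          bound≡  : num s boundAt k ≡ bound e
          cost≡   : num s costAt k ≡ cost e
      open PlacedEdge public

      Placed : ℕ → State → Set κ
      Placed k s = (∀ {j} → j ℕ.< k → PlacedNode s j) × (∀ t → toℕ t ℕ.< k → PlacedEdge s (toℕ t) (edge isPath t))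

      edgeNumber≡ : ∀ t → edgeNumber (toℕ t) ≡ toℕ (edge isPath t)
      edgeNumber≡ = pad-toℕ 0 (λ t → toℕ (edge isPath t))

      -- Only the edges at positions t - 1 and t meet the node at t. The former is excluded, and the
      -- latter is distinct from it, so the scan succeeds and leaves no choice.
      departs⇒next : ∀ t {f x} → Departs (at isPath (toℕ t)) (lastEdge (toℕ t)) f x →
        f ≡ suc (toℕ (edge isPath t)) × x ≡ toℕ (at isPath (suc (toℕ t)))
      departs⇒next t (inj₁ (_ , dead)) = contradiction (link isPath t) (dead (edge isPath t) (unused t ≡.refl) _)
        where
        unused : ∀ t {k} → toℕ t ≡ k → ¬ suc (toℕ (edge isPath t)) ≡ lastEdge k
        unused t {suc k} t≡ eq = ℕ.1+n≢n (≡.trans (≡.sym t≡) (≡.trans (≡.cong toℕ t≡u) (toℕ-fromℕ< k<m)))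
          where
          k<m : k ℕ.< m
          k<m = ℕ.<⇒≤ (≡.subst (ℕ._< m) t≡ (toℕ<n t))
          t≡u : t ≡ fromℕ< k<m
          t≡u = edge-injective isPath (toℕ-injective (≡.trans (ℕ.suc-injective eq)
            (≡.trans (≡.cong edgeNumber (≡.sym (toℕ-fromℕ< k<m))) (edgeNumber≡ (fromℕ< k<m)))))
      departs⇒next t (inj₂ (e , j , f≡ , x≡ , e≢last , e-joins))
        with joins-at isPath e-joins (position-at isPath (ℕ.<⇒≤ (toℕ<n t)))
      ... | inj₁ (u , ≡.refl , u≡t , j≡) with ≡.refl ← toℕ-injective u≡t =
        f≡ , ≡.trans x≡ (≡.cong toℕ (≡.trans (≡.sym (at-position isPath j)) (≡.cong (at isPath) j≡)))
      ... | inj₂ (u , ≡.refl , 1+u≡t) = contradiction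
        (≡.trans (≡.cong suc (≡.sym (edgeNumber≡ u))) (≡.cong lastEdge 1+u≡t)) e≢last

      -- For concrete array names `write` reduces to this conditional on the positions.
      overwritten : ∀ {a} {A : Set a} {i j} {x y z : A} → i ≡ j → x ≡ y → (if i ≡ᵇ j then x else z) ≡ y
      overwritten {i = i} ≡.refl x≡y rewrite ≡ᵇ-refl i = x≡y

      elsewhere : ∀ {a} {A : Set a} {i j} {x y z : A} → ¬ i ≡ j → z ≡ y → (if i ≡ᵇ j then x else z) ≡ y
      elsewhere i≢j z≡y rewrite ≢⇒≡ᵇ≡false i≢j = z≡y

      placed-agrees : ∀ {c s s′ k} {_ : Preservesᵢ c nodeOrder × Preservesᵢ c edgeOrder}
        {_ : Preservesₙ c weightAt × Preservesₙ c lengthAt × Preservesₙ c boundAt × Preservesₙ c costAt} →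
        Agrees c s s′ → Placed k s → Placed k s′
      placed-agrees {s = s} {s′} {_} {i₁ , i₂} {n₁ , n₂ , n₃ , n₄} ag (placedⁿ , placedᵉ) =
        (λ j<k → record
          { order≡  = ≡.trans (idx≡ ag _ _ {i₁}) (order≡ (placedⁿ j<k))
          ; weight≡ = ≡.trans (num≡ ag _ _ {n₁}) (weight≡ (placedⁿ j<k)) }) ,
        (λ t t<k → record
          { order≡  = ≡.trans (idx≡ ag _ _ {i₂}) (order≡ (placedᵉ t t<k))
          ; length≡ = ≡.trans (num≡ ag _ _ {n₂}) (length≡ (placedᵉ t t<k))
          ; bound≡  = ≡.trans (num≡ ag _ _ {n₃}) (bound≡ (placedᵉ t t<k))
          ; cost≡   = ≡.trans (num≡ ag _ _ {n₄}) (cost≡ (placedᵉ t t<k)) })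

      -- The position is an expression evaluated twice, the second time after the write to
      -- `nodeOrder`; hence two hypotheses about its value.
      placeNode-correct : ∀ {s k} p → evalIndex s p ≡ k →
        evalIndex (exec (nodeOrder [ p ]≔ᵢ scalarᵢ current) s) p ≡ k →
        Loaded s → idx s current 0 ≡ toℕ (at isPath k) →
        let s′ = exec (placeNode p) s in
        PlacedNode s′ k × (∀ {j} → ¬ k ≡ j → PlacedNode s j → PlacedNode s′ j)
      placeNode-correct {s} p p≡ p≡′ l current≡ =
        record { order≡  = overwritten p≡ current≡
               ; weight≡ = overwritten p≡′ (≡.trans (≡.cong (num s weights) current≡) (weights≡ l _)) } ,
        λ k≢j placed → record
               { order≡  = elsewhere (λ eq → k≢j (≡.trans (≡.sym p≡) eq)) (order≡ placed)
               ; weight≡ = elsewhere (λ eq → k≢j (≡.trans (≡.sym p≡′) eq)) (weight≡ placed) }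

      placeEdge-correct : ∀ {s k e} → idx s outer 0 ≡ k → Loaded s → idx s found 0 ≡ suc (toℕ e) →
        let s′ = exec (placeEdge (scalarᵢ outer)) s in
        PlacedEdge s′ k e × (∀ {j e′} → ¬ k ≡ j → PlacedEdge s j e′ → PlacedEdge s′ j e′)
      placeEdge-correct {s} {k} {e} k≡ l found≡ =
        record { order≡  = overwritten k≡ e≡
               ; length≡ = overwritten k≡ (≡.trans (≡.cong (num s lengths) e≡) (lengths≡ l e))
               ; bound≡  = overwritten k≡ (≡.trans (≡.cong (num s bounds) e≡) (bounds≡ l e))
               ; cost≡   = overwritten k≡ (≡.trans (≡.cong (num s costs) e≡) (costs≡ l e)) } ,
        λ k≢j placed → let k≢j′ = λ eq → k≢j (≡.trans (≡.sym k≡) eq) in record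
               { order≡  = elsewhere k≢j′ (order≡ placed)
               ; length≡ = elsewhere k≢j′ (length≡ placed)
               ; bound≡  = elsewhere k≢j′ (bound≡ placed)
               ; cost≡   = elsewhere k≢j′ (cost≡ placed) }
        where
        e≡ : idx s found 0 ℕ.∸ 1 ≡ toℕ e
        e≡ = ≡.cong (ℕ._∸ 1) found≡

      Inv : ℕ → State → Set κ
      Inv k s = idx s current 0 ≡ toℕ (at isPath k) × idx s previous 0 ≡ lastEdge k × Placed k s

      place settle : Code
      place = placeNode (scalarᵢ outer) ⨾ placeEdge (scalarᵢ outer)
      settle = current ≔ᵢ scalarᵢ next ⨾ previous ≔ᵢ scalarᵢ found

      place-correct : ∀ {s} t → idx s outer 0 ≡ toℕ t → Loaded s → idx s current 0 ≡ toℕ (at isPath (toℕ t)) →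
        idx s found 0 ≡ suc (toℕ (edge isPath t)) → Placed (toℕ t) s → Placed (suc (toℕ t)) (exec place s)
      place-correct {s} t outer≡ l current≡ found≡ (placedⁿ , placedᵉ) =
        let s₁ = exec (placeNode (scalarᵢ outer)) s
            newⁿ , keptⁿ = placeNode-correct {s} (scalarᵢ outer) outer≡ outer≡ l current≡
            newᵉ , keptᵉ = placeEdge-correct {s₁} {e = edge isPath t} outer≡
                             (loaded-agrees (exec-agrees (placeNode (scalarᵢ outer)) s) l) found≡
        in <suc-elim (PlacedNode (exec place s))
             (λ j<k → nodes-kept (keptⁿ (ℕ.>⇒≢ j<k) (placedⁿ j<k))) (nodes-kept newⁿ) ,
           λ u u<1+t → Sum.[ (λ u<t → keptᵉ (ℕ.>⇒≢ u<t) (edges-kept (placedᵉ u u<t)))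
                           , (λ u≡t → ≡.subst (λ t → PlacedEdge (exec place s) (toℕ t) (edge isPath t))
                                        (toℕ-injective (≡.sym u≡t)) newᵉ) ]′
                           (ℕ.m≤n⇒m<n∨m≡n (ℕ.≤-pred u<1+t))
        where
        nodes-kept : ∀ {j} → PlacedNode (exec (placeNode (scalarᵢ outer)) s) j → PlacedNode (exec place s) j
        nodes-kept placed = record { order≡ = order≡ placed ; weight≡ = weight≡ placed }
        edges-kept : ∀ {j e} → PlacedEdge s j e → PlacedEdge (exec (placeNode (scalarᵢ outer)) s) j e
        edges-kept placed = record
          { order≡ = order≡ placed ; length≡ = length≡ placed ; bound≡ = bound≡ placed ; cost≡ = cost≡ placed }

      advance-correct : ∀ {s} t → idx s outer 0 ≡ toℕ t → Loaded s → Inv (toℕ t) s → Inv (suc (toℕ t)) (exec advance s)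
      advance-correct {s} t outer≡ l (current≡ , previous≡ , placed) =
        let s₁ = exec scan s
            found≡ , next≡ = departs⇒next t (departs {s} {at isPath (toℕ t)} l current≡ previous≡)
            placed₁ = placed-agrees (exec-agrees scan s) placed
            placed₂ = place-correct {s₁} t (≡.trans (exec-idx scan s outer 0 _) outer≡)
                        (loaded-agrees (exec-agrees scan s) l)
                        (≡.trans (exec-idx scan s current 0 _) current≡) found≡ placed₁
        in next≡ , ≡.trans found≡ (≡.cong suc (≡.sym (edgeNumber≡ t))) ,
           placed-agrees (exec-agrees settle (exec place s₁)) placed₂

      traverse-correct : ∀ {s} → Loaded s → toℕ (at isPath 0) ≡ idx s endpoint 0 →
        let s′ = exec traverse s in
        (∀ {k} → k ℕ.≤ m → PlacedNode s′ k) × (∀ t → PlacedEdge s′ (toℕ t) (edge isPath t))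
      traverse-correct {s} l start≡ =
        let current≡ , _ , placedⁿ , placedᵉ = final
            new , kept = placeNode-correct {s₂} (scalarᵢ edgeCount) edges₂≡ edges₂≡ (loaded-agrees ag₂ l₁) current≡
        in (λ {k} k≤m → Sum.[ (λ k<m → kept (ℕ.>⇒≢ k<m) (placedⁿ k<m))
                            , (λ k≡m → ≡.subst (PlacedNode (exec (placeNode (scalarᵢ edgeCount)) s₂)) (≡.sym k≡m) new) ]′
                            (ℕ.m≤n⇒m<n∨m≡n k≤m)) ,
           λ t → edges-kept (placedᵉ t (toℕ<n t))
        where
        initialise advancing : Code
        initialise = current ≔ᵢ scalarᵢ endpoint ⨾ previous ≔ᵢ lit 0
        advancing = FOR outer BELOW edgeCount DO advance
        s₁ = exec initialise s
        s₂ = exec advancing s₁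
        l₁ = loaded-agrees (exec-agrees initialise s) l
        ag₂ = exec-agrees advancing s₁
        edges₂≡ : idx s₂ edgeCount 0 ≡ m
        edges₂≡ = ≡.trans (exec-idx advancing s₁ edgeCount 0 _) (edges≡ l₁)
        step : ∀ n s′ → n ℕ.< idx s₁ edgeCount 0 → Agrees advancing s₁ s′ → idx s′ outer 0 ≡ n → Inv n s′ →
               Inv (suc n) (tick outer (exec advance s′))
        step n s′ n< ag n≡ inv =
          let n<m = ≡.subst (n ℕ.<_) (edges≡ l₁) n<
              n≡t = ≡.sym (toℕ-fromℕ< n<m)
              current≡ , previous≡ , placed = ≡.subst (λ n → Inv (suc n) (exec advance s′)) (≡.sym n≡t)
                (advance-correct {s′} (fromℕ< n<m) (≡.trans n≡ n≡t) (loaded-agrees ag l₁)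
                  (≡.subst (λ n → Inv n s′) n≡t inv))
          in current≡ , previous≡ , ticked placed
          where
          ticked : ∀ {k s} → Placed k s → Placed k (tick outer s)
          ticked (placedⁿ , placedᵉ) =
            (λ j<k → record { order≡ = order≡ (placedⁿ j<k) ; weight≡ = weight≡ (placedⁿ j<k) }) ,
            (λ t t<k → record { order≡ = order≡ (placedᵉ t t<k) ; length≡ = length≡ (placedᵉ t t<k)
                              ; bound≡ = bound≡ (placedᵉ t t<k) ; cost≡ = cost≡ (placedᵉ t t<k) })
        final : Inv m s₂
        final = ≡.subst (λ n → Inv n s₂) (edges≡ l₁)
          (for-invariant outer edgeCount advance s₁ Inv
            (≡.sym start≡ , ≡.refl , (λ ()) , λ _ ()) step)
        edges-kept : ∀ {j e} → PlacedEdge s₂ j e → PlacedEdge (exec (placeNode (scalarᵢ edgeCount)) s₂) j e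
        edges-kept placed = record
          { order≡ = order≡ placed ; length≡ = length≡ placed ; bound≡ = bound≡ placed ; cost≡ = cost≡ placed }

  -- From positions on the path back to the instance

  module PathOptimality (I : UpMCLP.Instance K)
    (isPath : IsPath (UpMCLP.Instance.graph I)) where
    open UpMCLP.Instance I
    open IsPath isPath

    for-all-edges : ∀ {ℓ} (P : Edge → Set ℓ) → (∀ t → P (edge isPath t)) → ∀ e → P e
    for-all-edges P holds e = ≡.subst P (inverseʳ edgeAt) (holds (Inverse.from edgeAt e))

    below-edges : ∀ {ℓ} (P : ℕ → Set ℓ) → (∀ (t : Fin #edges) → P (toℕ t)) → ∀ {k} → k ℕ.< #edges → P k
    below-edges P holds k<m = ≡.subst P (toℕ-fromℕ< k<m) (holds (fromℕ< k<m))

    record Copies (L U C W : ℕ → Carrier) : Set κ where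
      field
        length≡ : ∀ t → L (toℕ t) ≡ len (edge isPath t)
        bound≡  : ∀ t → U (toℕ t) ≡ bound (edge isPath t)
        cost≡   : ∀ t → C (toℕ t) ≡ cost (edge isPath t)
        weight≡ : ∀ {k} → k ℕ.≤ #edges → W k ≡ weight (at isPath k)

      0≤U : ∀ {k} → k ℕ.< #edges → 0# ≤ U k
      0≤U = below-edges (λ k → 0# ≤ U k) λ t → ≤-resp refl (reflexive (≡.sym (bound≡ t))) (0≤bound _)

      U≤L : ∀ {k} → k ℕ.< #edges → U k ≤ L k
      U≤L = below-edges (λ k → U k ≤ L k) λ t →
        ≤-resp (reflexive (≡.sym (bound≡ t))) (reflexive (≡.sym (length≡ t))) (proj₁ (bound<len _))

      0≤C : ∀ {k} → k ℕ.< #edges → 0# ≤ C k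
      0≤C = below-edges (λ k → 0# ≤ C k) λ t → ≤-resp refl (reflexive (≡.sym (cost≡ t))) (proj₁ (0<cost _))

      0≤W : ∀ {k} → k ℕ.≤ #edges → 0# ≤ W k
      0≤W k≤m = ≤-resp refl (reflexive (≡.sym (weight≡ k≤m))) (0≤weight _)

    -- Optimality among all feasible solutions.

    module Optimality {L U C W} (copies : Copies L U C W) {σ} (sorting : Sorting #edges C σ) where
      open Copies copies
      open Search #edges L U C W radius budget σ 0≤U 0≤C 0≤W (proj₁ 0<radius) (proj₁ 0<budget) sorting
        using (total; expense; Reaches; Affordable; Reconstructed; from; intervalWeight; total-cong)
      open UpMCLP K using (IsCoverage; totalWeight; HasValue; IsFeasible; IsOptimal)

      private
        m : ℕ
        m = #edges
        pos : Node → ℕ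
        pos = position isPath

      sum-edges : ∀ {δ : Edge → Carrier} {D : ℕ → Carrier} → (∀ t → D (toℕ t) ≡ δ (edge isPath t)) →
                  sum (λ e → cost e * δ e) ≈ sumTo m (λ k → C k * D k)
      sum-edges {δ} {D} D≡ = trans (sum-permute (λ e → cost e * δ e) edgeAt)
        (trans (sum-cong-≋ {m} λ t → *-cong (reflexive (≡.sym (cost≡ t))) (reflexive (≡.sym (D≡ t))))
               (sym (sumTo≈sum m (λ k → C k * D k))))

      coveredWeight : Subset #nodes → ℕ → Carrier
      coveredWeight S k = if lookup S (at isPath k) then W k else 0#

      totalWeight≈ : ∀ S → totalWeight I S ≈ sumTo (suc m) (coveredWeight S)
      totalWeight≈ S = trans (sum-permute (λ i → if lookup S i then weight i else 0#) nodeAt)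
        (trans (sum-cong-≋ {suc m} λ k → reflexive (≡.trans
                  (≡.cong (λ i → if lookup S i then weight i else 0#) (≡.sym (at-toℕ isPath k)))
                  (≡.cong (λ w → if lookup S (at isPath (toℕ k)) then w else 0#)
                     (≡.sym (weight≡ (ℕ.≤-pred (toℕ<n k)))))))
               (sym (sumTo≈sum (suc m) (coveredWeight S))))

      0≤coveredWeight : ∀ S {k} → k ℕ.≤ m → 0# ≤ coveredWeight S k
      0≤coveredWeight S {k} k≤m with lookup S (at isPath k)
      ... | true  = 0≤W k≤m
      ... | false = ≤-refl

      module _ {δ : Edge → Carrier} {D : ℕ → Carrier} (D≡ : ∀ t → D (toℕ t) ≡ δ (edge isPath t))
               (D≤U : ∀ {k} → k ℕ.< m → D k ≤ U k) where

        gap : ℕ → Carrier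
        gap k = L k - D k

        gap≈ : ∀ t → gap (toℕ t) ≈ len (edge isPath t) - δ (edge isPath t)
        gap≈ t = reflexive (≡.cong₂ _-_ (length≡ t) (D≡ t))

        0≤gap : ∀ {k} → k ℕ.< m → 0# ≤ gap k
        0≤gap k<m = x≤y⇒0≤y-x (≤-trans (D≤U k<m) (U≤L k<m))

        module Cover = Coverage I isPath δ gap gap≈ 0≤gap
        open Cover using (φ; Near; φ-mono)

        private
          total-length : ∀ a x → total a x L ≈ total a x gap + total a x D
          total-length a x = trans
            (total-cong {a} {x} λ {k} _ _ → sym (x-y+y≈x (L k) (D k)))
            (trans (sumTo-cong m λ {k} _ → onlyIn-+ a x k gap D) (sumTo-+ m (onlyIn a x gap) (onlyIn a x D)))

        -- The difference of the coordinates is the interval sum of L - D, so nearness and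
        -- sufficient reduction are one inequality in two arrangements.
        near⇒enough : ∀ {a x} → a ℕ.≤ x → x ℕ.≤ m → φ x ≤ φ a + radius → total a x L ≤ radius + total a x D
        near⇒enough {a} {x} a≤x x≤m near = ≤-resp (sym (total-length a x)) refl (+-monoˡ-≤ _
          (+-cancelʳ-≤ (φ a) (≤-resp (trans (sym (sumTo-onlyIn gap a≤x x≤m)) (+-comm _ _)) (+-comm _ _) near)))

        enough⇒near : ∀ {a x} → a ℕ.≤ x → x ℕ.≤ m → total a x L ≤ radius + total a x D → φ x ≤ φ a + radius
        enough⇒near {a} {x} a≤x x≤m enough = ≤-resp (sumTo-onlyIn gap a≤x x≤m) refl (+-monoʳ-≤ (φ a)
          (+-cancelʳ-≤ (total a x D) (≤-resp (total-length a x) refl enough)))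

        near-refl : ∀ x → Near x x
        near-refl x = x≤x+y (proj₁ 0<radius) , x≤x+y (proj₁ 0<radius)

        -- Coordinates are monotone, so k is bounded by b from above and by a from below; on which
        -- side of x it lies does not matter.
        near-interval : ∀ {a x b k} → a ℕ.≤ x → x ℕ.≤ b → b ℕ.≤ m → φ x ≤ φ a + radius → φ b ≤ φ x + radius →
                        a ℕ.≤ k → k ℕ.≤ b → Near k x
        near-interval {a} {x} {b} {k} a≤x x≤b b≤m left right a≤k k≤b =
          ≤-trans (φ-mono k≤b b≤m) right ,
          ≤-trans left (+-monoˡ-≤ _ (φ-mono a≤k (ℕ.≤-trans k≤b b≤m)))

      module _ {a x b D} (aff : Affordable a x b)
               (best : ∀ {a′ x′ b′} → Affordable a′ x′ b′ → intervalWeight a′ b′ ≤ intervalWeight a b)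
               (reconstructed : Reconstructed a x b D)
               (δ : Edge → Carrier) (D≡ : ∀ t → D (toℕ t) ≡ δ (edge isPath t)) where
        open Affordable aff
        open Reconstructed reconstructed

        private
          module C₀ = Cover {δ} {D} D≡ bounded
          centre : Node
          centre = at isPath x
          x≤m : x ℕ.≤ m
          x≤m = ℕ.≤-trans x≤b b≤m

          near? : ∀ k → Dec (C₀.Near k x)
          near? k = (C₀.φ k ≤? C₀.φ x + radius) ×-dec (C₀.φ x ≤? C₀.φ k + radius)

          -- `HasValue` asks for the covered set itself. It may be larger than the interval, and
          -- decidable nearness provides it.
          covered : Subset #nodes
          covered = tabulate λ i → ⌊ near? (pos i) ⌋

          covered-true : ∀ {i} → C₀.Near (pos i) x → lookup covered i ≡ true
          covered-true {i} near = ≡.trans (lookup∘tabulate (λ i → ⌊ near? (pos i) ⌋) i)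
            (≡.trans (isYes≗does (near? (pos i))) (dec-true (near? (pos i)) near))

          true-covered : ∀ {i} → lookup covered i ≡ true → C₀.Near (pos i) x
          true-covered {i} eq with near? (pos i) | ≡.trans (≡.sym (lookup∘tabulate (λ i → ⌊ near? (pos i) ⌋) i)) eq
          ... | yes near | _ = near

          coverage : IsCoverage I ⁅ centre ⁆ δ covered
          coverage i = mk⇔
            (λ i∈ → C₀.near⇒covered (x∈⁅x⁆ centre)
              (≡.subst (C₀.Near (pos i)) (≡.sym (position-at isPath x≤m)) (true-covered ([]=⇒lookup i∈))))
            (λ cov → lookup⇒[]= i covered (covered-true
              (≡.subst (C₀.Near (pos i)) (position-at isPath x≤m)
                (C₀.covered⇒near {X = ⁅ centre ⁆} (x∈⁅y⁆⇒x≡y centre) cov))))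

          interval≤ : intervalWeight a b ≤ totalWeight I covered
          interval≤ = ≤-resp refl (sym (totalWeight≈ covered)) (≤-trans
            (sumTo-mono (suc b) λ {k} k≤b → term k (ℕ.≤-pred k≤b))
            (sumTo-extend (s≤s b≤m) λ _ k<1+m → 0≤coveredWeight covered (ℕ.≤-pred k<1+m)))
            where
            term : ∀ k → k ℕ.≤ b → from a W k ≤ coveredWeight covered k
            term k k≤b with a ℕ.≤ᵇ k in a≤ᵇk
            ... | false = 0≤coveredWeight covered (ℕ.≤-trans k≤b b≤m)
            ... | true  = ≤-reflexive (reflexive (≡.cong (λ c → if c then W k else 0#) (≡.sym (covered-true
              (≡.subst (λ j → C₀.Near j x) (≡.sym (position-at isPath (ℕ.≤-trans k≤b b≤m)))
                (near-interval {δ} {D} D≡ bounded a≤x x≤b b≤m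
                  (enough⇒near {δ} {D} D≡ bounded a≤x x≤m (proj₁ covers))
                  (enough⇒near {δ} {D} D≡ bounded x≤b b≤m (proj₂ covers))
                  (≤ᵇ≡true⇒≤ a≤ᵇk) k≤b))))))

          feasible : p ≡ 1 → IsFeasible I (⁅ centre ⁆ , δ)
          feasible p≡1 = record
            { ∣X∣≡p        = ≡.trans (∣⁅x⁆∣≡1 centre) (≡.sym p≡1)
            ; 0≤δ          = for-all-edges (λ e → 0# ≤ δ e) λ t →
                ≤-resp refl (reflexive (D≡ t)) (nonNegative (toℕ<n t))
            ; δ≤bound      = for-all-edges (λ e → δ e ≤ bound e) λ t →
                ≤-resp (reflexive (D≡ t)) (reflexive (bound≡ t)) (bounded (toℕ<n t))
            ; withinBudget = ≤-resp (sym (sum-edges D≡)) refl withinBudget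
            }

          module Competitor (p≡1 : p ≡ 1) (X : Subset #nodes) (δ* : Edge → Carrier) (S : Subset #nodes)
                            (feasible* : IsFeasible I (X , δ*)) (coverage* : IsCoverage I X δ* S) where
            module F = IsFeasible feasible*
            D* : ℕ → Carrier
            D* = pad 0# (λ t → δ* (edge isPath t))
            D*≡ : ∀ t → D* (toℕ t) ≡ δ* (edge isPath t)
            D*≡ = pad-toℕ 0# (λ t → δ* (edge isPath t))
            0≤D* : ∀ {k} → k ℕ.< m → 0# ≤ D* k
            0≤D* = below-edges (λ k → 0# ≤ D* k) λ t → ≤-resp refl (reflexive (≡.sym (D*≡ t))) (F.0≤δ _)
            D*≤U : ∀ {k} → k ℕ.< m → D* k ≤ U k
            D*≤U = below-edges (λ k → D* k ≤ U k) λ t →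
              ≤-resp (reflexive (≡.sym (D*≡ t))) (reflexive (≡.sym (bound≡ t))) (F.δ≤bound _)
            module C* = Cover {δ*} {D*} D*≡ D*≤U

            single = ∣p∣≡1⇒singleton X (≡.trans F.∣X∣≡p p≡1)
            x* = proj₁ single
            c = pos x*
            c≤m = position≤m isPath x*
            inS : ℕ → Bool
            inS k = lookup S (at isPath k)

            inS⇒near : ∀ {k} → k ℕ.≤ m → inS k ≡ true → C*.Near k c
            inS⇒near {k} k≤m eq = ≡.subst (λ j → C*.Near j c) (position-at isPath k≤m)
              (C*.covered⇒near {X = X} (proj₂ (proj₂ single)) (Equivalence.to (coverage* (at isPath k)) (lookup⇒[]= _ S eq)))

            -- A centre covers itself; this puts it inside the hull of the nodes that it covers.
            centre-inS : inS c ≡ true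
            centre-inS = ≡.trans (≡.cong (lookup S) (at-position isPath x*))
              ([]=⇒lookup (Equivalence.from (coverage* x*)
                (C*.near⇒covered (proj₁ (proj₂ single)) (near-refl {δ*} {D*} D*≡ D*≤U c))))

            reaches : ∀ {a b} → a ℕ.≤ b → b ℕ.≤ m → C*.φ b ≤ C*.φ a + radius → Reaches a b D*
            reaches a≤b b≤m near = record
              { 0≤δ    = λ e<m _ _ → 0≤D* e<m
              ; δ≤U    = λ e<m _ _ → D*≤U e<m
              ; enough = near⇒enough {δ*} {D*} D*≡ D*≤U a≤b b≤m near
              }

            -- The sides of the centre share no edge, and edges on neither side have non-negative
            -- cost.
            expenses : ∀ a b → expense a c D* + expense c b D* ≤ budget
            expenses a b = ≤-trans (≤-resp (sumTo-+ m _ _) refl (sumTo-mono m term))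
              (≤-resp (sum-edges D*≡) refl F.withinBudget)
              where
              cost* : ℕ → Carrier
              cost* k = C k * D* k
              term : ∀ {k} → k ℕ.< m → onlyIn a c cost* k + onlyIn c b cost* k ≤ cost* k
              term {k} k<m with locate a c k | locate c b k
              ... | inj₁ (a≤k , k<c) | _ = ≤-reflexive (trans (+-cong (reflexive (onlyIn-inside cost* a≤k k<c))
                (reflexive (onlyIn-outside {c} {b} cost* (inj₁ k<c)))) (+-identityʳ _))
              ... | inj₂ k∉ | inj₁ (c≤k , k<b) = ≤-reflexive (trans (+-cong (reflexive (onlyIn-outside {a} {c} cost* k∉))
                (reflexive (onlyIn-inside cost* c≤k k<b))) (+-identityˡ _))
              ... | inj₂ k∉ | inj₂ k∉′ = ≤-resp (sym (trans (+-cong (reflexive (onlyIn-outside {a} {c} cost* k∉))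
                (reflexive (onlyIn-outside {c} {b} cost* k∉′))) (+-identityʳ 0#))) refl
                (*-nonNegative (0≤C k<m) (0≤D* k<m))

            -- The hull of the covered positions weighs at least as much as `S`. Its two ends are
            -- covered, so the competitor's own reductions show that it is affordable, and the
            -- champion dominates it.
            weight≤ : totalWeight I S ≤ intervalWeight a b
            weight≤ with first-true inS (suc c) | last-true inS m c≤m centre-inS
            ... | inj₁ none | _ = contradiction (≡.trans (≡.sym centre-inS) (none ℕ.≤-refl)) (λ ())
            ... | inj₂ (a* , s≤s a≤c , a-in , before) | b* , c≤b , b≤m′ , b-in , after = ≤-trans
              (≤-resp (sym (totalWeight≈ S)) refl (≤-trans
                (≤-reflexive (sumTo-truncate (s≤s b≤m′) λ b<k k<1+m →
                  reflexive (≡.cong (λ c → if c then W _ else 0#) (after b<k (ℕ.≤-pred k<1+m)))))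
                (sumTo-mono (suc b*) λ {k} k<1+b → term k (ℕ.≤-trans (ℕ.≤-pred k<1+b) b≤m′))))
              (best record
                { a≤x = a≤c ; x≤b = c≤b ; b≤m = b≤m′
                ; reachesˡ = reaches a≤c c≤m (proj₂ (inS⇒near (ℕ.≤-trans a≤c c≤m) a-in))
                ; reachesʳ = reaches c≤b b≤m′ (proj₁ (inS⇒near b≤m′ b-in))
                ; affords  = expenses a* b*
                })
              where
              term : ∀ k → k ℕ.≤ m → coveredWeight S k ≤ from a* W k
              term k k≤m with ℕ.<-≤-connex k a*
              ... | inj₁ k<a rewrite before k<a with a* ℕ.≤ᵇ k
              ...   | true  = 0≤W k≤m
              ...   | false = ≤-refl
              term k k≤m | inj₂ a≤k rewrite T⇒≡ (ℕ.≤⇒≤ᵇ a≤k) with inS k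
              ...   | true  = ≤-refl
              ...   | false = 0≤W k≤m

        isOptimal : p ≡ 1 → IsOptimal I (⁅ centre ⁆ , δ)
        isOptimal p≡1 = feasible p≡1 , totalWeight I covered , (covered , coverage , refl) ,
          λ { (X , δ*) v feasible* (S , coverage* , S≈v) → ≤-resp S≈v refl
                (≤-trans (Competitor.weight≤ p≡1 X δ* S feasible* coverage*) interval≤) }

  -- The complete algorithm and its cubic bound.

  module Solver (I : UpMCLP.Instance K) where
    open PathInput I
    open UpMCLP.Instance I
    open SingleFacility K using (input; OutputsOptimum; Solves_within_)

    module _ (isPath : IsPath graph) where
      open Traversal isPath hiding (Inv)

      emit-correct : ∀ {s} → idx s edgeCount 0 ≡ #edges →
        (∀ t → idx s edgeOrder (toℕ t) ≡ toℕ (edge isPath t)) →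
        (∀ t → num (exec emit s) reductions (toℕ (edge isPath t)) ≡ num s reductionAt (toℕ t)) ×
        idx (exec emit s) facility 0 ≡ idx s nodeOrder (idx s bestCentre 0)
      emit-correct {s} edges≡ order≡ =
        (λ t → ≡.subst (λ n → Inv n (exec writing s)) edges≡
          (for-invariant inner edgeCount outputReduction s Inv (λ _ ()) step) t (toℕ<n t)) ,
        ≡.trans (≡.cong (idx (exec writing s) nodeOrder) (exec-idx writing s bestCentre 0 _))
                (exec-idx writing s nodeOrder _ _)
        where
        writing : Code
        writing = FOR inner BELOW edgeCount DO outputReduction
        Inv : ℕ → State → Set κ
        Inv n s′ = ∀ t → toℕ t ℕ.< n → num s′ reductions (toℕ (edge isPath t)) ≡ num s reductionAt (toℕ t)
        step : ∀ n s′ → n ℕ.< idx s edgeCount 0 → Agrees writing s s′ → idx s′ inner 0 ≡ n → Inv n s′ →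
               Inv (suc n) (tick inner (exec outputReduction s′))
        step n s′ n< ag n≡ inv t t<1+n with ℕ.m≤n⇒m<n∨m≡n (ℕ.≤-pred t<1+n)
        ... | inj₁ t<n = elsewhere
          -- Distinct positions hold distinct edges, so writing position n spares what was output
          -- before.
          (λ eq → ℕ.<⇒≢ t<n (≡.trans (≡.cong toℕ (≡.sym (edge-injective isPath (toℕ-injective
            (≡.trans (≡.sym position≡) eq))))) (toℕ-fromℕ< n<m))) (inv t t<n)
          where
          n<m : n ℕ.< #edges
          n<m = ≡.subst (n ℕ.<_) edges≡ n<
          position≡ : idx s′ edgeOrder (idx s′ inner 0) ≡ toℕ (edge isPath (fromℕ< n<m))
          position≡ = ≡.trans (idx≡ ag edgeOrder _) (≡.trans
            (≡.cong (idx s edgeOrder) (≡.trans n≡ (≡.sym (toℕ-fromℕ< n<m)))) (order≡ _))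
        ... | inj₂ t≡n = overwritten
          (≡.trans (idx≡ ag edgeOrder _) (≡.trans
            (≡.cong (idx s edgeOrder) (≡.trans n≡ (≡.sym t≡n))) (order≡ t)))
          (≡.trans (num≡ ag reductionAt _) (≡.cong (num s reductionAt) (≡.trans n≡ (≡.sym t≡n))))

      module Optimise {s₂ s₃ : State} (p≡1 : p ≡ 1) (loaded : Loaded s₂)
        (placedⁿ : ∀ {k} → k ℕ.≤ #edges → PlacedNode s₂ k)
        (placedᵉ : ∀ t → PlacedEdge s₂ (toℕ t) (edge isPath t))
        (ag : Agrees sortByCost s₂ s₃) (sorting : Sorting #edges (num s₂ costAt) (idx s₃ sorted)) where

        copies : PathOptimality.Copies I isPath (num s₂ lengthAt) (num s₂ boundAt) (num s₂ costAt) (num s₂ weightAt)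
        copies = record
          { length≡ = λ t → length≡ (placedᵉ t)
          ; bound≡  = λ t → bound≡ (placedᵉ t)
          ; cost≡   = λ t → cost≡ (placedᵉ t)
          ; weight≡ = λ k≤m → weight≡ (placedⁿ k≤m)
          }
        module Copied = PathOptimality.Copies copies
        open Search #edges (num s₂ lengthAt) (num s₂ boundAt) (num s₂ costAt) (num s₂ weightAt) radius budget
          (idx s₃ sorted) Copied.0≤U Copied.0≤C Copied.0≤W (proj₁ 0<radius) (proj₁ 0<budget) sorting

        holds : Holds s₃
        holds = record
          { edges≡  = ≡.trans (idx≡ ag edgeCount 0) (edges≡ loaded)
          -- The search wants one node more than edges; the bijective listing of the nodes gives
          -- this count.
          ; nodes≡  = ≡.trans (idx≡ ag nodeCount 0) (≡.trans (nodes≡ loaded) (≡.sym (↔⇒≡ (IsPath.nodeAt isPath))))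
          ; sorted≡ = λ _ → ≡.refl
          ; length≡ = λ k → num≡ ag lengthAt k
          ; bound≡  = λ k → num≡ ag boundAt k
          ; cost≡   = λ k → num≡ ag costAt k
          ; weight≡ = λ k → num≡ ag weightAt k
          ; radius≡ = ≡.trans (num≡ ag radius₀ 0) (radius≡ loaded)
          ; budget≡ = ≡.trans (num≡ ag budget₀ 0) (budget≡ loaded)
          }

        emit-optimal : ∀ {s₄ s₉} → Optimum s₄ →
          Reconstructed (idx s₄ bestLow 0) (idx s₄ bestCentre 0) (idx s₄ bestHigh 0) (num s₉ reductionAt) →
          idx s₉ edgeCount 0 ≡ #edges → idx s₉ bestCentre 0 ≡ idx s₄ bestCentre 0 →
          (∀ k → idx s₉ nodeOrder k ≡ idx s₂ nodeOrder k) → (∀ k → idx s₉ edgeOrder k ≡ idx s₂ edgeOrder k) →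
          OutputsOptimum I (exec emit s₉)
        emit-optimal {s₄} {s₉} (aff , best) reconstructed edges≡ centre≡ nodes-kept edges-kept = record
          { location = at isPath (idx s₄ bestCentre 0)
          ; stored   = ≡.trans (proj₂ emitted) (≡.trans (nodes-kept _) (≡.trans
              (≡.cong (idx s₂ nodeOrder) centre≡) (order≡ (placedⁿ (ℕ.≤-trans (x≤b aff) (b≤m aff))))))
          ; optimal  = PathOptimality.Optimality.isOptimal I isPath copies sorting aff best reconstructed
              (λ e → num (exec emit s₉) reductions (toℕ e)) (λ t → ≡.sym (proj₁ emitted t)) p≡1
          }
          where
          emitted = emit-correct {s₉} edges≡ (λ t → ≡.trans (edges-kept _) (order≡ (placedᵉ t)))

        optimise-correct :
          let s₄ = exec search s₃
              s₅ = exec shorten (exec selectLeft (exec resetReductions s₄))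
              s₆ = exec shorten (exec selectRight s₅)
          in OutputsOptimum I (exec emit s₆)
        optimise-correct =
          let s₄ = exec search s₃
              optimum = search-correct {s₃} holds
              h₄ = transfer (exec-agrees search s₃) holds
              s₅ = exec shorten (exec selectLeft (exec resetReductions s₄))
          in emit-optimal {s₄} {exec shorten (exec selectRight s₅)} optimum
               (reconstruct-correct {s₄} h₄ ≡.refl ≡.refl ≡.refl (proj₁ optimum))
               (≡.trans (kept edgeCount 0) (≡.trans (exec-idx search s₃ edgeCount 0 _)
                 (≡.trans (idx≡ ag edgeCount 0) (edges≡ loaded))))
               (kept bestCentre 0)
               (λ k → ≡.trans (kept nodeOrder k) (≡.trans (exec-idx search s₃ nodeOrder k _) (idx≡ ag nodeOrder k)))
               (λ k → ≡.trans (kept edgeOrder k) (≡.trans (exec-idx search s₃ edgeOrder k _) (idx≡ ag edgeOrder k)))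
          where
          kept : ∀ a k {_ : Preservesᵢ resetReductions a × Preservesᵢ shorten a ×
                            Preservesᵢ selectLeft a × Preservesᵢ selectRight a} →
            let s₄ = exec search s₃
                s₅ = exec shorten (exec selectLeft (exec resetReductions s₄))
            in idx (exec shorten (exec selectRight s₅)) a k ≡ idx s₄ a k
          kept a k {p , q , r , t} =
            let s₄ = exec search s₃
                s₅ = exec resetReductions s₄
                s₆ = exec selectLeft s₅
                s₇ = exec shorten s₆
            in ≡.trans (exec-idx shorten (exec selectRight s₇) a k q) (≡.trans (exec-idx selectRight s₇ a k t)
                 (≡.trans (exec-idx shorten s₆ a k q) (≡.trans (exec-idx selectLeft s₅ a k r)
                 (exec-idx resetReductions s₄ a k p))))

    input-loaded : Loaded (input I)
    input-loaded = record
      { nodes≡   = ≡.refl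
      ; edges≡   = ≡.refl
      ; end₁≡    = pad-toℕ 0 (λ e → toℕ (proj₁ (ends e)))
      ; end₂≡    = pad-toℕ 0 (λ e → toℕ (proj₂ (ends e)))
      ; lengths≡ = pad-toℕ 0# len
      ; weights≡ = pad-toℕ 0# weight
      ; bounds≡  = pad-toℕ 0# bound
      ; costs≡   = pad-toℕ 0# cost
      ; radius≡  = ≡.refl
      ; budget≡  = ≡.refl
      }

    module _ (isPath : IsPath graph) where
      private
        1+m≡n : suc #edges ≡ #nodes
        1+m≡n = ↔⇒≡ (IsPath.nodeAt isPath)

        1≤n : 1 ℕ.≤ #nodes
        1≤n = ≡.subst (1 ℕ.≤_) 1+m≡n (s≤s z≤n)

        input-limited : Limited 1≤n (input I)
        input-limited 0 _ = ℕ.≤-refl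
        input-limited 1 _ = ≡.subst (#edges ℕ.≤_) 1+m≡n (ℕ.n≤1+n #edges)
        input-limited (suc (suc _)) (s≤s ())

      solver-correct : p ≡ 1 → Solves_within_ I (compile solver) (timeFactor solver ℕ.* #nodes ℕ.^ 3)
      solver-correct p≡1 =
        let s₀ = input I
            s₁ = exec findEndpoint s₀
            s₂ = exec traverse s₁
            s₃ = exec sortByCost s₂
            s₄ = exec search s₃
            s₅ = exec resetReductions s₄
            s₆ = exec selectLeft s₅
            s₇ = exec shorten s₆
            s₈ = exec selectRight s₇
            s₉ = exec shorten s₈
            l₁ = limited-after findEndpoint {s = s₀} input-limited
            l₂ = limited-after traverse {s = s₁} l₁
            l₃ = limited-after sortByCost {s = s₂} l₂
            l₄ = limited-after search {s = s₃} l₃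
            l₅ = limited-after resetReductions {s = s₄} l₄
            l₆ = limited-after selectLeft {s = s₅} l₅
            l₇ = limited-after shorten {s = s₆} l₆
            l₈ = limited-after selectRight {s = s₇} l₇
            l₉ = limited-after shorten {s = s₈} l₈
            runs steps time≤ =
              run findEndpoint s₀ input-limited ▸′ run traverse s₁ l₁ ▸′ run sortByCost s₂ l₂ ▸′ run search s₃ l₃ ▸′
              run resetReductions s₄ l₄ ▸′ run selectLeft s₅ l₅ ▸′ run shorten s₆ l₆ ▸′
              run selectRight s₇ l₇ ▸′ run shorten s₈ l₈ ▸′ run emit s₉ l₉
            loaded₁ = loaded-agrees (exec-agrees findEndpoint s₀) input-loaded
            loaded₂ = loaded-agrees (exec-agrees traverse s₁) loaded₁
            -- From here on the listing that starts at the endpoint found replaces the given one.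
            isPath′ , first≡ = findEndpoint-correct {s₀} input-loaded isPath
            placedⁿ , placedᵉ = Traversal.traverse-correct isPath′ {s₁} loaded₁ first≡
            sorting = ≡.subst (λ m → Sorting m (num s₂ costAt) (idx s₃ sorted)) (edges≡ loaded₂) (sortByCost-correct s₂)
            optimum = Optimise.optimise-correct isPath′ {s₂} {s₃} p≡1 loaded₂ placedⁿ placedᵉ
                        (exec-agrees sortByCost s₂) sorting
        in exec emit s₉ , _ , steps , time≤ , optimum
        where
        infixr 5 _▸′_
        _▸′_ : ∀ {c e s s′ s″} → Runs 1≤n 3 c s s′ → Runs 1≤n 3 e s′ s″ → Runs 1≤n 3 (c ⨾ e) s s″
        _▸′_ = _▸_ 1≤n {3}
        limited-after : ∀ c {ok : Nested 3 c} {s} → Limited 1≤n s → Limited 1≤n (exec c s)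
        limited-after c {ok} = limited-exec 1≤n 3 c ok
        run : ∀ c {ok : Nested 3 c} s → Limited 1≤n s → Runs 1≤n 3 c s (exec c s)
        run c {ok} = compile-correct 1≤n 3 c ok

open import Data.Nat.Base using (_*_; _^_)

theorem4 : ∀ {c ℓ₁ ℓ₂} →
    Σ Program λ algorithm → Σ ℕ λ C →
    (K : OrderedField c ℓ₁ ℓ₂) (I : UpMCLP.Instance K) →
    let open UpMCLP.Instance I in
    p ≡ 1 → IsPath graph →
    SingleFacility.Solves_within_ K I algorithm (C * #nodes ^ 3)
theorem4 = compile solver , timeFactor solver , λ K I p≡1 isPath → Solution.Solver.solver-correct K I isPath p≡1
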